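{- Let $m\ge 3$ and let $R_m$ be a ring of butterflies with $m$ links. Then every hinge of $R_m$ is an implied nonedge of $R_m$. Furthermore: if $m\ge 7$ then $R_m$ is nucleation-free; if $m\ge 6$ then $R_m$ is independent and has exactly $m-6$ independent flexes; and if $m\le 5$ then $R_m$ is dependent.
   Context: All graphs are finite and simple. Rank, independence, rigidity and circuits refer to the 3-dimensional generic rigidity matroid $\mathcal{R}_3$ on the edge set of the complete graph on the relevant vertex set; $\mathrm{rank}(G)$ is the rank of $E(G)$. A graph $G$ is independent if $\mathrm{rank}(G)=|E(G)|$ and dependent otherwise; it is rigid if $\mathrm{rank}(G)$ equals the rank of the complete graph on $V(G)$ (which is $3|V(G)|-6$ when $|V(G)|\ge 3$), and flexible otherwise. The number of independent flexes of $G$ is $3|V(G)|-6-\mathrm{rank}(G)$. For a set $F$ of vertex pairs, $G\cup F$ denotes $G$ with the pairs of $F$ having both endpoints in $V(G)$ added as edges. A nonedge $f$ of $G$ (a pair of distinct non-adjacent vertices) is implied if $G\cup f$ contains a circuit containing $f$. A nucleation of $G$ is a rigid subgraph of $G$ on at least $5$ vertices; $G$ is nucleation-free if it has no nucleation. Ring: given $m\ge 3$ vertex-disjoint graphs $G_1,\dots,G_m$ (links), each with four distinct designated hinge vertices $a_i,b_i,c_i,d_i$, the ring $R(G_1,\dots,G_m)$ is obtained by identifying $a_1$ with $c_m$, $b_1$ with $d_m$, and, for $1\le i\le m-1$, $c_i$ with $a_{i+1}$ and $d_i$ with $b_{i+1}$. The pairs $(a_i,b_i)$ and $(c_i,d_i)$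 are the hinges. A butterfly is the graph obtained from $K_5$ by deleting two non-incident edges; a ring of butterflies is a ring whose links are all butterflies, where in each link the two hinges $(a_i,b_i)$ and $(c_i,d_i)$ are the two deleted edges (so the hinges are nonedges). -}

module Defs where

open import Data.Nat as ℕ using (ℕ; zero; suc; _∸_; _≤_; _<_)
open import Data.Nat.DivMod using (_mod_)
open import Data.Fin as Fin using (Fin; toℕ; combine; _≟_)
open import Data.Fin.Subset using (Subset; ∣_∣) renaming (_∈_ to _∈ₛ_)
open import Data.List using (List; []; _∷_; length; lookup; allFin; concatMap)
open import Data.List.Membership.Propositional using (_∈_)
open import Data.List.Relation.Binary.Sublist.Propositional using (_⊆_)
open import Data.List.Relation.Unary.All using (All)
open import Data.Rational using (ℚ; 0ℚ; _+_; _*_; _-_)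
open import Data.Product using (Σ; _×_; _,_; ∃)
open import Data.Sum using (_⊎_)
open import Relation.Nullary using (¬_; yes; no)
open import Relation.Binary.PropositionalEquality using (_≡_)

Edge : ℕ → Set
Edge n = Fin n × Fin n

Placement : ℕ → Set
Placement n = Fin n → Fin 3 → ℚ

-- Entry (w , k) of the row of the rigidity matrix for the edge uv at p.
row : ∀ {n} → Placement n → Edge n → Fin n → Fin 3 → ℚ
row p (u , v) w k = a + b
  where
  a : ℚ
  a with w ≟ u
  ... | yes _ = p u k - p v k
  ... | no  _ = 0ℚ
  b : ℚ
  b with w ≟ v
  ... | yes _ = p v k - p u k
  ... | no  _ = 0ℚ

sumFin : ∀ {k} → (Fin k → ℚ) → ℚ
sumFin {zero}  f = 0ℚ
sumFin {suc k} f = f Fin.zero + sumFin (λ i → f (Fin.suc i))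

IndependentAt : ∀ {n} → Placement n → List (Edge n) → Set
IndependentAt p es =
  (c : Fin (length es) → ℚ) →
  (∀ w k → sumFin (λ i → c i * row p (lookup es i) w k) ≡ 0ℚ) →
  ∀ i → c i ≡ 0ℚ

-- Independence in the generic 3-dimensional rigidity matroid R₃:
-- the rigidity matrix has independent rows at some (equivalently at a
-- generic) placement.
Independent : ∀ {n} → List (Edge n) → Set
Independent {n} es = ∃ λ (p : Placement n) → IndependentAt p es

Dependent : ∀ {n} → List (Edge n) → Set
Dependent es = ¬ Independent es

HasIndepSubsetOfSize : ∀ {n} → List (Edge n) → ℕ → Set
HasIndepSubsetOfSize es k =
  ∃ λ sub → sub ⊆ es × length sub ≡ k × Independent sub

IsRank : ∀ {n} → List (Edge n) → ℕ → Set
IsRank es r = HasIndepSubsetOfSize es r × ¬ HasIndepSubsetOfSize es (suc r)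

IsCircuit : ∀ {n} → List (Edge n) → Set
IsCircuit C = Dependent C × (∀ C' → C' ⊆ C → length C' < length C → Independent C')

Adjacent : ∀ {n} → List (Edge n) → Fin n → Fin n → Set
Adjacent es u v = (u , v) ∈ es ⊎ (v , u) ∈ es

ImpliedNonedge : ∀ {n} → List (Edge n) → Edge n → Set
ImpliedNonedge es (u , v) =
  ¬ (u ≡ v) × ¬ Adjacent es u v ×
  ∃ λ C → C ⊆ ((u , v) ∷ es) × (u , v) ∈ C × IsCircuit C

-- A nucleation: a rigid subgraph (S , H) with |S| ≥ 5, i.e. rank H = 3|S| - 6.
NucleationFree : ∀ {n} → List (Edge n) → Set
NucleationFree {n} es =
  ¬ (Σ (Subset n) λ S → ∃ λ H →
       H ⊆ es × All (λ e → Data.Product.proj₁ e ∈ₛ S × Data.Product.proj₂ e ∈ₛ S) H ×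
       5 ≤ ∣ S ∣ × IsRank H (3 ℕ.* ∣ S ∣ ∸ 6))

-- The ring of butterflies with m links.
-- Vertex (i , t) is combine i t : Fin (m * 3), where for link i
-- t = 0,1 are the hinge vertices a_i , b_i (shared with c_{i-1}, d_{i-1})
-- and t = 2 is the fifth (non-hinge) vertex of the i-th butterfly.

next : ∀ {m} → Fin m → Fin m
next {suc k} i = suc (toℕ i) mod suc k

vtx : ∀ {m} → Fin m → Fin 3 → Fin (m ℕ.* 3)
vtx i t = combine i t

-- Edges of link i: K₅ on {a_i, b_i, c_i, d_i, z_i} minus a_i b_i and c_i d_i,
-- where c_i = a_{i+1}, d_i = b_{i+1} (indices mod m).
linkEdges : ∀ {m} → Fin m → List (Edge (m ℕ.* 3))
linkEdges i =
  (a , c) ∷ (a , d) ∷ (b , c) ∷ (b , d) ∷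
  (z , a) ∷ (z , b) ∷ (z , c) ∷ (z , d) ∷ []
  where
  a = vtx i Fin.zero
  b = vtx i (Fin.suc Fin.zero)
  z = vtx i (Fin.suc (Fin.suc Fin.zero))
  c = vtx (next i) Fin.zero
  d = vtx (next i) (Fin.suc Fin.zero)

ringEdges : (m : ℕ) → List (Edge (m ℕ.* 3))
ringEdges m = concatMap linkEdges (allFin m)

hinge : ∀ {m} → Fin m → Edge (m ℕ.* 3)
hinge i = vtx i Fin.zero , vtx i (Fin.suc Fin.zero)

{-# OPTIONS --safe #-}

-- If μ is an affine dependency of the five points of a butterfly, the products
-- μ u · μ v form a stress of K₅, that is, of the butterfly and its two hinges.
-- Scaling these stresses so that they cancel on all hinges but h gives a stress
-- of the ring and h, at every placement: independence is an open condition, so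
-- coincident hinge ends may be moved apart first.
-- Conversely, let m ≥ 6 and choose hinge lines that span all screws. The wrench
-- transmitted around the ring does no work in the rotations about the hinges,
-- so it is zero, and every stress is a combination of the K₅ stresses. With
-- apexes z = a + b + c - 2 d their scales double from each link to the next, so
-- one coefficient determines the stress: the ring and h form a circuit.
-- For m ≤ 5 the circuit is h and the ring without 6 - m apexes, which has
-- 3 n - 5 edges on n vertices. Finally, a set S of at least five vertices
-- induces at most 3 |S| - 7 edges when m ≥ 7, too few for a nucleation.

module Submission where

open import Defs
open import Algebra.Bundles using (CommutativeRing)
open import Algebra.Structures using (IsCommutativeRing)
import Algebra.Solver.Ring
import Algebra.Solver.Ring.AlmostCommutativeRing as ACR
open import Data.Maybe using (Maybe; just; nothing)
open import Data.Vec as Vec using (_∷_; [])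
import Data.Vec.Properties as Vecₚ
open import Data.Fin.Subset using (Subset; ∣_∣) renaming (_∈_ to _∈ₛ_)
open import Data.Bool using (Bool; true; false)
open import Data.Unit using (tt)
open import Data.Nat as ℕ using (ℕ; zero; suc; _≤_; _*_; _∸_; z≤n; s≤s)
import Data.Nat.Properties as ℕₚ
import Data.Nat.DivMod as ℕᵈ
import Data.Nat.Solver as ℕˢ
import Data.Nat.ListAction as ListAction
import Data.Nat.ListAction.Properties as ListActionₚ
open import Data.Integer as ℤ using (ℤ; +_; -[1+_])
import Data.Integer.Properties as ℤₚ
open import Data.Rational as ℚ using (ℚ; 0ℚ; 1ℚ)
import Data.Rational.Properties as ℚₚ
import Data.Rational.Unnormalised as ℚᵘ
import Data.Rational.Unnormalised.Properties as ℚᵘₚ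
open import Data.Rational.Literals using (fromℤ)
open import Data.Fin as Fin using (Fin; zero; suc; toℕ; combine; remQuot; punchIn; inject₁; fromℕ; fromℕ<)
import Data.Fin.Properties as Finₚ
open import Data.Fin.Patterns
open import Data.List as List using (List; []; _∷_; length; lookup; allFin; concatMap; tabulate; _++_)
import Data.List.Properties as Listₚ
open import Data.List.Relation.Unary.Any using (here; there; index)
open import Data.List.Relation.Unary.All as All using (All; []; _∷_)
open import Data.List.Membership.Propositional using (_∈_; find)
import Data.List.Relation.Unary.Any.Properties as Anyₚ
open import Data.List.Relation.Binary.Sublist.Propositional as Sub using (_⊆_; []; _∷_; _∷ʳ_)
import Data.List.Relation.Binary.Sublist.Propositional.Properties as Subₚ
open import Data.Product using (Σ; _×_; _,_; ∃; proj₁; proj₂; uncurry)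
open import Data.Sum using (_⊎_; inj₁; inj₂)
open import Function using (_∘_; id; case_of_)
open import Relation.Nullary using (¬_; Dec; yes; no; contradiction)
open import Relation.Nullary.Decidable using (True; toWitness; ¬?; _⊎-dec_; _×-dec_; _→-dec_)
open import Relation.Binary.PropositionalEquality using (_≡_; _≢_; refl; sym; trans; cong; cong₂; subst; subst₂; module ≡-Reasoning)
import Data.List.Membership.DecPropositional as DecMembership
open import Data.Fin.Relation.Unary.Top using (view; ‵fromℕ; ‵inject₁)
import Data.Fin.Induction as FinInd
open import Data.List.Membership.Propositional.Properties using (∈-lookup; ∈-concatMap⁻)
open ℕˢ.+-*-Solver using () renaming (solve to ℕ-solve; _:+_ to _⊹_; _:*_ to _⊠ᴺ_; _:=_ to _≔_; con to kon)

-- `Dependent` speaks of all placements, `Independent` of one. So the dependence of the ring with a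
-- bar needs an argument uniform in the placement, whereas its proper sublists are all settled at a
-- single rational placement, where no nonzero stress has a zero coefficient. The uniform argument
-- is a count: the scales of the links and the bar are m + 1 unknowns for m hinge conditions. Its
-- one danger is a K₅ stress that vanishes on the whole butterfly, which forces coincident hinge
-- ends. The doubling is what keeps the ring itself independent: without a bar each scale would be 2
-- ^ m times itself, whereas a factor 1 would let equal scales form a stress. Six is the dimension
-- of the space of screws. Fewer hinges cannot span it, so a wrench can pass around the ring, and
-- the ring with h has 7 - m edges more than 9 m - 6. Dropping an apex removes four edges and three
-- coordinates, so 6 - m deletions reduce this excess to one. These three small cases are certified
-- by explicit integer motions.

fromℤ-+ : ∀ a b → fromℤ (a ℤ.+ b) ≡ fromℤ a ℚ.+ fromℤ b
fromℤ-+ a b = ℚₚ.toℚᵘ-injective (ℚᵘₚ.≃-trans (ℚᵘ.*≡* eq) (ℚᵘₚ.≃-sym (ℚₚ.toℚᵘ-homo-+ (fromℤ a) (fromℤ b))))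
  where
  eq : (a ℤ.+ b) ℤ.* + 1 ≡ (a ℤ.* + 1 ℤ.+ b ℤ.* + 1) ℤ.* + 1
  eq = cong (ℤ._* + 1) (sym (cong₂ ℤ._+_ (ℤₚ.*-identityʳ a) (ℤₚ.*-identityʳ b)))

fromℤ-* : ∀ a b → fromℤ (a ℤ.* b) ≡ fromℤ a ℚ.* fromℤ b
fromℤ-* a b = ℚₚ.toℚᵘ-injective (ℚᵘₚ.≃-trans (ℚᵘ.*≡* refl) (ℚᵘₚ.≃-sym (ℚₚ.toℚᵘ-homo-* (fromℤ a) (fromℤ b))))

fromℤ-neg : ∀ a → fromℤ (ℤ.- a) ≡ ℚ.- fromℤ a
fromℤ-neg (+ zero)  = refl
fromℤ-neg (+ suc n) = refl
fromℤ-neg -[1+ n ]  = refl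

fromℤ-injective : ∀ {a b} → fromℤ a ≡ fromℤ b → a ≡ b
fromℤ-injective = cong ℚ.numerator

infixl 6 _⊕_ _⊖_
infixl 7 _⊛_
infix  8 ⊝_

-- The operations of ℚ unfold on constructors, which defeats unification;
-- everything below works with opaque copies.
opaque
  _⊕_ _⊛_ : ℚ → ℚ → ℚ
  _⊕_ = ℚ._+_
  _⊛_ = ℚ._*_

  ⊝_ : ℚ → ℚ
  ⊝_ = ℚ.-_

-- Left transparent, so that it agrees definitionally with the subtraction `:-` of the ring solver.
_⊖_ : ℚ → ℚ → ℚ
x ⊖ y = x ⊕ ⊝ y

opaque
  unfolding _⊕_

  ⊕-unfold : ∀ x y → x ℚ.+ y ≡ x ⊕ y
  ⊕-unfold x y = refl

  ⊛-unfold : ∀ x y → x ℚ.* y ≡ x ⊛ y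
  ⊛-unfold x y = refl

  ⊖-unfold : ∀ x y → x ℚ.- y ≡ x ⊖ y
  ⊖-unfold x y = refl

  isCommutativeRing : IsCommutativeRing _≡_ _⊕_ _⊛_ ⊝_ 0ℚ 1ℚ
  isCommutativeRing = ℚₚ.+-*-isCommutativeRing

  fromℤ-⊕ : ∀ a b → fromℤ (a ℤ.+ b) ≡ fromℤ a ⊕ fromℤ b
  fromℤ-⊕ = fromℤ-+

  fromℤ-⊛ : ∀ a b → fromℤ (a ℤ.* b) ≡ fromℤ a ⊛ fromℤ b
  fromℤ-⊛ = fromℤ-*

  fromℤ-⊝ : ∀ a → fromℤ (ℤ.- a) ≡ ⊝ fromℤ a
  fromℤ-⊝ = fromℤ-neg

  ⊛-inverseˡ : ∀ x .{{_ : ℚ.NonZero x}} → (ℚ.1/ x) ⊛ x ≡ 1ℚ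
  ⊛-inverseˡ x = ℚₚ.*-inverseˡ x

  ∣⊕∣ : ∀ x y → ℚ.∣ x ⊕ y ∣ ℚ.≤ ℚ.∣ x ∣ ⊕ ℚ.∣ y ∣
  ∣⊕∣ = ℚₚ.∣p+q∣≤∣p∣+∣q∣

  ∣⊛∣ : ∀ x y → ℚ.∣ x ⊛ y ∣ ≡ ℚ.∣ x ∣ ⊛ ℚ.∣ y ∣
  ∣⊛∣ = ℚₚ.∣p*q∣≡∣p∣*∣q∣

  ∣⊝∣ : ∀ x → ℚ.∣ ⊝ x ∣ ≡ ℚ.∣ x ∣
  ∣⊝∣ = ℚₚ.∣-p∣≡∣p∣

  ⊕-mono-≤ : ∀ {x y z w} → x ℚ.≤ y → z ℚ.≤ w → x ⊕ z ℚ.≤ y ⊕ w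
  ⊕-mono-≤ = ℚₚ.+-mono-≤

  ⊛-monoʳ-≤ : ∀ x {y z} → 0ℚ ℚ.≤ x → y ℚ.≤ z → x ⊛ y ℚ.≤ x ⊛ z
  ⊛-monoʳ-≤ x 0≤x = ℚₚ.*-monoˡ-≤-nonNeg x {{ℚ.nonNegative 0≤x}}

commutativeRing : CommutativeRing _ _
commutativeRing = record { isCommutativeRing = isCommutativeRing }

open CommutativeRing commutativeRing using (+-assoc; +-comm; +-identityˡ; +-identityʳ; *-assoc; *-comm; *-identityˡ; *-identityʳ; distribˡ; zeroˡ; zeroʳ; +-congˡ; *-congˡ)

private
  -- With integer coefficients the solver normalises by computing in ℤ, while `con (+ 0)` and
  -- `con (+ 1)` still denote `0ℚ` and `1ℚ` by `refl`.
  morphism : ℤ.+-*-rawRing ACR.-Raw-AlmostCommutative⟶ ACR.fromCommutativeRing commutativeRing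
  morphism = record
    { ⟦_⟧ = fromℤ ; +-homo = fromℤ-⊕ ; *-homo = fromℤ-⊛ ; -‿homo = fromℤ-⊝ ; 0-homo = refl ; 1-homo = refl }

  coeff≟ : ∀ a b → Maybe (fromℤ a ≡ fromℤ b)
  coeff≟ a b with a ℤ.≟ b
  ... | yes eq = just (cong fromℤ eq)
  ... | no _   = nothing

open Algebra.Solver.Ring ℤ.+-*-rawRing (ACR.fromCommutativeRing commutativeRing) morphism coeff≟
  using (Polynomial; solve; _:=_; _:+_; _:*_; _:-_; :-_; con)

⊝0≡0 : ⊝ 0ℚ ≡ 0ℚ
⊝0≡0 = solve 0 (:- con (+ 0) := con (+ 0)) refl

-- Sums and linear algebra over ℚ

Vector : ℕ → Set
Vector n = Fin n → ℚ

∑ : ∀ {n} → Vector n → ℚ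
∑ {zero}  f = 0ℚ
∑ {suc n} f = f zero ⊕ ∑ (f ∘ suc)

sum-cong : ∀ {n} {f g : Vector n} → (∀ i → f i ≡ g i) → ∑ f ≡ ∑ g
sum-cong {zero}  eq = refl
sum-cong {suc n} eq = cong₂ _⊕_ (eq zero) (sum-cong (eq ∘ suc))

sum-zero : ∀ {n} {f : Vector n} → (∀ i → f i ≡ 0ℚ) → ∑ f ≡ 0ℚ
sum-zero {zero}  eq = refl
sum-zero {suc n} eq = trans (cong₂ _⊕_ (eq zero) (sum-zero (eq ∘ suc))) (+-identityˡ 0ℚ)

sum-+ : ∀ {n} (f g : Vector n) → ∑ (λ i → f i ⊕ g i) ≡ ∑ f ⊕ ∑ g
sum-+ {zero}  f g = sym (+-identityˡ 0ℚ)
sum-+ {suc n} f g = trans (+-congˡ (sum-+ (f ∘ suc) (g ∘ suc)))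
  (solve 4 (λ a b c d → (a :+ b) :+ (c :+ d) := (a :+ c) :+ (b :+ d)) refl _ _ _ _)

*-sum : ∀ {n} x (f : Vector n) → x ⊛ ∑ f ≡ ∑ (λ i → x ⊛ f i)
*-sum {zero}  x f = zeroʳ x
*-sum {suc n} x f = trans (distribˡ x _ _) (+-congˡ (*-sum x (f ∘ suc)))

sum-* : ∀ {n} (f : Vector n) x → ∑ f ⊛ x ≡ ∑ (λ i → f i ⊛ x)
sum-* f x = trans (*-comm _ x) (trans (*-sum x f) (sum-cong λ i → *-comm x (f i)))

sum-neg : ∀ {n} (f : Vector n) → ∑ (λ i → ⊝ f i) ≡ ⊝ ∑ f
sum-neg {zero}  f = sym ⊝0≡0
sum-neg {suc n} f = trans (+-congˡ (sum-neg (f ∘ suc))) (solve 2 (λ a b → :- a :+ :- b := :- (a :+ b)) refl _ _)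

sum-swap : ∀ {m n} (f : Fin m → Fin n → ℚ) →
  ∑ (λ i → ∑ (f i)) ≡ ∑ (λ j → ∑ (λ i → f i j))
sum-swap {zero} {n} f = sym (sum-zero {n} {λ _ → 0ℚ} λ _ → refl)
sum-swap {suc m} f = trans (+-congˡ (sum-swap (f ∘ suc))) (sym (sum-+ (f zero) _))

sum-punchIn : ∀ {n} i (f : Vector (suc n)) → ∑ f ≡ f i ⊕ ∑ (f ∘ punchIn i)
sum-punchIn         zero    f = refl
sum-punchIn {suc n} (suc i) f = trans (+-congˡ (sum-punchIn i (f ∘ suc)))
  (solve 3 (λ x y z → x :+ (y :+ z) := y :+ (x :+ z)) refl _ _ _)

sum-combine : ∀ {m n} (f : Vector (m * n)) →
  ∑ f ≡ ∑ (λ (i : Fin m) → ∑ (λ (j : Fin n) → f (combine i j)))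
sum-combine {zero}      f = refl
sum-combine {suc m} {n} f = trans (split n f) (+-congˡ (sum-combine {m} _))
  where
  split : ∀ k {l} (g : Vector (k ℕ.+ l)) →
    ∑ g ≡ ∑ (g ∘ (Fin._↑ˡ l)) ⊕ ∑ (g ∘ (k Fin.↑ʳ_))
  split zero    g = sym (+-identityˡ _)
  split (suc k) g = trans (+-congˡ (split k (g ∘ suc))) (sym (+-assoc _ _ _))

sum-combination : ∀ {m n} (a : Vector m) (b : Vector n) (f : Fin m → Fin n → ℚ) →
  ∑ (λ i → a i ⊛ ∑ (λ j → f i j ⊛ b j)) ≡
  ∑ (λ j → ∑ (λ i → a i ⊛ f i j) ⊛ b j)
sum-combination a b f = begin
  ∑ (λ i → a i ⊛ ∑ (λ j → f i j ⊛ b j))     ≡⟨ sum-cong (λ i → *-sum (a i) (λ j → f i j ⊛ b j)) ⟩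
  ∑ (λ i → ∑ (λ j → a i ⊛ (f i j ⊛ b j)))   ≡⟨ sum-swap (λ i j → a i ⊛ (f i j ⊛ b j)) ⟩
  ∑ (λ j → ∑ (λ i → a i ⊛ (f i j ⊛ b j)))   ≡⟨ sum-cong (λ j → sum-cong (λ i → *-assoc (a i) (f i j) (b j))) ⟨
  ∑ (λ j → ∑ (λ i → a i ⊛ f i j ⊛ b j))     ≡⟨ sum-cong (λ j → sum-* (λ i → a i ⊛ f i j) (b j)) ⟨
  ∑ (λ j → ∑ (λ i → a i ⊛ f i j) ⊛ b j)     ∎
  where open ≡-Reasoning

δ : ∀ {n} → Fin n → Fin n → ℚ
δ i j with i Fin.≟ j
... | yes _ = 1ℚ
... | no  _ = 0ℚ

δ-refl : ∀ {n} (i : Fin n) → δ i i ≡ 1ℚ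
δ-refl i with i Fin.≟ i
... | yes _  = refl
... | no i≢i = contradiction refl i≢i

δ-≢ : ∀ {n} {i j : Fin n} → i ≢ j → δ i j ≡ 0ℚ
δ-≢ {i = i} {j} i≢j with i Fin.≟ j
... | yes i≡j = contradiction i≡j i≢j
... | no _    = refl

δ-inj : ∀ {m n} (g : Fin m → Fin n) → (∀ {i j} → g i ≡ g j → i ≡ j) → ∀ i j → δ (g i) (g j) ≡ δ i j
δ-inj g inj i j with i Fin.≟ j
... | yes refl = δ-refl (g i)
... | no i≢j   = δ-≢ (i≢j ∘ inj)

δ-sym : ∀ {n} (i j : Fin n) → δ i j ≡ δ j i
δ-sym i j with i Fin.≟ j
... | yes refl = sym (δ-refl i)
... | no i≢j   = sym (δ-≢ (i≢j ∘ sym))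

sum-δ : ∀ {n} i (f : Vector n) → ∑ (λ j → δ i j ⊛ f j) ≡ f i
sum-δ {suc n} i f = begin
  ∑ (λ j → δ i j ⊛ f j)                                        ≡⟨ sum-punchIn i (λ j → δ i j ⊛ f j) ⟩
  δ i i ⊛ f i ⊕ ∑ (λ j → δ i (punchIn i j) ⊛ f (punchIn i j))  ≡⟨ cong₂ _⊕_ (cong (_⊛ f i) (δ-refl i)) (sum-zero vanish) ⟩
  1ℚ ⊛ f i ⊕ 0ℚ                                                     ≡⟨ +-identityʳ _ ⟩
  1ℚ ⊛ f i                                                          ≡⟨ *-identityˡ _ ⟩
  f i                                                               ∎
  where
  open ≡-Reasoning
  vanish : ∀ j → δ i (punchIn i j) ⊛ f (punchIn i j) ≡ 0ℚ
  vanish j = trans (cong (_⊛ f (punchIn i j)) (δ-≢ (Finₚ.punchInᵢ≢i i j ∘ sym))) (zeroˡ _)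

x⊛y≡0⇒y≡0 : ∀ {x y} → x ≢ 0ℚ → x ⊛ y ≡ 0ℚ → y ≡ 0ℚ
x⊛y≡0⇒y≡0 {x} {y} x≢0 eq = begin
  y                   ≡⟨ *-identityˡ y ⟨
  1ℚ ⊛ y              ≡⟨ cong (_⊛ y) (⊛-inverseˡ x) ⟨
  (ℚ.1/ x) ⊛ x ⊛ y    ≡⟨ *-assoc (ℚ.1/ x) x y ⟩
  (ℚ.1/ x) ⊛ (x ⊛ y)  ≡⟨ cong ((ℚ.1/ x) ⊛_) eq ⟩
  (ℚ.1/ x) ⊛ 0ℚ       ≡⟨ zeroʳ (ℚ.1/ x) ⟩
  0ℚ                  ∎
  where
  open ≡-Reasoning
  instance _ = ℚ.≢-nonZero x≢0

⊛-≢0 : ∀ {x y} → x ≢ 0ℚ → y ≢ 0ℚ → x ⊛ y ≢ 0ℚ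
⊛-≢0 x≢0 y≢0 = y≢0 ∘ x⊛y≡0⇒y≡0 x≢0

_∙_ : ∀ {n} → Vector n → Vector n → ℚ
x ∙ y = ∑ (λ i → x i ⊛ y i)

∙-+ʳ : ∀ {n} (x y z : Vector n) → x ∙ (λ i → y i ⊕ z i) ≡ x ∙ y ⊕ x ∙ z
∙-+ʳ x y z = trans (sum-cong λ i → distribˡ (x i) (y i) (z i)) (sum-+ (λ i → x i ⊛ y i) (λ i → x i ⊛ z i))

∙-*ʳ : ∀ {n} (x : Vector n) a (y : Vector n) → x ∙ (λ i → a ⊛ y i) ≡ a ⊛ x ∙ y
∙-*ʳ x a y = trans (sum-cong λ i → solve 3 (λ x a y → x :* (a :* y) := a :* (x :* y)) refl (x i) a (y i))
  (sym (*-sum a (λ i → x i ⊛ y i)))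

∙-comm : ∀ {n} (x y : Vector n) → x ∙ y ≡ y ∙ x
∙-comm x y = sum-cong λ i → *-comm (x i) (y i)

∙-zero : ∀ {n} (x y : Vector n) → (∀ i → x i ≡ 0ℚ ⊎ y i ≡ 0ℚ) → x ∙ y ≡ 0ℚ
∙-zero x y z = sum-zero λ i → vanish (x i) (y i) (z i)
  where
  vanish : ∀ a b → a ≡ 0ℚ ⊎ b ≡ 0ℚ → a ⊛ b ≡ 0ℚ
  vanish a b (inj₁ eq) = trans (cong (_⊛ b) eq) (zeroˡ b)
  vanish a b (inj₂ eq) = trans (cong (a ⊛_) eq) (zeroʳ a)

IsZero : ∀ {n} → Vector n → Set
IsZero x = ∀ i → x i ≡ 0ℚ

isZero? : ∀ {n} (x : Vector n) → IsZero x ⊎ ∃ λ i → x i ≢ 0ℚ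
isZero? x with Finₚ.all? (λ i → x i ℚₚ.≟ 0ℚ)
... | yes all = inj₁ all
... | no ¬all = inj₂ (Finₚ.¬∀⟶∃¬ _ _ (λ i → x i ℚₚ.≟ 0ℚ) ¬all)

Kills : ∀ {k n} → Vector k → (Fin k → Vector n) → Set
Kills c v = ∀ j → ∑ (λ i → c i ⊛ v i j) ≡ 0ℚ

NonTrivial : ∀ {k n} → (Fin k → Vector n) → Set
NonTrivial v = ∃ λ c → Kills c v × ∃ λ i → c i ≢ 0ℚ

-- Linear independence in positive form: a right inverse of the matrix with rows `v`. Unlike the
-- mere absence of relations it gives numbers to estimate with when the rows are perturbed.
Dual : ∀ {k n} → (Fin k → Vector n) → Set
Dual {k} {n} v = Σ (Fin k → Vector n) λ L → ∀ i j → v i ∙ L j ≡ δ i j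

-- Elimination of the first coordinate with a pivot `v i`, multiplying the other vectors by the
-- pivot entry `α` rather than dividing by it. A relation `c` of the reduced vectors lifts to `α`
-- times `c`, and the coefficient of the pivot is chosen to cancel the first coordinate.
nonTrivial : ∀ n (v : Fin (suc n) → Vector n) → NonTrivial v
nonTrivial zero    v = (λ _ → 1ℚ) , (λ ()) , zero , λ ()
nonTrivial (suc n) v with isZero? (λ i → v i zero)
... | inj₁ v₀≡0 =
  let c , kills , i , cᵢ≢0 = nonTrivial n (λ i j → v (suc i) (suc j))
      c′ : Vector (suc (suc n))
      c′ = λ { zero → 0ℚ ; (suc i) → c i }
      kills′ : Kills c′ v
      kills′ = λ
        { zero    → sum-zero {f = λ i → c′ i ⊛ v i zero} λ i → trans (cong (c′ i ⊛_) (v₀≡0 i)) (zeroʳ (c′ i))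
        ; (suc j) → trans (cong₂ _⊕_ (zeroˡ _) (kills j)) (+-identityˡ 0ℚ) }
  in c′ , kills′ , suc i , cᵢ≢0
... | inj₂ (i , vᵢ₀≢0) =
  let c , kills , k , cₖ≢0 = nonTrivial n w
  in c′ c , kills′ c kills , punchIn i k , λ eq → ⊛-≢0 vᵢ₀≢0 cₖ≢0 (trans (sym (c′-rest c k)) eq)
  where
  open ≡-Reasoning
  α : ℚ
  α = v i zero
  w : Fin (suc n) → Vector n
  w k j = α ⊛ v (punchIn i k) (suc j) ⊖ v (punchIn i k) zero ⊛ v i (suc j)
  rest : Vector (suc n) → Vector (suc (suc n)) → ℚ
  rest c x = ∑ (λ k → c k ⊛ x (punchIn i k))
  c′ : Vector (suc n) → Vector (suc (suc n))
  c′ c k with i Fin.≟ k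
  ... | yes _   = ⊝ rest c (λ k → v k zero)
  ... | no  i≢k = α ⊛ c (Fin.punchOut i≢k)
  c′-pivot : ∀ c → c′ c i ≡ ⊝ rest c (λ k → v k zero)
  c′-pivot c with i Fin.≟ i
  ... | yes _  = refl
  ... | no i≢i = contradiction refl i≢i
  c′-rest : ∀ c k → c′ c (punchIn i k) ≡ α ⊛ c k
  c′-rest c k with i Fin.≟ punchIn i k
  ... | yes eq = contradiction (sym eq) (Finₚ.punchInᵢ≢i i k)
  ... | no i≢  = cong (λ j → α ⊛ c j) (Finₚ.punchOut-punchIn i)
  expand : ∀ c (x : Vector (suc (suc n))) →
    ∑ (λ k → c′ c k ⊛ x k) ≡ α ⊛ rest c x ⊖ rest c (λ k → v k zero) ⊛ x i
  expand c x = begin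
    ∑ (λ k → c′ c k ⊛ x k)
      ≡⟨ sum-punchIn i (λ k → c′ c k ⊛ x k) ⟩
    c′ c i ⊛ x i ⊕ ∑ (λ k → c′ c (punchIn i k) ⊛ x (punchIn i k))
      ≡⟨ cong₂ _⊕_ (cong (_⊛ x i) (c′-pivot c))
           (sum-cong λ k → trans (cong (_⊛ x (punchIn i k)) (c′-rest c k)) (*-assoc α (c k) _)) ⟩
    ⊝ rest c (λ k → v k zero) ⊛ x i ⊕ ∑ (λ k → α ⊛ (c k ⊛ x (punchIn i k)))
      ≡⟨ +-congˡ (*-sum α (λ k → c k ⊛ x (punchIn i k))) ⟨
    ⊝ rest c (λ k → v k zero) ⊛ x i ⊕ α ⊛ rest c x
      ≡⟨ solve 3 (λ r x a → :- r :* x :+ a := a :- r :* x) refl (rest c (λ k → v k zero)) (x i) _ ⟩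
    α ⊛ rest c x ⊖ rest c (λ k → v k zero) ⊛ x i ∎
  kills′ : ∀ c → Kills c w → Kills (c′ c) v
  kills′ c kills zero    = trans (expand c (λ k → v k zero))
    (solve 2 (λ a r → a :* r :- r :* a := con (+ 0)) refl α _)
  kills′ c kills (suc j) = begin
    ∑ (λ k → c′ c k ⊛ v k (suc j))
      ≡⟨ expand c (λ k → v k (suc j)) ⟩
    α ⊛ rest c (λ k → v k (suc j)) ⊖ rest c (λ k → v k zero) ⊛ v i (suc j)
      ≡⟨ cong₂ _⊖_ (*-sum α x) (sum-* y (v i (suc j))) ⟩
    ∑ (λ k → α ⊛ x k) ⊖ ∑ (λ k → y k ⊛ v i (suc j))
      ≡⟨ cong (∑ (λ k → α ⊛ x k) ⊕_) (sum-neg (λ k → y k ⊛ v i (suc j))) ⟨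
    ∑ (λ k → α ⊛ x k) ⊕ ∑ (λ k → ⊝ (y k ⊛ v i (suc j)))
      ≡⟨ sum-+ (λ k → α ⊛ x k) (λ k → ⊝ (y k ⊛ v i (suc j))) ⟨
    ∑ (λ k → α ⊛ x k ⊖ y k ⊛ v i (suc j))
      ≡⟨ sum-cong (λ k → solve 5 (λ a c x y z → a :* (c :* x) :- c :* y :* z := c :* (a :* x :- y :* z)) refl
           α (c k) (v (punchIn i k) (suc j)) (v (punchIn i k) zero) (v i (suc j))) ⟩
    ∑ (λ k → c k ⊛ w k j)
      ≡⟨ kills j ⟩
    0ℚ ∎
    where
    x y : Vector (suc n)
    x k = c k ⊛ v (punchIn i k) (suc j)
    y k = c k ⊛ v (punchIn i k) zero

-- Subtract from the new vector `v₀` its expansion `s` in the others, read off with their duals. If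
-- the remainder `r` is zero this is a relation; otherwise a nonzero entry of `r` yields the missing
-- dual.
dependent-or-dual : ∀ {k n} (v : Fin k → Vector n) → NonTrivial v ⊎ Dual v
dependent-or-dual {zero}  v = inj₂ ((λ ()) , λ ())
dependent-or-dual {suc k} {n} v with dependent-or-dual (v ∘ suc)
... | inj₁ (c , kills , i , cᵢ≢0) =
  inj₁ ((λ { zero → 0ℚ ; (suc i) → c i }) , (λ j → trans (cong₂ _⊕_ (zeroˡ _) (kills j)) (+-identityˡ 0ℚ)) , suc i , cᵢ≢0)
... | inj₂ (L , dual) = result (isZero? r)
  where
  open ≡-Reasoning
  v₀ : Vector n
  v₀ = v zero
  s : Vector k
  s i = v₀ ∙ L i
  r : Vector n
  r j = v₀ j ⊖ ∑ (λ i → s i ⊛ v (suc i) j)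
  result : IsZero r ⊎ ∃ (λ j → r j ≢ 0ℚ) → NonTrivial v ⊎ Dual v
  result (inj₁ r≡0) = inj₁ (c , kills , zero , λ ())
    where
    c : Vector (suc k)
    c zero    = 1ℚ
    c (suc i) = ⊝ s i
    kills : Kills c v
    kills j = begin
      1ℚ ⊛ v₀ j ⊕ ∑ (λ i → ⊝ s i ⊛ v (suc i) j)
        ≡⟨ cong₂ _⊕_ (*-identityˡ (v₀ j)) (sum-cong λ i → solve 2 (λ a b → :- a :* b := :- (a :* b)) refl (s i) _) ⟩
      v₀ j ⊕ ∑ (λ i → ⊝ (s i ⊛ v (suc i) j))
        ≡⟨ cong (v₀ j ⊕_) (sum-neg (λ i → s i ⊛ v (suc i) j)) ⟩
      r j
        ≡⟨ r≡0 j ⟩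
      0ℚ ∎
  result (inj₂ (j , rⱼ≢0)) = inj₂ (L′ , dual′)
    where
    instance _ = ℚ.≢-nonZero rⱼ≢0
    -- The functional of coordinate `j`, corrected to vanish on the later vectors; its value on `v₀`
    -- is `r j`. After scaling it to `L₀`, multiples of it make the old duals vanish on `v₀`.
    x : Vector n
    x l = δ j l ⊕ ⊝ 1ℚ ⊛ ∑ (λ i → v (suc i) j ⊛ L i l)
    y∙x : ∀ y → y ∙ x ≡ y j ⊖ ∑ (λ i → v (suc i) j ⊛ (y ∙ L i))
    y∙x y = begin
      y ∙ x
        ≡⟨ ∙-+ʳ y (δ j) (λ l → ⊝ 1ℚ ⊛ ∑ (λ i → v (suc i) j ⊛ L i l)) ⟩
      y ∙ δ j ⊕ y ∙ (λ l → ⊝ 1ℚ ⊛ ∑ (λ i → v (suc i) j ⊛ L i l))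
        ≡⟨ cong₂ _⊕_ (trans (∙-comm y (δ j)) (sum-δ j y)) (∙-*ʳ y (⊝ 1ℚ) _) ⟩
      y j ⊕ ⊝ 1ℚ ⊛ y ∙ (λ l → ∑ (λ i → v (suc i) j ⊛ L i l))
        ≡⟨ cong (λ z → y j ⊕ ⊝ 1ℚ ⊛ z) (trans (∙-comm y _) (trans
             (sym (sum-combination (λ i → v (suc i) j) y L)) (sum-cong λ i → cong (v (suc i) j ⊛_) (∙-comm (L i) y)))) ⟩
      y j ⊕ ⊝ 1ℚ ⊛ ∑ (λ i → v (suc i) j ⊛ (y ∙ L i))
        ≡⟨ cong (y j ⊕_) (solve 1 (λ z → :- con (+ 1) :* z := :- z) refl _) ⟩
      y j ⊖ ∑ (λ i → v (suc i) j ⊛ (y ∙ L i)) ∎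
    L₀ : Vector n
    L₀ l = (ℚ.1/ r j) ⊛ x l
    L′ : Fin (suc k) → Vector n
    L′ zero    = L₀
    L′ (suc i) = λ l → L i l ⊕ ⊝ s i ⊛ L₀ l
    v₀∙L₀ : v₀ ∙ L₀ ≡ 1ℚ
    v₀∙L₀ = begin
      v₀ ∙ L₀                ≡⟨ ∙-*ʳ v₀ (ℚ.1/ r j) x ⟩
      (ℚ.1/ r j) ⊛ (v₀ ∙ x)  ≡⟨ cong ((ℚ.1/ r j) ⊛_) (trans (y∙x v₀) (cong (v₀ j ⊖_) (sum-cong λ i → *-comm (v (suc i) j) (s i)))) ⟩
      (ℚ.1/ r j) ⊛ r j       ≡⟨ ⊛-inverseˡ (r j) ⟩
      1ℚ                     ∎
    v₊∙L₀ : ∀ i → v (suc i) ∙ L₀ ≡ 0ℚ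
    v₊∙L₀ i = begin
      v (suc i) ∙ L₀
        ≡⟨ ∙-*ʳ (v (suc i)) (ℚ.1/ r j) x ⟩
      (ℚ.1/ r j) ⊛ (v (suc i) ∙ x)
        ≡⟨ cong ((ℚ.1/ r j) ⊛_) (y∙x (v (suc i))) ⟩
      (ℚ.1/ r j) ⊛ (v (suc i) j ⊖ ∑ (λ i′ → v (suc i′) j ⊛ (v (suc i) ∙ L i′)))
        ≡⟨ cong (λ z → (ℚ.1/ r j) ⊛ (v (suc i) j ⊖ z)) (trans
             (sum-cong λ i′ → trans (cong (v (suc i′) j ⊛_) (dual i i′)) (*-comm _ (δ i i′)))
             (sum-δ i (λ i′ → v (suc i′) j))) ⟩
      (ℚ.1/ r j) ⊛ (v (suc i) j ⊖ v (suc i) j)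
        ≡⟨ solve 2 (λ a b → a :* (b :- b) := con (+ 0)) refl (ℚ.1/ r j) (v (suc i) j) ⟩
      0ℚ ∎
    shift : ∀ y i → y ∙ L′ (suc i) ≡ y ∙ L i ⊕ ⊝ s i ⊛ (y ∙ L₀)
    shift y i = trans (∙-+ʳ y (L i) (λ l → ⊝ s i ⊛ L₀ l)) (+-congˡ (∙-*ʳ y (⊝ s i) L₀))
    dual′ : ∀ i j → v i ∙ L′ j ≡ δ i j
    dual′ zero    zero     = v₀∙L₀
    dual′ zero    (suc i)  = trans (shift v₀ i) (trans (cong (λ z → s i ⊕ ⊝ s i ⊛ z) v₀∙L₀)
      (solve 1 (λ s → s :+ :- s :* con (+ 1) := con (+ 0)) refl (s i)))
    dual′ (suc i) zero     = v₊∙L₀ i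
    dual′ (suc i) (suc i′) = begin
      v (suc i) ∙ L′ (suc i′)                             ≡⟨ shift (v (suc i)) i′ ⟩
      v (suc i) ∙ L i′ ⊕ ⊝ s i′ ⊛ (v (suc i) ∙ L₀)        ≡⟨ cong₂ (λ a b → a ⊕ ⊝ s i′ ⊛ b) (dual i i′) (v₊∙L₀ i) ⟩
      δ i i′ ⊕ ⊝ s i′ ⊛ 0ℚ                                ≡⟨ solve 2 (λ d s → d :+ :- s :* con (+ 0) := d) refl (δ i i′) (s i′) ⟩
      δ i i′                                              ≡⟨ δ-inj suc Finₚ.suc-injective i i′ ⟨
      δ (Fin.suc i) (suc i′)                              ∎

-- Stresses

sum-mono : ∀ {n} {f g : Vector n} → (∀ i → f i ℚ.≤ g i) → ∑ f ℚ.≤ ∑ g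
sum-mono {zero}  f≤g = ℚₚ.≤-refl
sum-mono {suc n} f≤g = ⊕-mono-≤ (f≤g zero) (sum-mono (f≤g ∘ suc))

∣sum∣≤ : ∀ {n} (f : Vector n) → ℚ.∣ ∑ f ∣ ℚ.≤ ∑ (λ i → ℚ.∣ f i ∣)
∣sum∣≤ {zero}  f = ℚₚ.≤-refl
∣sum∣≤ {suc n} f = ℚₚ.≤-trans (∣⊕∣ (f zero) (∑ (f ∘ suc))) (⊕-mono-≤ ℚₚ.≤-refl (∣sum∣≤ (f ∘ suc)))

sum-nonNeg : ∀ {n} {f : Vector n} → (∀ i → 0ℚ ℚ.≤ f i) → 0ℚ ℚ.≤ ∑ f
sum-nonNeg {n} {f} 0≤f = ℚₚ.≤-trans (ℚₚ.≤-reflexive (sym (sum-zero {n} {λ _ → 0ℚ} λ _ → refl))) (sum-mono 0≤f)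

term≤sum : ∀ {n} (f : Vector n) → (∀ i → 0ℚ ℚ.≤ f i) → ∀ i → f i ℚ.≤ ∑ f
term≤sum {suc n} f 0≤f i = begin
  f i                        ≡⟨ +-identityʳ (f i) ⟨
  f i ⊕ 0ℚ                   ≤⟨ ⊕-mono-≤ ℚₚ.≤-refl (sum-nonNeg (0≤f ∘ punchIn i)) ⟩
  f i ⊕ ∑ (f ∘ punchIn i)    ≡⟨ sum-punchIn i f ⟨
  ∑ f                        ∎
  where open ℚₚ.≤-Reasoning

entrySum : ∀ {m n} → (Fin m → Vector n) → ℚ
entrySum B = ∑ λ i → ∑ λ j → ℚ.∣ B i j ∣

entrySum-nonNeg : ∀ {m n} (B : Fin m → Vector n) → 0ℚ ℚ.≤ entrySum B
entrySum-nonNeg B = sum-nonNeg λ i → sum-nonNeg λ j → ℚₚ.0≤∣p∣ (B i j)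

-- An estimate in the sum norm `S` of `c`: adding the absolute values of all columns gives (1 + β) S
-- ≤ S β, because no row sum of |B| exceeds β, and hence S ≤ 0.
diagonallyDominant : ∀ {k} (B : Fin k → Vector k) (c : Vector k) →
  (∀ j → (1ℚ ⊕ entrySum B) ⊛ c j ⊕ ∑ (λ i → c i ⊛ B i j) ≡ 0ℚ) → IsZero c
diagonallyDominant {k} B c eq i =
  ℚₚ.∣p∣≡0⇒p≡0 (c i) (ℚₚ.≤-antisym (ℚₚ.≤-trans (term≤sum ∣c∣ (λ i → ℚₚ.0≤∣p∣ (c i)) i) S≤0) (ℚₚ.0≤∣p∣ (c i)))
  where
  open ℚₚ.≤-Reasoning
  β S : ℚ
  β = entrySum B
  ∣c∣ : Vector k
  ∣c∣ i = ℚ.∣ c i ∣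
  S = ∑ ∣c∣
  rowSum : Vector k
  rowSum i = ∑ λ j → ℚ.∣ B i j ∣
  0≤T : 0ℚ ℚ.≤ 1ℚ ⊕ β
  0≤T = ℚₚ.≤-trans (ℚₚ.≤-reflexive (sym (+-identityˡ 0ℚ))) (⊕-mono-≤ (ℚₚ.nonNegative⁻¹ 1ℚ) (entrySum-nonNeg B))
  column : ∀ j → (1ℚ ⊕ β) ⊛ ∣c∣ j ℚ.≤ ∑ (λ i → ∣c∣ i ⊛ ℚ.∣ B i j ∣)
  column j = begin
    (1ℚ ⊕ β) ⊛ ∣c∣ j                  ≡⟨ cong (_⊛ ∣c∣ j) (ℚₚ.0≤p⇒∣p∣≡p 0≤T) ⟨
    ℚ.∣ 1ℚ ⊕ β ∣ ⊛ ∣c∣ j              ≡⟨ ∣⊛∣ (1ℚ ⊕ β) (c j) ⟨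
    ℚ.∣ (1ℚ ⊕ β) ⊛ c j ∣              ≡⟨ cong ℚ.∣_∣ (move (eq j)) ⟩
    ℚ.∣ ⊝ ∑ (λ i → c i ⊛ B i j) ∣     ≡⟨ ∣⊝∣ _ ⟩
    ℚ.∣ ∑ (λ i → c i ⊛ B i j) ∣       ≤⟨ ∣sum∣≤ (λ i → c i ⊛ B i j) ⟩
    ∑ (λ i → ℚ.∣ c i ⊛ B i j ∣)       ≡⟨ sum-cong (λ i → ∣⊛∣ (c i) (B i j)) ⟩
    ∑ (λ i → ∣c∣ i ⊛ ℚ.∣ B i j ∣)     ∎
    where
    move : ∀ {x y} → x ⊕ y ≡ 0ℚ → x ≡ ⊝ y
    move {x} {y} x+y≡0 = trans (solve 2 (λ x y → x := (x :+ y) :- y) refl x y)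
      (trans (cong (_⊖ y) x+y≡0) (+-identityˡ (⊝ y)))
  total : (1ℚ ⊕ β) ⊛ S ℚ.≤ S ⊛ β
  total = begin
    (1ℚ ⊕ β) ⊛ S                                    ≡⟨ *-sum (1ℚ ⊕ β) ∣c∣ ⟩
    ∑ (λ j → (1ℚ ⊕ β) ⊛ ∣c∣ j)                      ≤⟨ sum-mono column ⟩
    ∑ (λ j → ∑ (λ i → ∣c∣ i ⊛ ℚ.∣ B i j ∣))         ≡⟨ sum-swap (λ i j → ∣c∣ i ⊛ ℚ.∣ B i j ∣) ⟨
    ∑ (λ i → ∑ (λ j → ∣c∣ i ⊛ ℚ.∣ B i j ∣))         ≡⟨ sum-cong (λ i → *-sum (∣c∣ i) (λ j → ℚ.∣ B i j ∣)) ⟨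
    ∑ (λ i → ∣c∣ i ⊛ rowSum i)                      ≤⟨ sum-mono (λ i → ⊛-monoʳ-≤ (∣c∣ i) (ℚₚ.0≤∣p∣ (c i)) (term≤sum rowSum (λ i → sum-nonNeg λ j → ℚₚ.0≤∣p∣ (B i j)) i)) ⟩
    ∑ (λ i → ∣c∣ i ⊛ β)                             ≡⟨ sum-* ∣c∣ β ⟨
    S ⊛ β                                           ∎
  S≤0 : S ℚ.≤ 0ℚ
  S≤0 = begin
    S                              ≡⟨ solve 2 (λ s b → s := (con (+ 1) :+ b) :* s :- s :* b) refl S β ⟩
    (1ℚ ⊕ β) ⊛ S ⊕ ⊝ (S ⊛ β)       ≤⟨ ⊕-mono-≤ total ℚₚ.≤-refl ⟩
    S ⊛ β ⊕ ⊝ (S ⊛ β)              ≡⟨ solve 1 (λ x → x :- x := con (+ 0)) refl (S ⊛ β) ⟩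
    0ℚ                             ∎

infixl 6 _⊞_ _⊟_
infixl 7 _⊠_

_⊞_ _⊟_ : ∀ {n} → Vector n → Vector n → Vector n
(x ⊞ y) i = x i ⊕ y i
(x ⊟ y) i = x i ⊖ y i

_⊠_ : ∀ {n} → ℚ → Vector n → Vector n
(a ⊠ x) i = a ⊛ x i

𝟘 : ∀ {n} → Vector n
𝟘 _ = 0ℚ

-- Half the derivative of the squared length of the edge when its ends move with velocity `q`. It is
-- bilinear in `p` and `q`, and the tests of a stress rely on this.
stretch : ∀ {n} → Placement n → Placement n → Edge n → ℚ
stretch p q (u , v) = (p u ⊟ p v) ∙ (q u ⊟ q v)

-- Virtual work: c is an equilibrium stress iff it does no work along any
-- displacement q (see independentAt⇒independentFamily and its converse).
Stress : ∀ {n k} → Placement n → (Fin k → Edge n) → Vector k → Set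
Stress p E c = ∀ q → ∑ (λ i → c i ⊛ stretch p q (E i)) ≡ 0ℚ

IndependentFamily : ∀ {n k} → Placement n → (Fin k → Edge n) → Set
IndependentFamily p E = ∀ c → Stress p E c → IsZero c

sumFin≡∑ : ∀ {n} (f : Vector n) → sumFin f ≡ ∑ f
sumFin≡∑ {zero}  f = refl
sumFin≡∑ {suc n} f = trans (⊕-unfold _ _) (+-congˡ (sumFin≡∑ (f ∘ suc)))

row-δ : ∀ {n} (p : Placement n) u v w k → row p (u , v) w k ≡ (p u k ⊖ p v k) ⊛ (δ w u ⊖ δ w v)
row-δ p u v w k with w Fin.≟ u | w Fin.≟ v
... | yes _ | yes _ = trans (cong₂ ℚ._+_ (⊖-unfold _ _) (⊖-unfold _ _)) (trans (⊕-unfold _ _)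
  (solve 2 (λ x y → (x :- y) :+ (y :- x) := (x :- y) :* (con (+ 1) :- con (+ 1))) refl _ _))
... | yes _ | no  _ = trans (cong (ℚ._+ 0ℚ) (⊖-unfold _ _)) (trans (⊕-unfold _ _)
  (solve 2 (λ x y → (x :- y) :+ con (+ 0) := (x :- y) :* (con (+ 1) :- con (+ 0))) refl _ _))
... | no  _ | yes _ = trans (cong (0ℚ ℚ.+_) (⊖-unfold _ _)) (trans (⊕-unfold _ _)
  (solve 2 (λ x y → con (+ 0) :+ (y :- x) := (x :- y) :* (con (+ 0) :- con (+ 1))) refl _ _))
... | no  _ | no  _ = trans (⊕-unfold _ _)
  (solve 2 (λ x y → con (+ 0) :+ con (+ 0) := (x :- y) :* (con (+ 0) :- con (+ 0))) refl (p u k) (p v k))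

stretch-row : ∀ {n} (p q : Placement n) e → stretch p q e ≡ ∑ (λ w → row p e w ∙ q w)
stretch-row p q (u , v) = sym (begin
  ∑ (λ w → ∑ (λ k → row p (u , v) w k ⊛ q w k))
    ≡⟨ sum-swap (λ w k → row p (u , v) w k ⊛ q w k) ⟩
  ∑ (λ k → ∑ (λ w → row p (u , v) w k ⊛ q w k))
    ≡⟨ sum-cong (λ k → sum-cong (λ w → cong (_⊛ q w k) (trans (row-δ p u v w k)
         (cong₂ (λ a b → (p u k ⊖ p v k) ⊛ (a ⊖ b)) (δ-sym w u) (δ-sym w v))))) ⟩
  ∑ (λ k → ∑ (λ w → (p u k ⊖ p v k) ⊛ (δ u w ⊖ δ v w) ⊛ q w k))
    ≡⟨ sum-cong coordinate ⟩
  ∑ (λ k → (p u k ⊖ p v k) ⊛ (q u k ⊖ q v k)) ∎)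
  where
  open ≡-Reasoning
  coordinate : ∀ k → ∑ (λ w → (p u k ⊖ p v k) ⊛ (δ u w ⊖ δ v w) ⊛ q w k) ≡ (p u k ⊖ p v k) ⊛ (q u k ⊖ q v k)
  coordinate k = begin
    ∑ (λ w → a ⊛ (δ u w ⊖ δ v w) ⊛ q w k)
      ≡⟨ sum-cong (λ w → solve 4 (λ a d e x → a :* (d :- e) :* x := a :* (d :* x :+ (:- (e :* x)))) refl a (δ u w) (δ v w) (q w k)) ⟩
    ∑ (λ w → a ⊛ (δ u w ⊛ q w k ⊕ ⊝ (δ v w ⊛ q w k)))
      ≡⟨ *-sum a (λ w → δ u w ⊛ q w k ⊕ ⊝ (δ v w ⊛ q w k)) ⟨
    a ⊛ ∑ (λ w → δ u w ⊛ q w k ⊕ ⊝ (δ v w ⊛ q w k))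
      ≡⟨ *-congˡ (trans (sum-+ (λ w → δ u w ⊛ q w k) (λ w → ⊝ (δ v w ⊛ q w k)))
           (cong₂ _⊕_ (sum-δ u (λ w → q w k)) (trans (sum-neg (λ w → δ v w ⊛ q w k)) (cong ⊝_ (sum-δ v (λ w → q w k)))))) ⟩
    a ⊛ (q u k ⊖ q v k) ∎
    where a = p u k ⊖ p v k

virtualWork : ∀ {n k} (p q : Placement n) (E : Fin k → Edge n) (c : Vector k) →
  ∑ (λ i → c i ⊛ stretch p q (E i)) ≡ ∑ (λ w → (λ d → ∑ (λ i → c i ⊛ row p (E i) w d)) ∙ q w)
virtualWork p q E c = begin
  ∑ (λ i → c i ⊛ stretch p q (E i))
    ≡⟨ sum-cong (λ i → trans (cong (c i ⊛_) (stretch-row p q (E i))) (*-sum (c i) (λ w → row p (E i) w ∙ q w))) ⟩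
  ∑ (λ i → ∑ (λ w → c i ⊛ (row p (E i) w ∙ q w)))
    ≡⟨ sum-swap (λ i w → c i ⊛ (row p (E i) w ∙ q w)) ⟩
  ∑ (λ w → ∑ (λ i → c i ⊛ (row p (E i) w ∙ q w)))
    ≡⟨ sum-cong (λ w → sum-combination c (q w) (λ i → row p (E i) w)) ⟩
  ∑ (λ w → (λ d → ∑ (λ i → c i ⊛ row p (E i) w d)) ∙ q w) ∎
  where open ≡-Reasoning

unit : ∀ {n} → Fin n → Fin 3 → Placement n
unit w d v e = δ w v ⊛ δ d e

virtualWork-unit : ∀ {n k} (p : Placement n) (E : Fin k → Edge n) (c : Vector k) w d →
  ∑ (λ i → c i ⊛ stretch p (unit w d) (E i)) ≡ ∑ (λ i → c i ⊛ row p (E i) w d)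
virtualWork-unit p E c w d = begin
  ∑ (λ i → c i ⊛ stretch p (unit w d) (E i))
    ≡⟨ virtualWork p (unit w d) E c ⟩
  ∑ (λ v → ∑ (λ e → F v e ⊛ (δ w v ⊛ δ d e)))
    ≡⟨ sum-cong (λ v → trans (sum-cong (λ e → solve 3 (λ f a b → f :* (a :* b) := a :* (b :* f)) refl (F v e) (δ w v) (δ d e)))
         (sym (*-sum (δ w v) (λ e → δ d e ⊛ F v e)))) ⟩
  ∑ (λ v → δ w v ⊛ ∑ (λ e → δ d e ⊛ F v e))
    ≡⟨ sum-δ w (λ v → ∑ (λ e → δ d e ⊛ F v e)) ⟩
  ∑ (λ e → δ d e ⊛ F w e)
    ≡⟨ sum-δ d (F w) ⟩
  F w d ∎
  where
  open ≡-Reasoning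
  F : _ → _ → ℚ
  F v e = ∑ (λ i → c i ⊛ row p (E i) v e)

sumFin-row : ∀ {n} (p : Placement n) es (c : Vector (length es)) w d →
  sumFin (λ i → c i ℚ.* row p (lookup es i) w d) ≡ ∑ (λ i → c i ⊛ row p (lookup es i) w d)
sumFin-row p es c w d = trans (sumFin≡∑ (λ i → c i ℚ.* row p (lookup es i) w d)) (sum-cong λ i → ⊛-unfold (c i) (row p (lookup es i) w d))

independentAt⇒independentFamily : ∀ {n} (p : Placement n) es → IndependentAt p es → IndependentFamily p (lookup es)
independentAt⇒independentFamily p es ind c stress = ind c λ w d →
  trans (sumFin-row p es c w d) (trans (sym (virtualWork-unit p (lookup es) c w d)) (stress (unit w d)))

independentFamily⇒independentAt : ∀ {n} (p : Placement n) es → IndependentFamily p (lookup es) → IndependentAt p es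
independentFamily⇒independentAt p es ind c kills = ind c λ q →
  trans (virtualWork p q (lookup es) c) (sum-zero λ w → sum-zero λ d →
    trans (cong (_⊛ q w d) (trans (sym (sumFin-row p es c w d)) (kills w d))) (zeroˡ (q w d)))

stretch-translate : ∀ {n} (p q r : Placement n) t e →
  stretch (λ v → p v ⊞ t ⊠ q v) r e ≡ stretch p r e ⊕ t ⊛ stretch q r e
stretch-translate p q r t (u , v) = begin
  ∑ (λ k → ((p u k ⊕ t ⊛ q u k) ⊖ (p v k ⊕ t ⊛ q v k)) ⊛ x k)
    ≡⟨ sum-cong (λ k → solve 6 (λ a b c d t x → ((a :+ t :* b) :- (c :+ t :* d)) :* x := (a :- c) :* x :+ t :* ((b :- d) :* x))
         refl (p u k) (q u k) (p v k) (q v k) t (x k)) ⟩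
  ∑ (λ k → (p u k ⊖ p v k) ⊛ x k ⊕ t ⊛ ((q u k ⊖ q v k) ⊛ x k))
    ≡⟨ sum-+ (λ k → (p u k ⊖ p v k) ⊛ x k) (λ k → t ⊛ ((q u k ⊖ q v k) ⊛ x k)) ⟩
  ∑ (λ k → (p u k ⊖ p v k) ⊛ x k) ⊕ ∑ (λ k → t ⊛ ((q u k ⊖ q v k) ⊛ x k))
    ≡⟨ +-congˡ (*-sum t (λ k → (q u k ⊖ q v k) ⊛ x k)) ⟨
  stretch p r (u , v) ⊕ t ⊛ stretch q r (u , v) ∎
  where
  open ≡-Reasoning
  x = r u ⊟ r v

flatten : ∀ {n} → Placement n → Vector (n * 3)
flatten {n} f x = uncurry f (remQuot {n} 3 x)

unflatten : ∀ {n} → Vector (n * 3) → Placement n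
unflatten x w d = x (combine w d)

flatten-∙ : ∀ {n} (f : Placement n) (x : Vector (n * 3)) → flatten f ∙ x ≡ ∑ (λ w → f w ∙ unflatten x w)
flatten-∙ {n} f x = trans (sum-combine {n} {3} (λ y → flatten f y ⊛ x y))
  (sum-cong λ w → sum-cong λ d → cong (λ z → uncurry f z ⊛ x (combine w d)) (Finₚ.remQuot-combine w d))

-- The duals of the rows are displacements: `L j` stretches the edge `j` at unit rate and no other
-- edge.
independent⇒dual : ∀ {n k} (p : Placement n) (E : Fin k → Edge n) → IndependentFamily p E →
  Σ (Fin k → Placement n) λ L → ∀ i j → stretch p (L j) (E i) ≡ δ i j
independent⇒dual {n} p E ind with dependent-or-dual (λ i → flatten (row p (E i)))
... | inj₂ (L , dual) = (λ j → unflatten (L j)) , λ i j →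
  trans (stretch-row p (unflatten (L j)) (E i)) (trans (sym (flatten-∙ (row p (E i)) (L j))) (dual i j))
... | inj₁ (c , kills , i , cᵢ≢0) = contradiction (ind c stress i) cᵢ≢0
  where
  stress : Stress p E c
  stress q = trans (virtualWork p q E c) (sum-zero λ w → sum-zero λ d →
    trans (cong (_⊛ q w d) (trans
      (sum-cong λ i → cong (λ z → c i ⊛ uncurry (row p (E i)) z) (sym (Finₚ.remQuot-combine w d)))
      (kills (combine w d)))) (zeroˡ (q w d)))

-- Independence is an open condition: with L dual to the rows at p, the rows
-- at p + t q pair with L to I + t B, which is invertible for small t.
perturb : ∀ {n k} (p q : Placement n) (E : Fin k → Edge n) → IndependentFamily p E →
  ∃ λ t → t ≢ 0ℚ × IndependentFamily (λ v → p v ⊞ t ⊠ q v) E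
perturb {n} {k} p q E ind = t , t≢0 , λ c stress → diagonallyDominant B c (dominant c stress)
  where
  open ≡-Reasoning
  L = proj₁ (independent⇒dual p E ind)
  dual = proj₂ (independent⇒dual p E ind)
  B : Fin k → Vector k
  B i j = stretch q (L j) (E i)
  -- For t = 1 / T the matrix T (I + t B) is T I + B, the form that `diagonallyDominant` treats.
  T : ℚ
  T = 1ℚ ⊕ entrySum B
  T≢0 : T ≢ 0ℚ
  T≢0 T≡0 = ℚₚ.<⇒≢ 0<T (sym T≡0)
    where
    0<T : 0ℚ ℚ.< T
    0<T = ℚₚ.<-≤-trans (ℚₚ.positive⁻¹ 1ℚ)
      (ℚₚ.≤-trans (ℚₚ.≤-reflexive (sym (+-identityʳ 1ℚ))) (⊕-mono-≤ ℚₚ.≤-refl (entrySum-nonNeg B)))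
  instance _ = ℚ.≢-nonZero T≢0
  t : ℚ
  t = ℚ.1/ T
  t≢0 : t ≢ 0ℚ
  t≢0 t≡0 = case trans (sym (⊛-inverseˡ T)) (trans (cong (_⊛ T) t≡0) (zeroˡ T)) of λ ()
  dominant : ∀ c → Stress (λ v → p v ⊞ t ⊠ q v) E c → ∀ j → T ⊛ c j ⊕ ∑ (λ i → c i ⊛ B i j) ≡ 0ℚ
  dominant c stress j = begin
    T ⊛ c j ⊕ b                ≡⟨ +-congˡ (trans (sym (*-identityˡ b)) (cong (_⊛ b) (sym (⊛-inverseˡ T)))) ⟩
    T ⊛ c j ⊕ t ⊛ T ⊛ b        ≡⟨ solve 4 (λ T c t b → T :* c :+ t :* T :* b := T :* (c :+ t :* b)) refl T (c j) t b ⟩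
    T ⊛ (c j ⊕ t ⊛ b)          ≡⟨ cong (T ⊛_) expand ⟨
    T ⊛ ∑ (λ i → c i ⊛ stretch (λ v → p v ⊞ t ⊠ q v) (L j) (E i)) ≡⟨ cong (T ⊛_) (stress (L j)) ⟩
    T ⊛ 0ℚ                     ≡⟨ zeroʳ T ⟩
    0ℚ                         ∎
    where
    b : ℚ
    b = ∑ (λ i → c i ⊛ B i j)
    expand : ∑ (λ i → c i ⊛ stretch (λ v → p v ⊞ t ⊠ q v) (L j) (E i)) ≡ c j ⊕ t ⊛ b
    expand = begin
      ∑ (λ i → c i ⊛ stretch (λ v → p v ⊞ t ⊠ q v) (L j) (E i))
        ≡⟨ sum-cong (λ i → trans (cong (c i ⊛_) (trans (stretch-translate p q (L j) t (E i))
             (cong (_⊕ t ⊛ B i j) (trans (dual i j) (δ-sym i j)))))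
             (solve 4 (λ c d t b → c :* (d :+ t :* b) := d :* c :+ t :* (c :* b)) refl (c i) (δ j i) t (B i j))) ⟩
      ∑ (λ i → δ j i ⊛ c i ⊕ t ⊛ (c i ⊛ B i j))
        ≡⟨ sum-+ (λ i → δ j i ⊛ c i) (λ i → t ⊛ (c i ⊛ B i j)) ⟩
      ∑ (λ i → δ j i ⊛ c i) ⊕ ∑ (λ i → t ⊛ (c i ⊛ B i j))
        ≡⟨ cong₂ _⊕_ (sum-δ j c) (sym (*-sum t (λ i → c i ⊛ B i j))) ⟩
      c j ⊕ t ⊛ b ∎

-- Sublists, circuits and tabulated families

extend : ∀ {A : Set} {xs ys : List A} → xs ⊆ ys → Vector (length xs) → Vector (length ys)
extend []         c = λ ()
extend (y ∷ʳ τ)   c = λ { zero → 0ℚ ; (suc i) → extend τ c i }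
extend (refl ∷ τ) c = λ { zero → c zero ; (suc i) → extend τ (c ∘ suc) i }

extend-sum : ∀ {A : Set} {xs ys : List A} (τ : xs ⊆ ys) c (f : A → ℚ) →
  ∑ (λ i → extend τ c i ⊛ f (lookup ys i)) ≡ ∑ (λ i → c i ⊛ f (lookup xs i))
extend-sum []         c f = refl
extend-sum (y ∷ʳ τ)   c f = trans (cong₂ _⊕_ (zeroˡ (f y)) (extend-sum τ c f)) (+-identityˡ _)
extend-sum (refl ∷ τ) c f = +-congˡ (extend-sum τ (c ∘ suc) f)

extend-isZero : ∀ {A : Set} {xs ys : List A} (τ : xs ⊆ ys) c → IsZero (extend τ c) → IsZero c
extend-isZero (y ∷ʳ τ)   c z i       = extend-isZero τ c (z ∘ suc) i
extend-isZero (refl ∷ τ) c z zero    = z zero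
extend-isZero (refl ∷ τ) c z (suc i) = extend-isZero τ (c ∘ suc) (z ∘ suc) i

extend-proper : ∀ {A : Set} {xs ys : List A} (τ : xs ⊆ ys) → length xs ℕ.< length ys →
  ∃ λ i → ∀ c → extend τ c i ≡ 0ℚ
extend-proper (y ∷ʳ τ)   _          = zero , λ c → refl
extend-proper (refl ∷ τ) (s≤s lt) with extend-proper τ lt
... | i , eq = suc i , λ c → eq (c ∘ suc)

-- The part of being a circuit that one placement can certify. A stress of a proper sublist is a
-- stress with a zero coefficient, so all proper sublists are independent at this same `p`;
-- dependence concerns every placement and is proved apart.
CircuitFamily : ∀ {n k} → Placement n → (Fin k → Edge n) → Set
CircuitFamily p E = ∀ c → Stress p E c → ∀ i → c i ≡ 0ℚ → IsZero c

independent-⊆ : ∀ {n} {xs ys : List (Edge n)} → xs ⊆ ys → Independent ys → Independent xs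
independent-⊆ {xs = xs} {ys} τ (p , ind) = p , independentFamily⇒independentAt p xs λ c stress →
  extend-isZero τ c (independentAt⇒independentFamily p ys ind (extend τ c) λ q →
    trans (extend-sum τ c (stretch p q)) (stress q))

properSublist-independent : ∀ {n} (p : Placement n) {xs ys : List (Edge n)} → CircuitFamily p (lookup ys) →
  xs ⊆ ys → length xs ℕ.< length ys → Independent xs
properSublist-independent p {xs} {ys} circuit τ lt =
  let i , eq = extend-proper τ lt
  in p , independentFamily⇒independentAt p xs λ c stress →
    extend-isZero τ c (circuit (extend τ c) (λ q → trans (extend-sum τ c (stretch p q)) (stress q)) i (eq c))

isCircuit : ∀ {n} (p : Placement n) es → CircuitFamily p (lookup es) → Dependent es → IsCircuit es
isCircuit p es circuit dep = dep , λ xs τ lt → properSublist-independent p circuit τ lt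

module _ {A : Set} where

  position : ∀ {k} (f : Fin k → A) → Fin k → Fin (length (tabulate f))
  position f zero    = zero
  position f (suc i) = suc (position (f ∘ suc) i)

  lookup-position : ∀ {k} (f : Fin k → A) i → lookup (tabulate f) (position f i) ≡ f i
  lookup-position f zero    = refl
  lookup-position f (suc i) = lookup-position (f ∘ suc) i

  position⁻¹ : ∀ {k} (f : Fin k → A) → Fin (length (tabulate f)) → Fin k
  position⁻¹ {suc k} f zero    = zero
  position⁻¹ {suc k} f (suc i) = suc (position⁻¹ (f ∘ suc) i)

  position-position⁻¹ : ∀ {k} (f : Fin k → A) i → position f (position⁻¹ f i) ≡ i
  position-position⁻¹ {suc k} f zero    = refl
  position-position⁻¹ {suc k} f (suc i) = cong suc (position-position⁻¹ (f ∘ suc) i)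

  position⁻¹-position : ∀ {k} (f : Fin k → A) i → position⁻¹ f (position f i) ≡ i
  position⁻¹-position f zero    = refl
  position⁻¹-position f (suc i) = cong suc (position⁻¹-position (f ∘ suc) i)

  sum-position : ∀ {k} (f : Fin k → A) (g : Vector (length (tabulate f))) → ∑ g ≡ ∑ (g ∘ position f)
  sum-position {zero}  f g = refl
  sum-position {suc k} f g = +-congˡ (sum-position (f ∘ suc) (g ∘ suc))

  lookup-tabulate-sum : ∀ {k} (f : Fin k → A) (c : Vector (length (tabulate f))) (g : A → ℚ) →
    ∑ (λ i → c i ⊛ g (lookup (tabulate f) i)) ≡ ∑ (λ i → c (position f i) ⊛ g (f i))
  lookup-tabulate-sum f c g = trans (sum-position f (λ i → c i ⊛ g (lookup (tabulate f) i)))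
    (sum-cong λ i → cong (λ x → c (position f i) ⊛ g x) (lookup-position f i))

circuitFamily-tabulate : ∀ {n k} (p : Placement n) (E : Fin k → Edge n) →
  CircuitFamily p E → CircuitFamily p (lookup (tabulate E))
circuitFamily-tabulate p E circuit c stress i cᵢ≡0 j =
  trans (cong c (sym (position-position⁻¹ E j)))
    (circuit (c ∘ position E) (λ q → trans (sym (lookup-tabulate-sum E c (stretch p q))) (stress q))
      (position⁻¹ E i) (trans (cong c (position-position⁻¹ E i)) cᵢ≡0) (position⁻¹ E j))

independentFamily-tabulate : ∀ {n k} (p : Placement n) (E : Fin k → Edge n) →
  IndependentFamily p (lookup (tabulate E)) → IndependentFamily p E
independentFamily-tabulate p E ind c stress i =
  trans (cong c (sym (position⁻¹-position E i)))
    (ind (c ∘ position⁻¹ E) (λ q → trans (lookup-tabulate-sum E (c ∘ position⁻¹ E) (stretch p q))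
      (trans (sum-cong λ i → cong (λ j → c j ⊛ stretch p q (E i)) (position⁻¹-position E i)) (stress q))) (position E i))

-- Infinitesimal rigid motions

_×̇_ : Vector 3 → Vector 3 → Vector 3
(x ×̇ y) 0F = x 1F ⊛ y 2F ⊖ x 2F ⊛ y 1F
(x ×̇ y) 1F = x 2F ⊛ y 0F ⊖ x 0F ⊛ y 2F
(x ×̇ y) 2F = x 0F ⊛ y 1F ⊖ x 1F ⊛ y 0F

-- Velocity at `x` of the screw motion with translation `τ` and angular velocity `ρ`.
rigid : Vector 3 → Vector 3 → Vector 3 → Vector 3
rigid τ ρ x = τ ⊞ ρ ×̇ x

infixl 8 _×̇_

-- The velocities of the two ends differ by ρ × (p u - p v), which is orthogonal to p u - p v.
stretch-rigid : ∀ {n} (p : Placement n) τ ρ e → stretch p (rigid τ ρ ∘ p) e ≡ 0ℚ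
stretch-rigid p τ ρ (u , v) = solve 12 (λ a b c d e f x y z k l m →
    (a :- d) :* ((k :+ (y :* c :- z :* b)) :- (k :+ (y :* f :- z :* e))) :+
    ((b :- e) :* ((l :+ (z :* a :- x :* c)) :- (l :+ (z :* d :- x :* f))) :+
    ((c :- f) :* ((m :+ (x :* b :- y :* a)) :- (m :+ (x :* e :- y :* d))) :+ con (+ 0))) := con (+ 0))
  refl (p u 0F) (p u 1F) (p u 2F) (p v 0F) (p v 1F) (p v 2F) (ρ 0F) (ρ 1F) (ρ 2F) (τ 0F) (τ 1F) (τ 2F)

stretch-⊞ : ∀ {n} (p q r : Placement n) e → stretch p (λ v → q v ⊞ r v) e ≡ stretch p q e ⊕ stretch p r e
stretch-⊞ p q r (u , v) = trans
  (sum-cong λ k → solve 5 (λ x a b c d → x :* ((a :+ b) :- (c :+ d)) := x :* (a :- c) :+ x :* (b :- d)) refl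
    (p u k ⊖ p v k) (q u k) (r u k) (q v k) (r v k))
  (sum-+ (λ k → (p u k ⊖ p v k) ⊛ (q u k ⊖ q v k)) (λ k → (p u k ⊖ p v k) ⊛ (r u k ⊖ r v k)))

-- The bound 3 n - 6 on the rank

-- Pinning p₁ in all coordinates, p₁ + u in the first and p₁ + v in the first
-- two leaves no rigid motion when the two quantities below are nonzero.
pinning : ∀ (p₁ u v q₁ q₂ q₃ : Vector 3) → u 2F ⊛ v 1F ⊖ u 1F ⊛ v 2F ≢ 0ℚ → v 2F ≢ 0ℚ →
  ∃ λ τ → ∃ λ ρ →
    (∀ d → rigid τ ρ p₁ d ≡ q₁ d) × rigid τ ρ (p₁ ⊞ u) 0F ≡ q₂ 0F ×
    rigid τ ρ (p₁ ⊞ v) 0F ≡ q₃ 0F × rigid τ ρ (p₁ ⊞ v) 1F ≡ q₃ 1F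
pinning p₁ u v q₁ q₂ q₃ D≢0 v₂≢0 = τ , ρ , at-p₁ ,
  at (p₁ ⊞ u) 0F refl (trans (solve 7 (λ i a b x y z w → i :* (a :* y :- x :* b) :* z :- i :* (a :* w :- z :* b) :* x
    := (i :* (z :* y :- x :* w)) :* a) refl i a b (u 1F) (v 1F) (u 2F) (v 2F)) (cancel (⊛-inverseˡ D))) ,
  at (p₁ ⊞ v) 0F refl (trans (solve 7 (λ i a b x y z w → i :* (a :* y :- x :* b) :* w :- i :* (a :* w :- z :* b) :* y
    := (i :* (z :* y :- x :* w)) :* b) refl i a b (u 1F) (v 1F) (u 2F) (v 2F)) (cancel (⊛-inverseˡ D))) ,
  at (p₁ ⊞ v) 1F refl (trans (solve 5 (λ r x j c w → r :* x :- j :* (r :* x :- c) :* w := r :* x :- (j :* w) :* (r :* x :- c))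
    refl (ρ 2F) (v 0F) j c (v 2F)) (trans (cong (λ z → ρ 2F ⊛ v 0F ⊖ z) (cancel (⊛-inverseˡ (v 2F))))
      (solve 2 (λ x c → x :- (x :- c) := c) refl _ c)))
  where
  instance _ = ℚ.≢-nonZero D≢0
  instance _ = ℚ.≢-nonZero v₂≢0
  D i j a b c : ℚ
  D = u 2F ⊛ v 1F ⊖ u 1F ⊛ v 2F
  i = ℚ.1/ D
  j = ℚ.1/ (v 2F)
  a = q₂ 0F ⊖ q₁ 0F
  b = q₃ 0F ⊖ q₁ 0F
  c = q₃ 1F ⊖ q₁ 1F
  ρ τ : Vector 3
  -- Cramer's rule for the two conditions on first coordinates, whose unknowns are `ρ 1F` and
  -- `ρ 2F`. The remaining condition then determines `ρ 0F`, and `τ` is what takes `p₁` to the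
  -- required value.
  ρ 2F = i ⊛ (a ⊛ v 2F ⊖ u 2F ⊛ b)
  ρ 1F = i ⊛ (a ⊛ v 1F ⊖ u 1F ⊛ b)
  ρ 0F = j ⊛ (ρ 2F ⊛ v 0F ⊖ c)
  τ = q₁ ⊟ ρ ×̇ p₁
  cancel : ∀ {x y} → x ≡ 1ℚ → x ⊛ y ≡ y
  cancel {y = y} eq = trans (cong (_⊛ y) eq) (*-identityˡ y)
  at-p₁ : ∀ d → rigid τ ρ p₁ d ≡ q₁ d
  at-p₁ d = solve 2 (λ x y → x :- y :+ y := x) refl (q₁ d) ((ρ ×̇ p₁) d)
  cross-shift : ∀ w d → q₁ d ⊖ (ρ ×̇ p₁) d ⊕ (ρ ×̇ (p₁ ⊞ w)) d ≡ (ρ ×̇ w) d ⊕ q₁ d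
  cross-shift w d = trans (cong (λ z → q₁ d ⊖ (ρ ×̇ p₁) d ⊕ z) (distrib d))
    (solve 3 (λ q x y → q :- x :+ (x :+ y) := y :+ q) refl (q₁ d) ((ρ ×̇ p₁) d) ((ρ ×̇ w) d))
    where
    split : ∀ r s x y z t → r ⊛ (x ⊕ y) ⊖ s ⊛ (z ⊕ t) ≡ (r ⊛ x ⊖ s ⊛ z) ⊕ (r ⊛ y ⊖ s ⊛ t)
    split = solve 6 (λ r s x y z t → r :* (x :+ y) :- s :* (z :+ t) := (r :* x :- s :* z) :+ (r :* y :- s :* t)) refl
    distrib : ∀ d → (ρ ×̇ (p₁ ⊞ w)) d ≡ (ρ ×̇ p₁) d ⊕ (ρ ×̇ w) d
    distrib 0F = split _ _ _ _ _ _
    distrib 1F = split _ _ _ _ _ _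
    distrib 2F = split _ _ _ _ _ _
  at : ∀ x {w q} d → x ≡ p₁ ⊞ w → (ρ ×̇ w) d ≡ q ⊖ q₁ d → rigid τ ρ x d ≡ q
  at x {w} {q} d refl eq = trans (cross-shift w d) (trans (cong (_⊕ q₁ d) eq)
    (solve 2 (λ q p → q :- p :+ p := q) refl q (q₁ d)))

module _ {n} (v₁ v₂ v₃ : Fin n) (rest : List (Fin n)) where

  Within : Edge n → Set
  Within (u , v) = u ∈ (v₁ ∷ v₂ ∷ v₃ ∷ rest) × v ∈ (v₁ ∷ v₂ ∷ v₃ ∷ rest)

  -- This is 3 n - 6 for the n listed vertices: all coordinates of `v₁`, the first of `v₂` and the
  -- first two of `v₃` are pinned.
  freeCoordinates : ℕ
  freeCoordinates = 3 ℕ.+ length rest * 3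

  freeCoordinate : Fin freeCoordinates → Fin n × Fin 3
  freeCoordinate 0F = v₂ , 1F
  freeCoordinate 1F = v₂ , 2F
  freeCoordinate 2F = v₃ , 2F
  freeCoordinate (suc (suc (suc i))) = let w , d = remQuot {length rest} 3 i in lookup rest w , d

  InGeneralPosition : Placement n → Set
  InGeneralPosition p = u 2F ⊛ v 1F ⊖ u 1F ⊛ v 2F ≢ 0ℚ × v 2F ≢ 0ℚ
    where
    u = p v₂ ⊟ p v₁
    v = p v₃ ⊟ p v₁

  -- A combination of rows vanishing off the pinned coordinates vanishes, since
  -- any displacement can be made zero on those by a rigid motion.
  overcounted-generic : ∀ p → InGeneralPosition p → (E : Fin (suc freeCoordinates) → Edge n) →
    (∀ i → Within (E i)) → ¬ IndependentFamily p E
  overcounted-generic p (D≢0 , v≢0) E within ind =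
    let c , kills , i , cᵢ≢0 = nonTrivial freeCoordinates (λ i x → uncurry (row p (E i)) (freeCoordinate x))
    in cᵢ≢0 (ind c (stress c kills) i)
    where
    stress : ∀ c → Kills c (λ i x → uncurry (row p (E i)) (freeCoordinate x)) → Stress p E c
    stress c kills q = work (pinning (p v₁) (p v₂ ⊟ p v₁) (p v₃ ⊟ p v₁) (q v₁) (q v₂) (q v₃) D≢0 v≢0)
      where
      F : Fin n → Vector 3
      F w d = ∑ (λ i → c i ⊛ row p (E i) w d)
      work : (∃ λ τ → ∃ λ ρ →
        (∀ d → rigid τ ρ (p v₁) d ≡ q v₁ d) × rigid τ ρ (p v₁ ⊞ (p v₂ ⊟ p v₁)) 0F ≡ q v₂ 0F ×
        rigid τ ρ (p v₁ ⊞ (p v₃ ⊟ p v₁)) 0F ≡ q v₃ 0F × rigid τ ρ (p v₁ ⊞ (p v₃ ⊟ p v₁)) 1F ≡ q v₃ 1F) →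
        ∑ (λ i → c i ⊛ stretch p q (E i)) ≡ 0ℚ
      work (τ , ρ , at₁ , at₂ , at₃ , at₃′) = begin
        ∑ (λ i → c i ⊛ stretch p q (E i))
          ≡⟨ sum-cong (λ i → cong (c i ⊛_) (stretch-correct (E i))) ⟩
        ∑ (λ i → c i ⊛ stretch p r (E i))
          ≡⟨ virtualWork p r E c ⟩
        ∑ (λ w → F w ∙ r w)
          ≡⟨ sum-zero vanish ⟩
        0ℚ ∎
        where
        open ≡-Reasoning
        -- `r` is `q` minus the rigid motion that agrees with `q` on the pinned coordinates. The
        -- work is the same, and `r` is zero there.
        R r : Placement n
        R v = rigid (⊝_ ∘ τ) (⊝_ ∘ ρ) (p v)
        r v = q v ⊞ R v
        stretch-correct : ∀ e → stretch p q e ≡ stretch p r e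
        stretch-correct e = sym (trans (stretch-⊞ p q R e) (trans (+-congˡ (stretch-rigid p (⊝_ ∘ τ) (⊝_ ∘ ρ) e)) (+-identityʳ _)))
        correct : ∀ w d → rigid τ ρ (p v₁ ⊞ (p w ⊟ p v₁)) d ≡ q w d → r w d ≡ 0ℚ
        correct w d eq = trans (cong (_⊕ R w d) (sym eq)) (opposite d)
          where
          component : ∀ t a b x y x′ y′ → t ⊕ (a ⊛ (x′ ⊕ (x ⊖ x′)) ⊖ b ⊛ (y′ ⊕ (y ⊖ y′))) ⊕ (⊝ t ⊕ (⊝ a ⊛ x ⊖ ⊝ b ⊛ y)) ≡ 0ℚ
          component = solve 7 (λ t a b x y x′ y′ → t :+ (a :* (x′ :+ (x :- x′)) :- b :* (y′ :+ (y :- y′))) :+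
            (:- t :+ (:- a :* x :- :- b :* y)) := con (+ 0)) refl
          opposite : ∀ d → rigid τ ρ (p v₁ ⊞ (p w ⊟ p v₁)) d ⊕ R w d ≡ 0ℚ
          opposite 0F = component _ _ _ _ _ _ _
          opposite 1F = component _ _ _ _ _ _ _
          opposite 2F = component _ _ _ _ _ _ _
        F-rest : ∀ {w} → w ∈ rest → ∀ d → F w d ≡ 0ℚ
        F-rest {w} w∈ d = subst (λ (v , e) → F v e ≡ 0ℚ) eq (kills (suc (suc (suc (combine (index w∈) d)))))
          where
          eq : freeCoordinate (suc (suc (suc (combine (index w∈) d)))) ≡ (w , d)
          eq = trans (cong (λ (i , e) → lookup rest i , e) (Finₚ.remQuot-combine (index w∈) d)) (cong (_, d) (sym (Anyₚ.lookup-index w∈)))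
        F-outside : ∀ {w} → ¬ w ∈ (v₁ ∷ v₂ ∷ v₃ ∷ rest) → ∀ d → F w d ≡ 0ℚ
        F-outside {w} w∉ d = sum-zero λ i → trans (cong (c i ⊛_) (trans
          (row-δ p (proj₁ (E i)) (proj₂ (E i)) w d)
          (trans (cong₂ (λ a b → (p (proj₁ (E i)) d ⊖ p (proj₂ (E i)) d) ⊛ (a ⊖ b))
            (δ-≢ λ eq → w∉ (subst (_∈ _) (sym eq) (proj₁ (within i))))
            (δ-≢ λ eq → w∉ (subst (_∈ _) (sym eq) (proj₂ (within i)))))
          (solve 1 (λ x → x :* (con (+ 0) :- con (+ 0)) := con (+ 0)) refl _)))) (zeroʳ (c i))
        vanish : ∀ w → F w ∙ r w ≡ 0ℚ
        vanish w with DecMembership._∈?_ Fin._≟_ w (v₁ ∷ v₂ ∷ v₃ ∷ rest)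
        ... | no w∉ = ∙-zero (F w) (r w) λ d → inj₁ (F-outside w∉ d)
        ... | yes (here refl) = ∙-zero (F w) (r w) λ d → inj₂ (correct w d (trans (at-v₁ d) (at₁ d)))
          where
          self : ∀ x → x ⊕ (x ⊖ x) ≡ x
          self = solve 1 (λ x → x :+ (x :- x) := x) refl
          component : ∀ t a b x y → t ⊕ (a ⊛ (x ⊕ (x ⊖ x)) ⊖ b ⊛ (y ⊕ (y ⊖ y))) ≡ t ⊕ (a ⊛ x ⊖ b ⊛ y)
          component t a b x y = cong₂ (λ x y → t ⊕ (a ⊛ x ⊖ b ⊛ y)) (self x) (self y)
          at-v₁ : ∀ d → rigid τ ρ (p v₁ ⊞ (p v₁ ⊟ p v₁)) d ≡ rigid τ ρ (p v₁) d
          at-v₁ 0F = component _ _ _ _ _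
          at-v₁ 1F = component _ _ _ _ _
          at-v₁ 2F = component _ _ _ _ _
        ... | yes (there (here refl)) = ∙-zero (F w) (r w) λ
          { 0F → inj₂ (correct w 0F at₂)
          ; 1F → inj₁ (kills 0F)
          ; 2F → inj₁ (kills 1F) }
        ... | yes (there (there (here refl))) = ∙-zero (F w) (r w) λ
          { 0F → inj₂ (correct w 0F at₃)
          ; 1F → inj₂ (correct w 1F at₃′)
          ; 2F → inj₁ (kills 2F) }
        ... | yes (there (there (there w∈))) = ∙-zero (F w) (r w) λ d → inj₁ (F-rest w∈ d)

  module _ (v₁≢v₂ : v₁ ≢ v₂) (v₁≢v₃ : v₁ ≢ v₃) (v₂≢v₃ : v₂ ≢ v₃) {k} (E : Fin k → Edge n) where

    raise-v₃ : (∃ λ p → IndependentFamily p E) → ∃ λ p → p v₃ 2F ⊖ p v₁ 2F ≢ 0ℚ × IndependentFamily p E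
    raise-v₃ (p , ind) with p v₃ 2F ⊖ p v₁ 2F ℚₚ.≟ 0ℚ
    ... | no ≢0 = p , ≢0 , ind
    ... | yes ≡0 =
      let t , t≢0 , ind′ = perturb p (unit v₃ 2F) E ind
      in (λ v → p v ⊞ t ⊠ unit v₃ 2F v) , (λ eq → t≢0 (trans (sym (height t)) eq)) , ind′
      where
      height : ∀ t → (p v₃ 2F ⊕ t ⊛ (δ v₃ v₃ ⊛ 1ℚ)) ⊖ (p v₁ 2F ⊕ t ⊛ (δ v₃ v₁ ⊛ 1ℚ)) ≡ t
      height t = trans (cong₂ (λ a b → (p v₃ 2F ⊕ t ⊛ (a ⊛ 1ℚ)) ⊖ (p v₁ 2F ⊕ t ⊛ (b ⊛ 1ℚ))) (δ-refl v₃) (δ-≢ (v₁≢v₃ ∘ sym)))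
        (trans (solve 3 (λ x y t → (x :+ t :* (con (+ 1) :* con (+ 1))) :- (y :+ t :* (con (+ 0) :* con (+ 1))) := (x :- y) :+ t)
          refl (p v₃ 2F) (p v₁ 2F) t) (trans (cong (_⊕ t) ≡0) (+-identityˡ t)))

    -- The second perturbation must not undo the first. It moves `v₂` in coordinate `1F` alone,
    -- which keeps the height of `v₃` over `v₁` and changes a vanishing determinant into minus that
    -- height times `t`.
    generalPosition : (∃ λ p → IndependentFamily p E) → ∃ λ p → InGeneralPosition p × IndependentFamily p E
    generalPosition ind with raise-v₃ ind
    ... | p , z≢0 , ind with (p v₂ 2F ⊖ p v₁ 2F) ⊛ (p v₃ 1F ⊖ p v₁ 1F) ⊖ (p v₂ 1F ⊖ p v₁ 1F) ⊛ (p v₃ 2F ⊖ p v₁ 2F) ℚₚ.≟ 0ℚ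
    ... | no ≢0  = p , (≢0 , z≢0) , ind
    ... | yes ≡0 =
      let t , t≢0 , ind′ = perturb p (unit v₂ 1F) E ind
      in p′ t , ((λ eq → ⊛-≢0 z≢0 t≢0 (trans (sym (determinant t)) (trans (cong ⊝_ eq) ⊝0≡0))) , (λ eq → z≢0 (trans (sym (height t)) eq))) , ind′
      where
      p′ : ℚ → Placement n
      p′ t v = p v ⊞ t ⊠ unit v₂ 1F v
      fixed : ∀ t v d → δ v₂ v ⊛ δ 1F d ≡ 0ℚ → p′ t v d ≡ p v d
      fixed t v d eq = trans (cong (λ z → p v d ⊕ t ⊛ z) eq) (solve 2 (λ x t → x :+ t :* con (+ 0) := x) refl (p v d) t)
      fixed-v : ∀ t v d → v₂ ≢ v → p′ t v d ≡ p v d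
      fixed-v t v d v₂≢v = fixed t v d (trans (cong (_⊛ δ 1F d) (δ-≢ v₂≢v)) (zeroˡ _))
      height : ∀ t → p′ t v₃ 2F ⊖ p′ t v₁ 2F ≡ p v₃ 2F ⊖ p v₁ 2F
      height t = cong₂ _⊖_ (fixed-v t v₃ 2F v₂≢v₃) (fixed-v t v₁ 2F (v₁≢v₂ ∘ sym))
      determinant : ∀ t → ⊝ ((p′ t v₂ 2F ⊖ p′ t v₁ 2F) ⊛ (p′ t v₃ 1F ⊖ p′ t v₁ 1F) ⊖ (p′ t v₂ 1F ⊖ p′ t v₁ 1F) ⊛ (p′ t v₃ 2F ⊖ p′ t v₁ 2F))
        ≡ (p v₃ 2F ⊖ p v₁ 2F) ⊛ t
      determinant t
        rewrite height t | fixed-v t v₃ 1F v₂≢v₃ | fixed-v t v₁ 1F (v₁≢v₂ ∘ sym) | fixed-v t v₁ 2F (v₁≢v₂ ∘ sym)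
              | fixed t v₂ 2F (zeroʳ _) | δ-refl v₂ =
        trans (solve 7 (λ a b c d e f t → :- ((a :- b) :* c :- ((d :+ t :* (con (+ 1) :* con (+ 1))) :- e) :* f)
                 := f :* t :- ((a :- b) :* c :- (d :- e) :* f)) refl
                 (p v₂ 2F) (p v₁ 2F) (p v₃ 1F ⊖ p v₁ 1F) (p v₂ 1F) (p v₁ 1F) (p v₃ 2F ⊖ p v₁ 2F) t)
          (trans (cong (λ z → (p v₃ 2F ⊖ p v₁ 2F) ⊛ t ⊖ z) ≡0) (solve 1 (λ x → x :- con (+ 0) := x) refl _))

  overcounted : v₁ ≢ v₂ → v₁ ≢ v₃ → v₂ ≢ v₃ → (E : Fin (suc freeCoordinates) → Edge n) →
    (∀ i → Within (E i)) → ∀ p → ¬ IndependentFamily p E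
  overcounted v₁≢v₂ v₁≢v₃ v₂≢v₃ E within p ind =
    let p′ , general , ind′ = generalPosition v₁≢v₂ v₁≢v₃ v₂≢v₃ E (p , ind)
    in overcounted-generic p′ general E within ind′

-- The ring

-- With `next-fromℕ` this trades the remainder in `next` for a distinction between the last index
-- and all others.
next-inject₁ : ∀ {k} (i : Fin k) → next (inject₁ i) ≡ suc i
next-inject₁ {k} i = Finₚ.toℕ-injective (begin
  toℕ (next (inject₁ i))                ≡⟨ Finₚ.toℕ-fromℕ< (ℕᵈ.m%n<n (suc (toℕ (inject₁ i))) (suc k)) ⟩
  suc (toℕ (inject₁ i)) ℕ.% suc k       ≡⟨ cong (λ x → suc x ℕ.% suc k) (Finₚ.toℕ-inject₁ i) ⟩
  suc (toℕ i) ℕ.% suc k                 ≡⟨ ℕᵈ.m<n⇒m%n≡m (s≤s (Finₚ.toℕ<n i)) ⟩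
  suc (toℕ i)                           ∎)
  where open ≡-Reasoning

next-fromℕ : ∀ k → next (fromℕ k) ≡ zero
next-fromℕ k = Finₚ.toℕ-injective (begin
  toℕ (next (fromℕ k))             ≡⟨ Finₚ.toℕ-fromℕ< (ℕᵈ.m%n<n (suc (toℕ (fromℕ k))) (suc k)) ⟩
  suc (toℕ (fromℕ k)) ℕ.% suc k    ≡⟨ cong (λ x → suc x ℕ.% suc k) (Finₚ.toℕ-fromℕ k) ⟩
  suc k ℕ.% suc k                  ≡⟨ ℕᵈ.n%n≡0 (suc k) ⟩
  0                                ∎)
  where open ≡-Reasoning

next-injective : ∀ {m} {i j : Fin m} → next i ≡ next j → i ≡ j
next-injective {suc k} {i} {j} eq with view i | view j
... | ‵fromℕ | ‵fromℕ = refl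
... | ‵fromℕ | ‵inject₁ j = case trans (sym (next-fromℕ k)) (trans eq (next-inject₁ j)) of λ ()
... | ‵inject₁ i | ‵fromℕ = case trans (sym (next-inject₁ i)) (trans eq (next-fromℕ k)) of λ ()
... | ‵inject₁ i | ‵inject₁ j =
  cong inject₁ (Finₚ.suc-injective (trans (sym (next-inject₁ i)) (trans eq (next-inject₁ j))))

next-surjective : ∀ {m} (i : Fin m) → ∃ λ j → next j ≡ i
next-surjective {suc k} zero    = fromℕ k , next-fromℕ k
next-surjective {suc k} (suc i) = inject₁ i , next-inject₁ i

next-≢ : ∀ {m} → 2 ≤ m → (i : Fin m) → next i ≢ i
next-≢ {suc (suc k)} (s≤s (s≤s _)) i eq with view i
... | ‵fromℕ     = case trans (sym (next-fromℕ (suc k))) eq of λ ()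
... | ‵inject₁ i = ℕₚ.1+n≢n (trans (cong toℕ (trans (sym (next-inject₁ i)) eq)) (Finₚ.toℕ-inject₁ i))

-- Once around the ring: from `i` up to the last index, across to zero, and upwards again.
next-induction : ∀ {m} (P : Fin m → Set) i → P i → (∀ j → P j → P (next j)) → ∀ j → P j
next-induction {suc k} P i base step =
  FinInd.<-weakInduction P (subst P (next-fromℕ k) (step (fromℕ k) top)) ascend
  where
  ascend : ∀ j → P (inject₁ j) → P (suc j)
  ascend j x = subst P (next-inject₁ j) (step (inject₁ j) x)
  top : P (fromℕ k)
  top = FinInd.<-weakInduction-startingFrom P base ascend (Finₚ.≤fromℕ i)

sum-init-last : ∀ {k} (f : Vector (suc k)) → ∑ f ≡ ∑ (f ∘ inject₁) ⊕ f (fromℕ k)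
sum-init-last {zero}  f = +-comm (f zero) 0ℚ
sum-init-last {suc k} f = trans (+-congˡ (sum-init-last (f ∘ suc))) (sym (+-assoc _ _ _))

sum-next : ∀ {m} (f : Vector m) → ∑ (f ∘ next) ≡ ∑ f
sum-next {zero}  f = refl
sum-next {suc k} f = begin
  ∑ (f ∘ next)                                          ≡⟨ sum-init-last (f ∘ next) ⟩
  ∑ (λ i → f (next (inject₁ i))) ⊕ f (next (fromℕ k))   ≡⟨ cong₂ _⊕_ (sum-cong λ i → cong f (next-inject₁ i)) (cong f (next-fromℕ k)) ⟩
  ∑ (f ∘ suc) ⊕ f zero                                  ≡⟨ +-comm _ (f zero) ⟩
  ∑ f                                                   ∎
  where open ≡-Reasoning

tabulate-++ : ∀ {A : Set} k {l} (f : Fin (k ℕ.+ l) → A) →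
  tabulate f ≡ tabulate (f ∘ (Fin._↑ˡ l)) ++ tabulate (f ∘ (k Fin.↑ʳ_))
tabulate-++ zero    f = refl
tabulate-++ (suc k) f = cong (f zero ∷_) (tabulate-++ k (f ∘ suc))

-- Makes the edge list a family indexed by pairs of a link and a position in the link, so that
-- `sum-combine` splits sums over edges into sums over links.
concatMap-tabulate : ∀ {A B : Set} {m k} (G : A → Fin k → B) (f : Fin m → A) →
  concatMap (λ a → tabulate (G a)) (tabulate f) ≡ tabulate (λ x → let (i , t) = remQuot {m} k x in G (f i) t)
concatMap-tabulate {m = zero}      G f = refl
concatMap-tabulate {m = suc m} {k} G f = begin
  tabulate (G (f zero)) ++ concatMap (λ a → tabulate (G a)) (tabulate (f ∘ suc))
    ≡⟨ cong₂ _++_ (Listₚ.tabulate-cong λ t → sym (cong G′ (Finₚ.remQuot-combine {suc m} zero t)))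
         (trans (concatMap-tabulate G (f ∘ suc)) (Listₚ.tabulate-cong shifted)) ⟩
  tabulate (λ t → G′ (remQuot {suc m} k (t Fin.↑ˡ (m * k)))) ++ tabulate (λ x → G′ (remQuot {suc m} k (k Fin.↑ʳ x)))
    ≡⟨ tabulate-++ k (λ x → G′ (remQuot {suc m} k x)) ⟨
  tabulate (λ x → G′ (remQuot {suc m} k x)) ∎
  where
  open ≡-Reasoning
  G′ : Fin (suc m) × Fin k → _
  G′ (i , t) = G (f i) t
  shifted : ∀ x → (let (i , t) = remQuot {m} k x in G (f (suc i)) t) ≡ G′ (remQuot {suc m} k (k Fin.↑ʳ x))
  shifted x = let i , t , eq = Finₚ.combine-surjective {m} {k} x in begin
    (let (i , t) = remQuot {m} k x in G (f (suc i)) t)                  ≡⟨ cong (λ y → let (i , t) = remQuot {m} k y in G (f (suc i)) t) eq ⟨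
    (let (i , t) = remQuot {m} k (combine i t) in G (f (suc i)) t)      ≡⟨ cong (λ (i , t) → G (f (suc i)) t) (Finₚ.remQuot-combine {m} {k} i t) ⟩
    G (f (suc i)) t                                                     ≡⟨ cong G′ (Finₚ.remQuot-combine {suc m} {k} (suc i) t) ⟨
    G′ (remQuot {suc m} k (k Fin.↑ʳ combine i t))                       ≡⟨ cong (λ y → G′ (remQuot {suc m} k (k Fin.↑ʳ y))) eq ⟩
    G′ (remQuot {suc m} k (k Fin.↑ʳ x))                                 ∎

linkEdge : ∀ {m} → Fin m → Fin 8 → Edge (m * 3)
linkEdge i = lookup (linkEdges i)

-- The bar along `h` has index `zero`; edge `t` of link `j` has index `suc (combine j t)`.
hingeAndRing : ∀ {m} → Fin m → Fin (suc (m * 8)) → Edge (m * 3)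
hingeAndRing     h zero    = hinge h
hingeAndRing {m} h (suc x) = uncurry linkEdge (remQuot {m} 8 x)

hinge∷ring≡tabulate : ∀ {m} (h : Fin m) → hinge h ∷ ringEdges m ≡ tabulate (hingeAndRing h)
hinge∷ring≡tabulate {m} h = cong (hinge h ∷_) (concatMap-tabulate (linkEdge {m}) id)

-- The order puts the three vertices a, b, z that belong to the link in the sense of `vtx` first, so
-- that `_↑ˡ 2` embeds their indices.
pattern aᵛ = 0F
pattern bᵛ = 1F
pattern zᵛ = 2F
pattern cᵛ = 3F
pattern dᵛ = 4F

butterfly : Fin 8 → Edge 5
butterfly = lookup ((aᵛ , cᵛ) ∷ (aᵛ , dᵛ) ∷ (bᵛ , cᵛ) ∷ (bᵛ , dᵛ) ∷ (zᵛ , aᵛ) ∷ (zᵛ , bᵛ) ∷ (zᵛ , cᵛ) ∷ (zᵛ , dᵛ) ∷ [])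

linkVertex : ∀ {m} → Fin m → Fin 5 → Fin (m * 3)
linkVertex j aᵛ = vtx j 0F
linkVertex j bᵛ = vtx j 1F
linkVertex j zᵛ = vtx j 2F
linkVertex j cᵛ = vtx (next j) 0F
linkVertex j dᵛ = vtx (next j) 1F

local : ∀ {m} → Placement (m * 3) → Fin m → Placement 5
local p j v = p (linkVertex j v)

stretch-link : ∀ {m} (p q : Placement (m * 3)) (j : Fin m) t →
  stretch p q (linkEdge j t) ≡ stretch (local p j) (local q j) (butterfly t)
stretch-link p q j 0F = refl
stretch-link p q j 1F = refl
stretch-link p q j 2F = refl
stretch-link p q j 3F = refl
stretch-link p q j 4F = refl
stretch-link p q j 5F = refl
stretch-link p q j 6F = refl
stretch-link p q j 7F = refl

ringWork : ∀ {m} (p q : Placement (m * 3)) (h : Fin m) (c : Vector (suc (m * 8))) →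
  ∑ (λ i → c i ⊛ stretch p q (hingeAndRing h i)) ≡
  c zero ⊛ stretch p q (hinge h) ⊕
  ∑ (λ (j : Fin m) → ∑ (λ t → c (suc (combine j t)) ⊛ stretch (local p j) (local q j) (butterfly t)))
ringWork {m} p q h c = +-congˡ (trans (sum-combine {m} {8} (λ x → c (suc x) ⊛ stretch p q (hingeAndRing h (suc x))))
  (sum-cong {m} λ j → sum-cong {8} λ t → cong (c (suc (combine j t)) ⊛_) (edge j t)))
  where
  edge : ∀ (j : Fin m) t → stretch p q (hingeAndRing h (suc (combine j t))) ≡
    stretch (local p j) (local q j) (butterfly t)
  edge j t = begin
    stretch p q (uncurry linkEdge (remQuot {m} 8 (combine j t)))
      ≡⟨ cong (λ x → stretch p q (uncurry linkEdge x)) (Finₚ.remQuot-combine {m} {8} j t) ⟩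
    stretch p q (linkEdge j t)
      ≡⟨ stretch-link p q j t ⟩
    stretch (local p j) (local q j) (butterfly t) ∎
    where open ≡-Reasoning

-- The resultant at vertex `w` of the stressed bars of a single link.
force : Vector 8 → Placement 5 → Placement 5
force ω P w d = ∑ λ t → ω t ⊛ row P (butterfly t) w d

-- A test displacement that is felt by two links at most: link `i` at a, b, z and the preceding link
-- at c, d.
block : ∀ {m} → Fin m → (Fin 3 → Vector 3) → Placement (m * 3)
block {m} i x v = let (j , s) = remQuot {m} 3 v in δ i j ⊠ x s

block-vtx : ∀ {m} (i : Fin m) x j s d → block i x (vtx j s) d ≡ δ i j ⊛ x s d
block-vtx {m} i x j s d = cong (λ (j , s) → δ i j ⊛ x s d) (Finₚ.remQuot-combine {m} {3} j s)

-- The forces of the two links meeting at a hinge balance against the stress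
-- of an additional bar along the hinge.
balance : ∀ {m} (p : Placement (m * 3)) (h : Fin m) c → Stress p (hingeAndRing h) c → ∀ j x →
  let F = λ (i : Fin m) → force (λ t → c (suc (combine i t))) (local p i) in
  c zero ⊛ (δ (next j) h ⊛ ((p (vtx h 0F) ⊟ p (vtx h 1F)) ∙ (x 0F ⊟ x 1F))) ⊕
  ((F (next j) aᵛ ∙ x 0F ⊕ F (next j) bᵛ ∙ x 1F ⊕ F (next j) zᵛ ∙ x 2F) ⊕
   (F j cᵛ ∙ x 0F ⊕ F j dᵛ ∙ x 1F)) ≡ 0ℚ
balance {m} p h c stress j x = begin
  c zero ⊛ (δ i h ⊛ ((p (vtx h 0F) ⊟ p (vtx h 1F)) ∙ (x 0F ⊟ x 1F))) ⊕ (front i ⊕ back j)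
    ≡⟨ cong₂ (λ u v → c zero ⊛ u ⊕ v) (sym hinge-stretch) (sym links) ⟩
  c zero ⊛ stretch p q (hinge h) ⊕ ∑ (λ k → work k)
    ≡⟨ ringWork p q h c ⟨
  ∑ (λ k → c k ⊛ stretch p q (hingeAndRing h k))
    ≡⟨ stress q ⟩
  0ℚ ∎
  where
  open ≡-Reasoning
  i = next j
  q = block i x
  ω : Fin m → Vector 8
  ω k t = c (suc (combine k t))
  F : Fin m → Placement 5
  F k = force (ω k) (local p k)
  front back work : Fin m → ℚ
  front k = F k aᵛ ∙ x 0F ⊕ F k bᵛ ∙ x 1F ⊕ F k zᵛ ∙ x 2F
  back k = F k cᵛ ∙ x 0F ⊕ F k dᵛ ∙ x 1F
  work k = ∑ λ t → ω k t ⊛ stretch (local p k) (local q k) (butterfly t)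
  scaled : ∀ (f : Vector 3) k s → f ∙ q (vtx k s) ≡ δ i k ⊛ (f ∙ x s)
  scaled f k s = trans (sum-cong λ d → cong (f d ⊛_) (block-vtx i x k s d)) (∙-*ʳ f (δ i k) (x s))
  hinge-stretch : stretch p q (hinge h) ≡ δ i h ⊛ ((p (vtx h 0F) ⊟ p (vtx h 1F)) ∙ (x 0F ⊟ x 1F))
  hinge-stretch = trans (sum-cong λ d → cong ((p (vtx h 0F) d ⊖ p (vtx h 1F) d) ⊛_)
    (trans (cong₂ _⊖_ (block-vtx i x h 0F d) (block-vtx i x h 1F d))
      (solve 3 (λ e a b → e :* a :- e :* b := e :* (a :- b)) refl (δ i h) (x 0F d) (x 1F d))))
    (∙-*ʳ (p (vtx h 0F) ⊟ p (vtx h 1F)) (δ i h) (x 0F ⊟ x 1F))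
  work-split : ∀ k → work k ≡ δ i k ⊛ front k ⊕ δ j k ⊛ back k
  work-split k = begin
    work k
      ≡⟨ virtualWork (local p k) (local q k) butterfly (ω k) ⟩
    ∑ (λ w → F k w ∙ q (linkVertex k w))
      ≡⟨ cong₂ _⊕_ (scaled (F k aᵛ) k 0F) (cong₂ _⊕_ (scaled (F k bᵛ) k 1F) (cong₂ _⊕_ (scaled (F k zᵛ) k 2F)
           (cong₂ _⊕_ (scaled (F k cᵛ) (next k) 0F) (cong (_⊕ 0ℚ) (scaled (F k dᵛ) (next k) 1F))))) ⟩
    δ i k ⊛ (F k aᵛ ∙ x 0F) ⊕ (δ i k ⊛ (F k bᵛ ∙ x 1F) ⊕ (δ i k ⊛ (F k zᵛ ∙ x 2F) ⊕
      (δ i (next k) ⊛ (F k cᵛ ∙ x 0F) ⊕ (δ i (next k) ⊛ (F k dᵛ ∙ x 1F) ⊕ 0ℚ))))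
      ≡⟨ solve 7 (λ e f a b z c d → e :* a :+ (e :* b :+ (e :* z :+ (f :* c :+ (f :* d :+ con (+ 0))))) :=
           e :* (a :+ b :+ z) :+ f :* (c :+ d)) refl (δ i k) (δ i (next k)) _ _ _ _ _ ⟩
    δ i k ⊛ front k ⊕ δ i (next k) ⊛ back k
      ≡⟨ cong (λ e → δ i k ⊛ front k ⊕ e ⊛ back k) (δ-inj next next-injective j k) ⟩
    δ i k ⊛ front k ⊕ δ j k ⊛ back k ∎
  links : ∑ work ≡ front i ⊕ back j
  links = trans (sum-cong work-split) (trans (sum-+ (λ k → δ i k ⊛ front k) (λ k → δ j k ⊛ back k))
    (cong₂ _⊕_ (sum-δ i front) (sum-δ j back)))

-- Stresses of a ring with at least six links

pattern -1ᶻ = -[1+ 0 ]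
pattern -2ᶻ = -[1+ 1 ]

two : ℚ
two = fromℤ (+ 2)

-- Proves an equation modulo hypotheses: the solver checks x = y + r, where r is a combination of
-- quantities known to vanish.
x≡y⊕0 : ∀ {x y r} → x ≡ y ⊕ r → r ≡ 0ℚ → x ≡ y
x≡y⊕0 {x} {y} eq r≡0 = trans eq (trans (cong (y ⊕_) r≡0) (+-identityʳ y))

triple : Vector 3 → Vector 3 → Vector 3 → ℚ
triple x y z = x ∙ (y ×̇ z)

-- The rotation about the axis `v` through `b` fixes `b` and moves `a` with velocity (b - a) × v.
-- Hence the force at `a` is parallel to the line through `a` and `b`.
rotation-test : ∀ F G a b → (∀ τ ρ → F ∙ rigid τ ρ a ⊕ G ∙ rigid τ ρ b ≡ 0ℚ) → ∀ v → F ∙ ((b ⊟ a) ×̇ v) ≡ 0ℚ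
rotation-test F G a b test v = trans
  (solve 15 (λ F₀ F₁ F₂ G₀ G₁ G₂ a₀ a₁ a₂ b₀ b₁ b₂ v₀ v₁ v₂ →
      F₀ :* ((b₁ :- a₁) :* v₂ :- (b₂ :- a₂) :* v₁) :+ (F₁ :* ((b₂ :- a₂) :* v₀ :- (b₀ :- a₀) :* v₂) :+
        (F₂ :* ((b₀ :- a₀) :* v₁ :- (b₁ :- a₁) :* v₀) :+ con (+ 0))) :=
      F₀ :* (:- (v₁ :* b₂ :- v₂ :* b₁) :+ (v₁ :* a₂ :- v₂ :* a₁)) :+ (F₁ :* (:- (v₂ :* b₀ :- v₀ :* b₂) :+ (v₂ :* a₀ :- v₀ :* a₂)) :+
        (F₂ :* (:- (v₀ :* b₁ :- v₁ :* b₀) :+ (v₀ :* a₁ :- v₁ :* a₀)) :+ con (+ 0))) :+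
      (G₀ :* (:- (v₁ :* b₂ :- v₂ :* b₁) :+ (v₁ :* b₂ :- v₂ :* b₁)) :+ (G₁ :* (:- (v₂ :* b₀ :- v₀ :* b₂) :+ (v₂ :* b₀ :- v₀ :* b₂)) :+
        (G₂ :* (:- (v₀ :* b₁ :- v₁ :* b₀) :+ (v₀ :* b₁ :- v₁ :* b₀)) :+ con (+ 0)))))
    refl (F 0F) (F 1F) (F 2F) (G 0F) (G 1F) (G 2F) (a 0F) (a 1F) (a 2F) (b 0F) (b 1F) (b 2F) (v 0F) (v 1F) (v 2F))
  (test (⊝_ ∘ (v ×̇ b)) v)

-- The tests say that `f` is parallel to `u`. Taking s = w and s = v turns them into -y and z times
-- the triple product.
cross-test : ∀ {f} (u v w : Vector 3) x {y z} → (∀ d → f d ≡ x ⊛ u d ⊕ y ⊛ v d ⊕ z ⊛ w d) →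
  (∀ s → f ∙ (u ×̇ s) ≡ 0ℚ) → triple u v w ≢ 0ℚ → y ≡ 0ℚ × z ≡ 0ℚ
cross-test {f} u v w x {y} {z} f≡ test Δ≢0 =
  x⊛y≡0⇒y≡0 Δ≢0 (trans (solve 12 (λ x y z u₀ u₁ u₂ v₀ v₁ v₂ w₀ w₁ w₂ →
      (u₀ :* (v₁ :* w₂ :- v₂ :* w₁) :+ (u₁ :* (v₂ :* w₀ :- v₀ :* w₂) :+ (u₂ :* (v₀ :* w₁ :- v₁ :* w₀) :+ con (+ 0)))) :* y :=
      :- ((x :* u₀ :+ y :* v₀ :+ z :* w₀) :* (u₁ :* w₂ :- u₂ :* w₁) :+ ((x :* u₁ :+ y :* v₁ :+ z :* w₁) :* (u₂ :* w₀ :- u₀ :* w₂) :+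
        ((x :* u₂ :+ y :* v₂ :+ z :* w₂) :* (u₀ :* w₁ :- u₁ :* w₀) :+ con (+ 0)))))
      refl x y z (u 0F) (u 1F) (u 2F) (v 0F) (v 1F) (v 2F) (w 0F) (w 1F) (w 2F))
    (trans (cong ⊝_ (expand w)) ⊝0≡0)) ,
  x⊛y≡0⇒y≡0 Δ≢0 (trans (solve 12 (λ x y z u₀ u₁ u₂ v₀ v₁ v₂ w₀ w₁ w₂ →
      (u₀ :* (v₁ :* w₂ :- v₂ :* w₁) :+ (u₁ :* (v₂ :* w₀ :- v₀ :* w₂) :+ (u₂ :* (v₀ :* w₁ :- v₁ :* w₀) :+ con (+ 0)))) :* z :=
      (x :* u₀ :+ y :* v₀ :+ z :* w₀) :* (u₁ :* v₂ :- u₂ :* v₁) :+ ((x :* u₁ :+ y :* v₁ :+ z :* w₁) :* (u₂ :* v₀ :- u₀ :* v₂) :+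
        ((x :* u₂ :+ y :* v₂ :+ z :* w₂) :* (u₀ :* v₁ :- u₁ :* v₀) :+ con (+ 0))))
      refl x y z (u 0F) (u 1F) (u 2F) (v 0F) (v 1F) (v 2F) (w 0F) (w 1F) (w 2F))
    (expand v))
  where
  expand : ∀ s → (λ d → x ⊛ u d ⊕ y ⊛ v d ⊕ z ⊛ w d) ∙ (u ×̇ s) ≡ 0ℚ
  expand s = trans (sum-cong λ d → cong (_⊛ (u ×̇ s) d) (sym (f≡ d))) (test s)

force-δ : ∀ ω P w d → force ω P w d ≡
  ∑ (λ t → let (u , v) = butterfly t in ω t ⊛ ((P u d ⊖ P v d) ⊛ (δ w u ⊖ δ w v)))
force-δ ω P w d = sum-cong λ t → cong (ω t ⊛_) (row-δ P (proj₁ (butterfly t)) (proj₂ (butterfly t)) w d)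

-- The weights 1 of c and -2 of d in this dependency give the hinges ab and cd the products 1 and
-- -2. Their ratio is the doubling in `scale-next`.
Apex : Placement 5 → Set
Apex P = ∀ d → P zᵛ d ≡ P aᵛ d ⊕ P bᵛ d ⊕ P cᵛ d ⊖ two ⊛ P dᵛ d

-- The negated products of the affine dependency (1, 1, -1, 1, -2) of a, b, z, c, d.
signature : Fin 8 → ℤ
signature = lookup (-1ᶻ ∷ + 2 ∷ -1ᶻ ∷ + 2 ∷ + 1 ∷ + 1 ∷ + 1 ∷ -2ᶻ ∷ [])

signature≢0 : ∀ t → fromℤ (signature t) ≢ 0ℚ
signature≢0 = λ { 0F () ; 1F () ; 2F () ; 3F () ; 4F () ; 5F () ; 6F () ; 7F () }

-- Six times the signed volume of the tetrahedron abcd, nonzero exactly when the hinge lines ab and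
-- cd are skew.
volume : Placement 5 → ℚ
volume P = triple (P bᵛ ⊟ P aᵛ) (P cᵛ ⊟ P aᵛ) (P dᵛ ⊟ P aᵛ)

module _ (ω : Vector 8) (P : Placement 5) (apex : Apex P) where

  private
    B C D G : Vector 3
    B = P bᵛ ⊟ P aᵛ
    C = P cᵛ ⊟ P aᵛ
    D = P dᵛ ⊟ P aᵛ
    G = P dᵛ ⊟ P cᵛ
    apex-defect : ∀ x d → x ⊛ (P zᵛ d ⊖ (P aᵛ d ⊕ P bᵛ d ⊕ P cᵛ d ⊖ two ⊛ P dᵛ d)) ≡ 0ℚ
    apex-defect x d = trans (cong (λ y → x ⊛ (y ⊖ (P aᵛ d ⊕ P bᵛ d ⊕ P cᵛ d ⊖ two ⊛ P dᵛ d))) (apex d))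
      (solve 2 (λ x y → x :* (y :- y) := con (+ 0)) refl x (P aᵛ d ⊕ P bᵛ d ⊕ P cᵛ d ⊖ two ⊛ P dᵛ d))

  -- In each of the four formulas the apex is eliminated and the direction of the hinge comes first,
  -- `B` at a and b and `G` at c and d, as `cross-test` expects.
  force-a : ∀ d → force ω P aᵛ d ≡ ⊝ ω 4F ⊛ B d ⊕ ⊝ (ω 0F ⊕ ω 4F) ⊛ C d ⊕ (two ⊛ ω 4F ⊖ ω 1F) ⊛ D d
  force-a d = x≡y⊕0 (trans (force-δ ω P aᵛ d) (solve 13 (λ a b z c e s t u v k l m n →
      s :* ((a :- c) :* (con (+ 1) :- con (+ 0))) :+ (t :* ((a :- e) :* (con (+ 1) :- con (+ 0))) :+
      (u :* ((b :- c) :* (con (+ 0) :- con (+ 0))) :+ (v :* ((b :- e) :* (con (+ 0) :- con (+ 0))) :+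
      (k :* ((z :- a) :* (con (+ 0) :- con (+ 1))) :+ (l :* ((z :- b) :* (con (+ 0) :- con (+ 0))) :+
      (m :* ((z :- c) :* (con (+ 0) :- con (+ 0))) :+ (n :* ((z :- e) :* (con (+ 0) :- con (+ 0))) :+ con (+ 0)))))))) :=
      :- k :* (b :- a) :+ :- (s :+ k) :* (c :- a) :+ (con (+ 2) :* k :- t) :* (e :- a) :+
      :- k :* (z :- (a :+ b :+ c :- con (+ 2) :* e)))
      refl (P aᵛ d) (P bᵛ d) (P zᵛ d) (P cᵛ d) (P dᵛ d) (ω 0F) (ω 1F) (ω 2F) (ω 3F) (ω 4F) (ω 5F) (ω 6F) (ω 7F)))
    (apex-defect (⊝ ω 4F) d)

  force-b : ∀ d → force ω P bᵛ d ≡ (ω 2F ⊕ ω 3F) ⊛ B d ⊕ ⊝ (ω 2F ⊕ ω 5F) ⊛ C d ⊕ (two ⊛ ω 5F ⊖ ω 3F) ⊛ D d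
  force-b d = x≡y⊕0 (trans (force-δ ω P bᵛ d) (solve 13 (λ a b z c e s t u v k l m n →
      s :* ((a :- c) :* (con (+ 0) :- con (+ 0))) :+ (t :* ((a :- e) :* (con (+ 0) :- con (+ 0))) :+
      (u :* ((b :- c) :* (con (+ 1) :- con (+ 0))) :+ (v :* ((b :- e) :* (con (+ 1) :- con (+ 0))) :+
      (k :* ((z :- a) :* (con (+ 0) :- con (+ 0))) :+ (l :* ((z :- b) :* (con (+ 0) :- con (+ 1))) :+
      (m :* ((z :- c) :* (con (+ 0) :- con (+ 0))) :+ (n :* ((z :- e) :* (con (+ 0) :- con (+ 0))) :+ con (+ 0)))))))) :=
      (u :+ v) :* (b :- a) :+ :- (u :+ l) :* (c :- a) :+ (con (+ 2) :* l :- v) :* (e :- a) :+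
      :- l :* (z :- (a :+ b :+ c :- con (+ 2) :* e)))
      refl (P aᵛ d) (P bᵛ d) (P zᵛ d) (P cᵛ d) (P dᵛ d) (ω 0F) (ω 1F) (ω 2F) (ω 3F) (ω 4F) (ω 5F) (ω 6F) (ω 7F)))
    (apex-defect (⊝ ω 5F) d)

  force-c : ∀ d → force ω P cᵛ d ≡ two ⊛ ω 6F ⊛ G d ⊕ ⊝ (ω 2F ⊕ ω 6F) ⊛ B d ⊕ (ω 0F ⊕ ω 2F ⊕ two ⊛ ω 6F) ⊛ C d
  force-c d = x≡y⊕0 (trans (force-δ ω P cᵛ d) (solve 13 (λ a b z c e s t u v k l m n →
      s :* ((a :- c) :* (con (+ 0) :- con (+ 1))) :+ (t :* ((a :- e) :* (con (+ 0) :- con (+ 0))) :+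
      (u :* ((b :- c) :* (con (+ 0) :- con (+ 1))) :+ (v :* ((b :- e) :* (con (+ 0) :- con (+ 0))) :+
      (k :* ((z :- a) :* (con (+ 0) :- con (+ 0))) :+ (l :* ((z :- b) :* (con (+ 0) :- con (+ 0))) :+
      (m :* ((z :- c) :* (con (+ 0) :- con (+ 1))) :+ (n :* ((z :- e) :* (con (+ 0) :- con (+ 0))) :+ con (+ 0)))))))) :=
      con (+ 2) :* m :* (e :- c) :+ :- (u :+ m) :* (b :- a) :+ (s :+ u :+ con (+ 2) :* m) :* (c :- a) :+
      :- m :* (z :- (a :+ b :+ c :- con (+ 2) :* e)))
      refl (P aᵛ d) (P bᵛ d) (P zᵛ d) (P cᵛ d) (P dᵛ d) (ω 0F) (ω 1F) (ω 2F) (ω 3F) (ω 4F) (ω 5F) (ω 6F) (ω 7F)))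
    (apex-defect (⊝ ω 6F) d)

  force-d : ∀ d → force ω P dᵛ d ≡ ω 7F ⊛ G d ⊕ ⊝ (ω 3F ⊕ ω 7F) ⊛ B d ⊕ (ω 1F ⊕ ω 3F ⊕ two ⊛ ω 7F) ⊛ D d
  force-d d = x≡y⊕0 (trans (force-δ ω P dᵛ d) (solve 13 (λ a b z c e s t u v k l m n →
      s :* ((a :- c) :* (con (+ 0) :- con (+ 0))) :+ (t :* ((a :- e) :* (con (+ 0) :- con (+ 1))) :+
      (u :* ((b :- c) :* (con (+ 0) :- con (+ 0))) :+ (v :* ((b :- e) :* (con (+ 0) :- con (+ 1))) :+
      (k :* ((z :- a) :* (con (+ 0) :- con (+ 0))) :+ (l :* ((z :- b) :* (con (+ 0) :- con (+ 0))) :+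
      (m :* ((z :- c) :* (con (+ 0) :- con (+ 0))) :+ (n :* ((z :- e) :* (con (+ 0) :- con (+ 1))) :+ con (+ 0)))))))) :=
      n :* (e :- c) :+ :- (v :+ n) :* (b :- a) :+ (t :+ v :+ con (+ 2) :* n) :* (e :- a) :+
      :- n :* (z :- (a :+ b :+ c :- con (+ 2) :* e)))
      refl (P aᵛ d) (P bᵛ d) (P zᵛ d) (P cᵛ d) (P dᵛ d) (ω 0F) (ω 1F) (ω 2F) (ω 3F) (ω 4F) (ω 5F) (ω 6F) (ω 7F)))
    (apex-defect (⊝ ω 7F) d)

  -- If the forces at a and b have no joint wrench, `rotation-test` makes each of them parallel to
  -- ab, and likewise at cd. So two components vanish at every hinge end, and the resulting linear
  -- equations express all eight coefficients by `ω 4F`.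
  K₅-stress : volume P ≢ 0ℚ →
    (∀ τ ρ → force ω P aᵛ ∙ rigid τ ρ (P aᵛ) ⊕ force ω P bᵛ ∙ rigid τ ρ (P bᵛ) ≡ 0ℚ) →
    (∀ τ ρ → force ω P cᵛ ∙ rigid τ ρ (P cᵛ) ⊕ force ω P dᵛ ∙ rigid τ ρ (P dᵛ) ≡ 0ℚ) →
    ∀ t → ω t ≡ fromℤ (signature t) ⊛ ω 4F
  K₅-stress Δ≢0 front back = λ
    { 0F → ω₀ ; 1F → ω₁ ; 2F → trans ω₂ (cong (fromℤ -1ᶻ ⊛_) ω₅)
    ; 3F → trans ω₃ (cong (fromℤ (+ 2) ⊛_) ω₅) ; 4F → sym (*-identityˡ (ω 4F))
    ; 5F → trans ω₅ (sym (*-identityˡ (ω 4F))) ; 6F → trans ω₆ (sym (*-identityˡ (ω 4F)))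
    ; 7F → x≡y⊕0 (solve 3 (λ x y z → x := con -2ᶻ :* z :+ (:- (:- (y :+ x)) :- (y :- con (+ 2) :* z))) refl (ω 7F) (ω 3F) (ω 4F))
        (trans (cong₂ (λ x y → ⊝ x ⊖ (y ⊖ two ⊛ ω 4F)) (proj₁ testD) (trans ω₃ (cong (two ⊛_) ω₅)))
          (solve 1 (λ x → :- con (+ 0) :- (x :- x) := con (+ 0)) refl (two ⊛ ω 4F))) }
    where
    swap : ∀ {F G a b} → (∀ τ ρ → F ∙ rigid τ ρ a ⊕ G ∙ rigid τ ρ b ≡ 0ℚ) → ∀ τ ρ → G ∙ rigid τ ρ b ⊕ F ∙ rigid τ ρ a ≡ 0ℚ
    swap test τ ρ = trans (+-comm _ _) (test τ ρ)
    flip : ∀ F a b → (∀ s → F ∙ ((a ⊟ b) ×̇ s) ≡ 0ℚ) → ∀ s → F ∙ ((b ⊟ a) ×̇ s) ≡ 0ℚ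
    flip F a b test s = trans (solve 12 (λ F₀ F₁ F₂ a₀ a₁ a₂ b₀ b₁ b₂ v₀ v₁ v₂ →
        F₀ :* ((b₁ :- a₁) :* v₂ :- (b₂ :- a₂) :* v₁) :+ (F₁ :* ((b₂ :- a₂) :* v₀ :- (b₀ :- a₀) :* v₂) :+
          (F₂ :* ((b₀ :- a₀) :* v₁ :- (b₁ :- a₁) :* v₀) :+ con (+ 0))) :=
        :- (F₀ :* ((a₁ :- b₁) :* v₂ :- (a₂ :- b₂) :* v₁) :+ (F₁ :* ((a₂ :- b₂) :* v₀ :- (a₀ :- b₀) :* v₂) :+
          (F₂ :* ((a₀ :- b₀) :* v₁ :- (a₁ :- b₁) :* v₀) :+ con (+ 0)))))
        refl (F 0F) (F 1F) (F 2F) (a 0F) (a 1F) (a 2F) (b 0F) (b 1F) (b 2F) (s 0F) (s 1F) (s 2F))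
      (trans (cong ⊝_ (test s)) ⊝0≡0)
    -- Since G = D - C, both determinants reduce to that of `B`, `C`, `D` after dropping the
    -- repeated vector.
    swing : triple G B C ≡ volume P × triple G B D ≡ volume P
    swing =
      solve 12 (λ a₀ a₁ a₂ b₀ b₁ b₂ c₀ c₁ c₂ d₀ d₁ d₂ →
        (d₀ :- c₀) :* ((b₁ :- a₁) :* (c₂ :- a₂) :- (b₂ :- a₂) :* (c₁ :- a₁)) :+ ((d₁ :- c₁) :* ((b₂ :- a₂) :* (c₀ :- a₀) :- (b₀ :- a₀) :* (c₂ :- a₂)) :+
          ((d₂ :- c₂) :* ((b₀ :- a₀) :* (c₁ :- a₁) :- (b₁ :- a₁) :* (c₀ :- a₀)) :+ con (+ 0))) :=
        (b₀ :- a₀) :* ((c₁ :- a₁) :* (d₂ :- a₂) :- (c₂ :- a₂) :* (d₁ :- a₁)) :+ ((b₁ :- a₁) :* ((c₂ :- a₂) :* (d₀ :- a₀) :- (c₀ :- a₀) :* (d₂ :- a₂)) :+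
          ((b₂ :- a₂) :* ((c₀ :- a₀) :* (d₁ :- a₁) :- (c₁ :- a₁) :* (d₀ :- a₀)) :+ con (+ 0))))
        refl (P aᵛ 0F) (P aᵛ 1F) (P aᵛ 2F) (P bᵛ 0F) (P bᵛ 1F) (P bᵛ 2F) (P cᵛ 0F) (P cᵛ 1F) (P cᵛ 2F) (P dᵛ 0F) (P dᵛ 1F) (P dᵛ 2F) ,
      solve 12 (λ a₀ a₁ a₂ b₀ b₁ b₂ c₀ c₁ c₂ d₀ d₁ d₂ →
        (d₀ :- c₀) :* ((b₁ :- a₁) :* (d₂ :- a₂) :- (b₂ :- a₂) :* (d₁ :- a₁)) :+ ((d₁ :- c₁) :* ((b₂ :- a₂) :* (d₀ :- a₀) :- (b₀ :- a₀) :* (d₂ :- a₂)) :+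
          ((d₂ :- c₂) :* ((b₀ :- a₀) :* (d₁ :- a₁) :- (b₁ :- a₁) :* (d₀ :- a₀)) :+ con (+ 0))) :=
        (b₀ :- a₀) :* ((c₁ :- a₁) :* (d₂ :- a₂) :- (c₂ :- a₂) :* (d₁ :- a₁)) :+ ((b₁ :- a₁) :* ((c₂ :- a₂) :* (d₀ :- a₀) :- (c₀ :- a₀) :* (d₂ :- a₂)) :+
          ((b₂ :- a₂) :* ((c₀ :- a₀) :* (d₁ :- a₁) :- (c₁ :- a₁) :* (d₀ :- a₀)) :+ con (+ 0))))
        refl (P aᵛ 0F) (P aᵛ 1F) (P aᵛ 2F) (P bᵛ 0F) (P bᵛ 1F) (P bᵛ 2F) (P cᵛ 0F) (P cᵛ 1F) (P cᵛ 2F) (P dᵛ 0F) (P dᵛ 1F) (P dᵛ 2F)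
    testA : ⊝ (ω 0F ⊕ ω 4F) ≡ 0ℚ × two ⊛ ω 4F ⊖ ω 1F ≡ 0ℚ
    testA = cross-test B C D (⊝ ω 4F) force-a (rotation-test (force ω P aᵛ) (force ω P bᵛ) (P aᵛ) (P bᵛ) front) Δ≢0
    testB : ⊝ (ω 2F ⊕ ω 5F) ≡ 0ℚ × two ⊛ ω 5F ⊖ ω 3F ≡ 0ℚ
    testB = cross-test B C D (ω 2F ⊕ ω 3F) force-b (flip (force ω P bᵛ) (P aᵛ) (P bᵛ) (λ s → rotation-test (force ω P bᵛ) (force ω P aᵛ) (P bᵛ) (P aᵛ) (swap {force ω P aᵛ} {force ω P bᵛ} {P aᵛ} {P bᵛ} front) s)) Δ≢0
    testC : ⊝ (ω 2F ⊕ ω 6F) ≡ 0ℚ × ω 0F ⊕ ω 2F ⊕ two ⊛ ω 6F ≡ 0ℚ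
    testC = cross-test G B C (two ⊛ ω 6F) force-c (rotation-test (force ω P cᵛ) (force ω P dᵛ) (P cᵛ) (P dᵛ) back) (λ eq → Δ≢0 (trans (sym (proj₁ swing)) eq))
    testD : ⊝ (ω 3F ⊕ ω 7F) ≡ 0ℚ × ω 1F ⊕ ω 3F ⊕ two ⊛ ω 7F ≡ 0ℚ
    testD = cross-test G B D (ω 7F) force-d (flip (force ω P dᵛ) (P cᵛ) (P dᵛ) (λ s → rotation-test (force ω P dᵛ) (force ω P cᵛ) (P dᵛ) (P cᵛ) (swap {force ω P cᵛ} {force ω P dᵛ} {P cᵛ} {P dᵛ} back) s)) (λ eq → Δ≢0 (trans (sym (proj₂ swing)) eq))
    minus : ∀ {x y} → ⊝ (x ⊕ y) ≡ 0ℚ → x ≡ fromℤ -1ᶻ ⊛ y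
    minus {x} {y} eq = x≡y⊕0 (solve 2 (λ x y → x := con -1ᶻ :* y :+ :- (:- (x :+ y))) refl x y)
      (trans (cong ⊝_ eq) ⊝0≡0)
    double : ∀ {x y} → two ⊛ x ⊖ y ≡ 0ℚ → y ≡ two ⊛ x
    double {x} {y} eq = x≡y⊕0 (solve 2 (λ x y → y := con (+ 2) :* x :+ :- (con (+ 2) :* x :- y)) refl x y)
      (trans (cong ⊝_ eq) ⊝0≡0)
    ω₀ : ω 0F ≡ fromℤ -1ᶻ ⊛ ω 4F
    ω₀ = minus (proj₁ testA)
    ω₁ : ω 1F ≡ two ⊛ ω 4F
    ω₁ = double (proj₂ testA)
    ω₂ : ω 2F ≡ fromℤ -1ᶻ ⊛ ω 5F
    ω₂ = minus (proj₁ testB)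
    ω₃ : ω 3F ≡ two ⊛ ω 5F
    ω₃ = double (proj₂ testB)
    ω₆ : ω 6F ≡ ω 4F
    ω₆ = x≡y⊕0 (solve 4 (λ s u k m → m := k :+ ((s :+ u :+ con (+ 2) :* m) :+ :- (u :+ m) :+ :- (s :+ k))) refl (ω 0F) (ω 2F) (ω 4F) (ω 6F))
      (trans (cong₂ _⊕_ (cong₂ _⊕_ (proj₂ testC) (proj₁ testC)) (proj₁ testA)) (solve 0 (con (+ 0) :+ con (+ 0) :+ con (+ 0) := con (+ 0)) refl))
    ω₅ : ω 5F ≡ ω 4F
    ω₅ = trans (x≡y⊕0 (solve 3 (λ u l m → l := m :+ (:- (u :+ m) :- :- (u :+ l))) refl (ω 2F) (ω 5F) (ω 6F))
      (trans (cong₂ _⊖_ (proj₁ testC) (proj₁ testB)) (solve 0 (con (+ 0) :- con (+ 0) := con (+ 0)) refl))) ω₆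

-- The pair (a × b, b - a) is the Plücker vector of a hinge line, that is, the rotation about the
-- hinge, and the sum is its work against the wrench (w, w′). A wrench reciprocal to all hinges must
-- vanish.
Spanning : ∀ {m} → Placement (m * 3) → Set
Spanning {m} p = ∀ (w w′ : Vector 3) →
  (∀ (i : Fin m) → (p (vtx i 0F) ×̇ p (vtx i 1F)) ∙ w ⊕ (p (vtx i 1F) ⊟ p (vtx i 0F)) ∙ w′ ≡ 0ℚ) → IsZero w × IsZero w′

module _ {m} (p : Placement (m * 3)) (apex : ∀ (j : Fin m) → Apex (local p j))
         (volume≢0 : ∀ (j : Fin m) → volume (local p j) ≢ 0ℚ) (spanning : Spanning {m} p) (h : Fin m)
         (c : Vector (suc (m * 8))) (stress : Stress p (hingeAndRing h) c) where

  private
    ω : Fin m → Vector 8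
    ω j t = c (suc (combine j t))
    F : Fin m → Placement 5
    F j = force (ω j) (local p j)
    χ : ℚ
    χ = c zero
    λᵒ : Vector m
    λᵒ j = ω j 4F
    ∙-𝟘 : ∀ {n} (x : Vector n) → x ∙ 𝟘 ≡ 0ℚ
    ∙-𝟘 x = ∙-zero x 𝟘 λ _ → inj₂ refl

    frontWrench backWrench : Fin m → Vector 3 → Vector 3 → ℚ
    frontWrench j τ ρ = F j aᵛ ∙ rigid τ ρ (local p j aᵛ) ⊕ F j bᵛ ∙ rigid τ ρ (local p j bᵛ)
    backWrench j τ ρ = F j cᵛ ∙ rigid τ ρ (local p j cᵛ) ⊕ F j dᵛ ∙ rigid τ ρ (local p j dᵛ)

    -- An apex lies on no other link and not on the bar, so its forces balance.
    apex-balance : ∀ j x → F j zᵛ ∙ x ≡ 0ℚ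
    apex-balance j x with next-surjective j
    ... | i , refl = trans (sym (begin
        χ ⊛ (δ (next i) h ⊛ ((p (vtx h 0F) ⊟ p (vtx h 1F)) ∙ (𝟘 ⊟ 𝟘))) ⊕
        ((F (next i) aᵛ ∙ 𝟘 ⊕ F (next i) bᵛ ∙ 𝟘 ⊕ F (next i) zᵛ ∙ x) ⊕ (F i cᵛ ∙ 𝟘 ⊕ F i dᵛ ∙ 𝟘))
          ≡⟨ cong₂ (λ s t → χ ⊛ (δ (next i) h ⊛ s) ⊕ t)
               (∙-zero (p (vtx h 0F) ⊟ p (vtx h 1F)) (𝟘 ⊟ 𝟘) λ _ → inj₂ (solve 0 (con (+ 0) :- con (+ 0) := con (+ 0)) refl))
               (cong₂ _⊕_ (cong (_⊕ F (next i) zᵛ ∙ x) (cong₂ _⊕_ (∙-𝟘 (F (next i) aᵛ)) (∙-𝟘 (F (next i) bᵛ))))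
                 (cong₂ _⊕_ (∙-𝟘 (F i cᵛ)) (∙-𝟘 (F i dᵛ)))) ⟩
        χ ⊛ (δ (next i) h ⊛ 0ℚ) ⊕ ((0ℚ ⊕ 0ℚ ⊕ F (next i) zᵛ ∙ x) ⊕ (0ℚ ⊕ 0ℚ))
          ≡⟨ solve 3 (λ a e y → a :* (e :* con (+ 0)) :+ ((con (+ 0) :+ con (+ 0) :+ y) :+ (con (+ 0) :+ con (+ 0))) := y) refl χ (δ (next i) h) _ ⟩
        F (next i) zᵛ ∙ x ∎)) (balance p h c stress i (λ { 0F → 𝟘 ; 1F → 𝟘 ; 2F → x }))
      where open ≡-Reasoning

    -- A rigid motion of a link stretches none of its bars. As the apex is balanced, what enters the
    -- link at the front hinge leaves it at the back.
    link-balance : ∀ j τ ρ → frontWrench j τ ρ ⊕ backWrench j τ ρ ≡ 0ℚ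
    link-balance j τ ρ = begin
      (F j aᵛ ∙ R aᵛ ⊕ F j bᵛ ∙ R bᵛ) ⊕ (F j cᵛ ∙ R cᵛ ⊕ F j dᵛ ∙ R dᵛ)
        ≡⟨ solve 4 (λ a b c d → (a :+ b) :+ (c :+ d) := a :+ (b :+ (con (+ 0) :+ (c :+ (d :+ con (+ 0)))))) refl _ _ _ _ ⟩
      F j aᵛ ∙ R aᵛ ⊕ (F j bᵛ ∙ R bᵛ ⊕ (0ℚ ⊕ (F j cᵛ ∙ R cᵛ ⊕ (F j dᵛ ∙ R dᵛ ⊕ 0ℚ))))
        ≡⟨ cong (λ x → F j aᵛ ∙ R aᵛ ⊕ (F j bᵛ ∙ R bᵛ ⊕ (x ⊕ (F j cᵛ ∙ R cᵛ ⊕ (F j dᵛ ∙ R dᵛ ⊕ 0ℚ))))) (apex-balance j (R zᵛ)) ⟨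
      ∑ (λ w → F j w ∙ R w)
        ≡⟨ virtualWork (local p j) R butterfly (ω j) ⟨
      ∑ (λ t → ω j t ⊛ stretch (local p j) R (butterfly t))
        ≡⟨ sum-zero (λ t → trans (cong (ω j t ⊛_) (stretch-rigid (local p j) τ ρ (butterfly t))) (zeroʳ (ω j t))) ⟩
      0ℚ ∎
      where
      open ≡-Reasoning
      R : Placement 5
      R w = rigid τ ρ (local p j w)

    -- A bar along the hinge does no work in a rigid motion either, so the wrench passes unchanged
    -- even through `h`.
    hinge-balance : ∀ j τ ρ → frontWrench (next j) τ ρ ⊕ backWrench j τ ρ ≡ 0ℚ
    hinge-balance j τ ρ = trans (sym (begin
        χ ⊛ (δ (next j) h ⊛ ((p (vtx h 0F) ⊟ p (vtx h 1F)) ∙ (R 0F ⊟ R 1F))) ⊕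
        ((F (next j) aᵛ ∙ R 0F ⊕ F (next j) bᵛ ∙ R 1F ⊕ F (next j) zᵛ ∙ 𝟘) ⊕ backWrench j τ ρ)
          ≡⟨ cong₂ (λ s t → χ ⊛ s ⊕ ((frontWrench (next j) τ ρ ⊕ t) ⊕ backWrench j τ ρ)) bar (∙-𝟘 (F (next j) zᵛ)) ⟩
        χ ⊛ 0ℚ ⊕ ((frontWrench (next j) τ ρ ⊕ 0ℚ) ⊕ backWrench j τ ρ)
          ≡⟨ solve 3 (λ a x y → a :* con (+ 0) :+ ((x :+ con (+ 0)) :+ y) := x :+ y) refl χ _ _ ⟩
        frontWrench (next j) τ ρ ⊕ backWrench j τ ρ ∎)) (balance p h c stress j (λ { 0F → R 0F ; 1F → R 1F ; 2F → 𝟘 }))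
      where
      open ≡-Reasoning
      R : Fin 3 → Vector 3
      R s = rigid τ ρ (p (vtx (next j) s))
      bar : δ (next j) h ⊛ ((p (vtx h 0F) ⊟ p (vtx h 1F)) ∙ (R 0F ⊟ R 1F)) ≡ 0ℚ
      bar with next j Fin.≟ h
      ... | yes refl = trans (*-identityˡ _) (stretch-rigid p τ ρ (hinge h))
      ... | no _     = zeroˡ _

    frontWrench-next : ∀ j τ ρ → frontWrench (next j) τ ρ ≡ frontWrench j τ ρ
    frontWrench-next j τ ρ = trans (solve 3 (λ x y z → x := y :+ ((x :+ z) :- (y :+ z))) refl _ (frontWrench j τ ρ) (backWrench j τ ρ))
      (trans (cong₂ (λ s t → frontWrench j τ ρ ⊕ (s ⊖ t)) (hinge-balance j τ ρ) (link-balance j τ ρ))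
        (solve 1 (λ x → x :+ (con (+ 0) :- con (+ 0)) := x) refl _))

    frontWrench-constant : ∀ i j τ ρ → frontWrench j τ ρ ≡ frontWrench i τ ρ
    frontWrench-constant i = next-induction (λ j → ∀ τ ρ → frontWrench j τ ρ ≡ frontWrench i τ ρ) i (λ _ _ → refl)
      λ j eq τ ρ → trans (frontWrench-next j τ ρ) (eq τ ρ)

    resultant moment : Fin m → Vector 3
    resultant j = F j aᵛ ⊞ F j bᵛ
    moment j = local p j aᵛ ×̇ F j aᵛ ⊞ local p j bᵛ ×̇ F j bᵛ

    frontWrench-linear : ∀ j τ ρ → frontWrench j τ ρ ≡ τ ∙ resultant j ⊕ ρ ∙ moment j
    frontWrench-linear j τ ρ = trans (cong₂ _⊕_ (one (F j aᵛ) (local p j aᵛ)) (one (F j bᵛ) (local p j bᵛ)))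
      (trans (solve 4 (λ a b c d → (a :+ b) :+ (c :+ d) := (a :+ c) :+ (b :+ d)) refl _ _ _ _)
        (sym (cong₂ _⊕_ (∙-+ʳ τ (F j aᵛ) (F j bᵛ)) (∙-+ʳ ρ (local p j aᵛ ×̇ F j aᵛ) (local p j bᵛ ×̇ F j bᵛ)))))
      where
      one : ∀ f x → f ∙ rigid τ ρ x ≡ τ ∙ f ⊕ ρ ∙ (x ×̇ f)
      one f x = solve 12 (λ f₀ f₁ f₂ x₀ x₁ x₂ t₀ t₁ t₂ r₀ r₁ r₂ →
        f₀ :* (t₀ :+ (r₁ :* x₂ :- r₂ :* x₁)) :+ (f₁ :* (t₁ :+ (r₂ :* x₀ :- r₀ :* x₂)) :+ (f₂ :* (t₂ :+ (r₀ :* x₁ :- r₁ :* x₀)) :+ con (+ 0))) :=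
        (t₀ :* f₀ :+ (t₁ :* f₁ :+ (t₂ :* f₂ :+ con (+ 0)))) :+
        (r₀ :* (x₁ :* f₂ :- x₂ :* f₁) :+ (r₁ :* (x₂ :* f₀ :- x₀ :* f₂) :+ (r₂ :* (x₀ :* f₁ :- x₁ :* f₀) :+ con (+ 0)))))
        refl (f 0F) (f 1F) (f 2F) (x 0F) (x 1F) (x 2F) (τ 0F) (τ 1F) (τ 2F) (ρ 0F) (ρ 1F) (ρ 2F)

    -- The wrench transmitted around the ring does no work in rotations about
    -- any of the hinges, and these span all rigid motions.
    frontWrench-zero : ∀ j τ ρ → frontWrench j τ ρ ≡ 0ℚ
    frontWrench-zero j τ ρ = trans (frontWrench-linear j τ ρ)
      (trans (cong₂ _⊕_ (∙-zero τ (resultant j) (inj₂ ∘ proj₁ both)) (∙-zero ρ (moment j) (inj₂ ∘ proj₂ both))) (+-identityˡ 0ℚ))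
      where
      -- The rotation about the line ab has translation part a × b and angular velocity b - a, and
      -- fixes both points.
      a×b+[b-a]×a≡0 : ∀ a b d → rigid (a ×̇ b) (b ⊟ a) a d ≡ 0ℚ × rigid (a ×̇ b) (b ⊟ a) b d ≡ 0ℚ
      a×b+[b-a]×a≡0 a b = λ { 0F → component (a 1F) (a 2F) (b 1F) (b 2F)
        ; 1F → component (a 2F) (a 0F) (b 2F) (b 0F) ; 2F → component (a 0F) (a 1F) (b 0F) (b 1F) }
        where
        component : ∀ x y z w →
          (x ⊛ w ⊖ y ⊛ z) ⊕ ((z ⊖ x) ⊛ y ⊖ (w ⊖ y) ⊛ x) ≡ 0ℚ × (x ⊛ w ⊖ y ⊛ z) ⊕ ((z ⊖ x) ⊛ w ⊖ (w ⊖ y) ⊛ z) ≡ 0ℚ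
        component x y z w =
          solve 4 (λ x y z w → (x :* w :- y :* z) :+ ((z :- x) :* y :- (w :- y) :* x) := con (+ 0)) refl x y z w ,
          solve 4 (λ x y z w → (x :* w :- y :* z) :+ ((z :- x) :* w :- (w :- y) :* z) := con (+ 0)) refl x y z w
      both : IsZero (resultant j) × IsZero (moment j)
      both = spanning (resultant j) (moment j) λ i →
        let a = p (vtx i 0F) ; b = p (vtx i 1F) in
        trans (sym (frontWrench-linear j (a ×̇ b) (b ⊟ a)))
          (trans (frontWrench-constant i j (a ×̇ b) (b ⊟ a))
            (trans (cong₂ _⊕_ (∙-zero (F i aᵛ) _ (λ d → inj₂ (proj₁ (a×b+[b-a]×a≡0 a b d))))
                              (∙-zero (F i bᵛ) _ (λ d → inj₂ (proj₂ (a×b+[b-a]×a≡0 a b d))))) (+-identityˡ 0ℚ)))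

    backWrench-zero : ∀ j τ ρ → backWrench j τ ρ ≡ 0ℚ
    backWrench-zero j τ ρ = trans (sym (+-identityˡ _)) (trans (cong (_⊕ backWrench j τ ρ) (sym (frontWrench-zero j τ ρ))) (link-balance j τ ρ))

    coefficients : ∀ j t → ω j t ≡ fromℤ (signature t) ⊛ λᵒ j
    coefficients j = K₅-stress (ω j) (local p j) (apex j) (volume≢0 j) (frontWrench-zero j) (backWrench-zero j)

    -- Equilibrium at the first end of the hinge shared by `j` and `next j`, where all three forces
    -- act along the hinge: the front of `next j`, the back of `j`, and the bar if this is `h`. The
    -- normal `n` of the plane acd pairs with the hinge direction to `volume`, so testing with `n`
    -- leaves one scalar equation.
    scale-next : ∀ j → λᵒ (next j) ≡ two ⊛ λᵒ j ⊕ ⊝ (χ ⊛ δ (next j) h)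
    scale-next j = x≡y⊕0
      (solve 3 (λ x y z → x := con (+ 2) :* y :+ :- z :+ con -1ᶻ :* (con (+ 2) :* y :- x :- z)) refl (λᵒ (next j)) (λᵒ j) (χ ⊛ δ (next j) h))
      (trans (cong (fromℤ -1ᶻ ⊛_) (x⊛y≡0⇒y≡0 (volume≢0 (next j)) (trans (sym work) equilibrium))) (zeroʳ _))
      where
      open ≡-Reasoning
      i = next j
      B = local p i bᵛ ⊟ local p i aᵛ
      n : Vector 3
      n = (local p i cᵛ ⊟ local p i aᵛ) ×̇ (local p i dᵛ ⊟ local p i aᵛ)
      equilibrium : χ ⊛ (δ i h ⊛ ((p (vtx h 0F) ⊟ p (vtx h 1F)) ∙ (n ⊟ 𝟘))) ⊕
        ((F i aᵛ ∙ n ⊕ F i bᵛ ∙ 𝟘 ⊕ F i zᵛ ∙ 𝟘) ⊕ (F j cᵛ ∙ n ⊕ F j dᵛ ∙ 𝟘)) ≡ 0ℚ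
      equilibrium = balance p h c stress j (λ { 0F → n ; 1F → 𝟘 ; 2F → 𝟘 })
      along : ∀ (f : Vector 3) x → (∀ d → f d ≡ x ⊛ B d) → f ∙ n ≡ x ⊛ volume (local p i)
      along f x eq = trans (sum-cong λ d → trans (cong (_⊛ n d) (eq d)) (*-assoc x (B d) (n d))) (sym (*-sum x (λ d → B d ⊛ n d)))
      bar : δ i h ⊛ ((p (vtx h 0F) ⊟ p (vtx h 1F)) ∙ (n ⊟ 𝟘)) ≡ δ i h ⊛ (⊝ volume (local p i))
      bar with i Fin.≟ h
      ... | yes refl = cong (1ℚ ⊛_) (trans (sum-cong λ d → solve 3 (λ a b n → (a :- b) :* (n :- con (+ 0)) := (:- (b :- a)) :* n) refl
              (p (vtx h 0F) d) (p (vtx h 1F) d) (n d))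
            (trans (along (λ d → ⊝ B d) (fromℤ -1ᶻ) (λ d → solve 1 (λ b → :- b := con -1ᶻ :* b) refl (B d)))
              (solve 1 (λ v → con -1ᶻ :* v := :- v) refl _)))
      ... | no _ = trans (zeroˡ _) (sym (zeroˡ _))
      frontForce : ∀ d → F i aᵛ d ≡ ⊝ λᵒ i ⊛ B d
      frontForce d = trans (force-a (ω i) (local p i) (apex i) d)
        (trans (cong₂ (λ x y → ⊝ λᵒ i ⊛ B d ⊕ ⊝ (x ⊕ λᵒ i) ⊛ (local p i cᵛ ⊟ local p i aᵛ) d ⊕ (two ⊛ λᵒ i ⊖ y) ⊛ (local p i dᵛ ⊟ local p i aᵛ) d)
                 (coefficients i 0F) (coefficients i 1F))
          (solve 4 (λ l b c d → :- l :* b :+ :- (con -1ᶻ :* l :+ l) :* c :+ (con (+ 2) :* l :- con (+ 2) :* l) :* d := :- l :* b) refl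
            (λᵒ i) (B d) ((local p i cᵛ ⊟ local p i aᵛ) d) ((local p i dᵛ ⊟ local p i aᵛ) d)))
      backForce : ∀ d → F j cᵛ d ≡ two ⊛ λᵒ j ⊛ B d
      backForce d = trans (force-c (ω j) (local p j) (apex j) d)
        (trans (cong₂ _⊕_ (cong₂ _⊕_ (cong (λ x → two ⊛ x ⊛ B d) (coefficients j 6F))
                 (cong₂ (λ x y → ⊝ (x ⊕ y) ⊛ (local p j bᵛ ⊟ local p j aᵛ) d) (coefficients j 2F) (coefficients j 6F)))
               (trans (cong₂ (λ x y → (x ⊕ ω j 2F ⊕ two ⊛ y) ⊛ (local p j cᵛ ⊟ local p j aᵛ) d) (coefficients j 0F) (coefficients j 6F))
                 (cong (λ x → (fromℤ -1ᶻ ⊛ λᵒ j ⊕ x ⊕ two ⊛ (1ℚ ⊛ λᵒ j)) ⊛ (local p j cᵛ ⊟ local p j aᵛ) d) (coefficients j 2F))))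
          (solve 4 (λ l b c d → con (+ 2) :* (con (+ 1) :* l) :* b :+ :- (con -1ᶻ :* l :+ con (+ 1) :* l) :* c :+
              (con -1ᶻ :* l :+ con -1ᶻ :* l :+ con (+ 2) :* (con (+ 1) :* l)) :* d := con (+ 2) :* l :* b) refl
            (λᵒ j) (B d) ((local p j bᵛ ⊟ local p j aᵛ) d) ((local p j cᵛ ⊟ local p j aᵛ) d)))
      work : χ ⊛ (δ i h ⊛ ((p (vtx h 0F) ⊟ p (vtx h 1F)) ∙ (n ⊟ 𝟘))) ⊕
        ((F i aᵛ ∙ n ⊕ F i bᵛ ∙ 𝟘 ⊕ F i zᵛ ∙ 𝟘) ⊕ (F j cᵛ ∙ n ⊕ F j dᵛ ∙ 𝟘)) ≡
        volume (local p i) ⊛ (two ⊛ λᵒ j ⊖ λᵒ i ⊖ χ ⊛ δ i h)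
      work = begin
        _
          ≡⟨ cong₂ (λ s t → χ ⊛ s ⊕ t) bar (cong₂ _⊕_
               (cong₂ _⊕_ (cong₂ _⊕_ (along (F i aᵛ) (⊝ λᵒ i) frontForce) (∙-𝟘 (F i bᵛ))) (∙-𝟘 (F i zᵛ)))
               (cong₂ _⊕_ (along (F j cᵛ) (two ⊛ λᵒ j) backForce) (∙-𝟘 (F j dᵛ)))) ⟩
        χ ⊛ (δ i h ⊛ ⊝ V) ⊕ ((⊝ λᵒ i ⊛ V ⊕ 0ℚ ⊕ 0ℚ) ⊕ (two ⊛ λᵒ j ⊛ V ⊕ 0ℚ))
          ≡⟨ solve 5 (λ x e v l k → x :* (e :* :- v) :+ ((:- l :* v :+ con (+ 0) :+ con (+ 0)) :+ (con (+ 2) :* k :* v :+ con (+ 0))) :=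
               v :* (con (+ 2) :* k :- l :- x :* e)) refl χ (δ i h) V (λᵒ i) (λᵒ j) ⟩
        V ⊛ (two ⊛ λᵒ j ⊖ λᵒ i ⊖ χ ⊛ δ i h) ∎
        where
        V = volume (local p i)

    scale-away : ∀ j → χ ⊛ δ (next j) h ≡ 0ℚ → λᵒ (next j) ≡ two ⊛ λᵒ j
    scale-away j eq = x≡y⊕0 (scale-next j) (trans (cong ⊝_ eq) ⊝0≡0)

    all-zero : IsZero λᵒ → χ ≡ 0ℚ → IsZero c
    all-zero λ≡0 χ≡0 zero    = χ≡0
    all-zero λ≡0 χ≡0 (suc x) with Finₚ.combine-surjective {m} {8} x
    ... | j , t , refl = trans (coefficients j t) (trans (cong (fromℤ (signature t) ⊛_) (λ≡0 j)) (zeroʳ _))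

    -- Without a force in the bar every step doubles the scale. The sum of their absolute values is
    -- invariant under the cyclic shift, so S = 2 S.
    from-bar : χ ≡ 0ℚ → IsZero c
    from-bar χ≡0 = all-zero λ≡0 χ≡0
      where
      open ≡-Reasoning
      S : ℚ
      S = ∑ λ j → ℚ.∣ λᵒ j ∣
      S≡2S : S ≡ two ⊛ S
      S≡2S = begin
        S                                ≡⟨ sum-next (λ j → ℚ.∣ λᵒ j ∣) ⟨
        ∑ (λ j → ℚ.∣ λᵒ (next j) ∣)      ≡⟨ sum-cong (λ j → trans (cong ℚ.∣_∣ (scale-away j (trans (cong (_⊛ δ (next j) h) χ≡0) (zeroˡ _)))) (∣⊛∣ two (λᵒ j))) ⟩
        ∑ (λ j → two ⊛ ℚ.∣ λᵒ j ∣)       ≡⟨ *-sum two (λ j → ℚ.∣ λᵒ j ∣) ⟨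
        two ⊛ S                          ∎
      S≡0 : S ≡ 0ℚ
      S≡0 = trans (solve 1 (λ s → s := con (+ 2) :* s :- s) refl S) (trans (cong (_⊖ S) (sym S≡2S)) (solve 1 (λ s → s :- s := con (+ 0)) refl S))
      λ≡0 : IsZero λᵒ
      λ≡0 j = ℚₚ.∣p∣≡0⇒p≡0 (λᵒ j) (ℚₚ.≤-antisym
        (ℚₚ.≤-trans (term≤sum (λ j → ℚ.∣ λᵒ j ∣) (λ j → ℚₚ.0≤∣p∣ (λᵒ j)) j) (ℚₚ.≤-reflexive S≡0)) (ℚₚ.0≤∣p∣ (λᵒ j)))

    -- Doubling is unconditional except in the step into `h`. A zero scale is therefore carried
    -- backwards to `h`, then forwards from `h` to all links, and the step into `h` finally yields χ
    -- = 0.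
    from-link : ∀ j → λᵒ j ≡ 0ℚ → IsZero c
    from-link j λⱼ≡0 = all-zero λ≡0 χ≡0
      where
      away : ∀ {i} → next i ≢ h → λᵒ (next i) ≡ two ⊛ λᵒ i
      away {i} i≢h = scale-away i (trans (cong (χ ⊛_) (δ-≢ i≢h)) (zeroʳ χ))
      λₕ≡0 : λᵒ h ≡ 0ℚ
      λₕ≡0 = next-induction (λ j → λᵒ j ≡ 0ℚ → λᵒ h ≡ 0ℚ) h id back j λⱼ≡0
        where
        back : ∀ i → (λᵒ i ≡ 0ℚ → λᵒ h ≡ 0ℚ) → λᵒ (next i) ≡ 0ℚ → λᵒ h ≡ 0ℚ
        back i ih eq with next i Fin.≟ h
        ... | yes refl = eq
        ... | no i≢h = ih (x⊛y≡0⇒y≡0 {two} (λ ()) (trans (sym (away i≢h)) eq))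
      λ≡0 : IsZero λᵒ
      λ≡0 = next-induction (λ j → λᵒ j ≡ 0ℚ) h λₕ≡0 forth
        where
        forth : ∀ i → λᵒ i ≡ 0ℚ → λᵒ (next i) ≡ 0ℚ
        forth i eq with next i Fin.≟ h
        ... | yes refl = λₕ≡0
        ... | no i≢h = trans (away i≢h) (trans (cong (two ⊛_) eq) (zeroʳ two))
      χ≡0 : χ ≡ 0ℚ
      χ≡0 with next-surjective h
      ... | i , refl = begin
        χ                                       ≡⟨ solve 2 (λ x l → x := con (+ 2) :* l :- (con (+ 2) :* l :+ :- (x :* con (+ 1)))) refl χ (λᵒ i) ⟩
        two ⊛ λᵒ i ⊖ (two ⊛ λᵒ i ⊕ ⊝ (χ ⊛ 1ℚ))  ≡⟨ cong (λ e → two ⊛ λᵒ i ⊖ (two ⊛ λᵒ i ⊕ ⊝ (χ ⊛ e))) (δ-refl (next i)) ⟨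
        two ⊛ λᵒ i ⊖ (two ⊛ λᵒ i ⊕ ⊝ (χ ⊛ δ (next i) (next i)))  ≡⟨ cong (two ⊛ λᵒ i ⊖_) (scale-next i) ⟨
        two ⊛ λᵒ i ⊖ λᵒ (next i)                ≡⟨ cong₂ (λ x y → two ⊛ x ⊖ y) (λ≡0 i) (λ≡0 (next i)) ⟩
        two ⊛ 0ℚ ⊖ 0ℚ                           ≡⟨ solve 0 (con (+ 2) :* con (+ 0) :- con (+ 0) := con (+ 0)) refl ⟩
        0ℚ                                      ∎
        where open ≡-Reasoning

  circuit : ∀ i → c i ≡ 0ℚ → IsZero c
  circuit zero    χ≡0 = from-bar χ≡0
  circuit (suc x) cₓ≡0 with Finₚ.combine-surjective {m} {8} x
  ... | j , t , refl = from-link j (x⊛y≡0⇒y≡0 (signature≢0 t) (trans (sym (coefficients j t)) cₓ≡0))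

-- Six pairwise skew lines with linearly independent Plücker vectors.
lineStart lineEnd : Fin 6 → Fin 3 → ℤ
lineStart 0F = lookup (+ 2 ∷ + 0 ∷ + 0 ∷ [])
lineStart 1F = lookup (+ 1 ∷ + 2 ∷ + 1 ∷ [])
lineStart 2F = lookup (+ 1 ∷ + 1 ∷ + 1 ∷ [])
lineStart 3F = lookup (+ 1 ∷ + 1 ∷ + 2 ∷ [])
lineStart 4F = lookup (+ 1 ∷ + 0 ∷ + 0 ∷ [])
lineStart 5F = lookup (+ 1 ∷ + 0 ∷ + 2 ∷ [])
lineEnd 0F = lookup (+ 2 ∷ + 1 ∷ + 1 ∷ [])
lineEnd 1F = lookup (+ 2 ∷ + 2 ∷ + 1 ∷ [])
lineEnd 2F = lookup (+ 0 ∷ + 1 ∷ + 0 ∷ [])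
lineEnd 3F = lookup (+ 0 ∷ + 2 ∷ + 2 ∷ [])
lineEnd 4F = lookup (+ 1 ∷ + 1 ∷ + 0 ∷ [])
lineEnd 5F = lookup (+ 0 ∷ + 1 ∷ + 1 ∷ [])

linkAt : Fin 6 → Fin 6 → Placement 5
linkAt x y aᵛ d = fromℤ (lineStart x d)
linkAt x y bᵛ d = fromℤ (lineEnd x d)
linkAt x y zᵛ d = fromℤ (lineStart x d) ⊕ fromℤ (lineEnd x d) ⊕ fromℤ (lineStart y d) ⊖ two ⊛ fromℤ (lineEnd y d)
linkAt x y cᵛ d = fromℤ (lineStart y d)
linkAt x y dᵛ d = fromℤ (lineEnd y d)

opaque
  unfolding _⊕_

  -- All pairs of lines are checked by evaluation, for which the opaque operations have to unfold.
  skew : ∀ x y → x ≡ y ⊎ volume (linkAt x y) ≢ 0ℚ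
  skew = toWitness {a? = Finₚ.all? λ x → Finₚ.all? λ y → (x Fin.≟ y) ⊎-dec ¬? (volume (linkAt x y) ℚₚ.≟ 0ℚ)} tt

-- Consecutive hinges, the last and the first included, lie on different lines.
lineOf : ℕ → Fin 6
lineOf 0 = 0F
lineOf 1 = 1F
lineOf 2 = 2F
lineOf 3 = 3F
lineOf (suc (suc (suc (suc n)))) = alternate n
  where
  alternate : ℕ → Fin 6
  alternate 0 = 4F
  alternate 1 = 5F
  alternate (suc (suc n)) = alternate n

lineOf-suc : ∀ n → lineOf n ≢ lineOf (suc n)
lineOf-suc 0 ()
lineOf-suc 1 ()
lineOf-suc 2 ()
lineOf-suc 3 ()
lineOf-suc 4 ()
lineOf-suc 5 ()
lineOf-suc (suc (suc (suc (suc (suc (suc n)))))) = lineOf-suc (suc (suc (suc (suc n))))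

lineOf-last : ∀ n → lineOf (5 ℕ.+ n) ≢ 0F
lineOf-last 0 ()
lineOf-last 1 ()
lineOf-last (suc (suc n)) = lineOf-last n

lineOf-next : ∀ {m} → 6 ≤ m → (i : Fin m) → lineOf (toℕ i) ≢ lineOf (toℕ (next i))
lineOf-next (s≤s (s≤s (s≤s (s≤s (s≤s (s≤s {n = n} _)))))) i with view i
... | ‵fromℕ rewrite next-fromℕ (5 ℕ.+ n) | Finₚ.toℕ-fromℕ n = lineOf-last n
... | ‵inject₁ i rewrite next-inject₁ i | Finₚ.toℕ-inject₁ i = lineOf-suc (toℕ i)

lineWork : Vector 3 → Vector 3 → Vector 3 → Vector 3 → ℚ
lineWork a b w w′ = (a ×̇ b) ∙ w ⊕ (b ⊟ a) ∙ w′

×̇-cong : ∀ {a a′ b b′ : Vector 3} → (∀ d → a d ≡ a′ d) → (∀ d → b d ≡ b′ d) → ∀ d → (a ×̇ b) d ≡ (a′ ×̇ b′) d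
×̇-cong a b 0F = cong₂ _⊖_ (cong₂ _⊛_ (a 1F) (b 2F)) (cong₂ _⊛_ (a 2F) (b 1F))
×̇-cong a b 1F = cong₂ _⊖_ (cong₂ _⊛_ (a 2F) (b 0F)) (cong₂ _⊛_ (a 0F) (b 2F))
×̇-cong a b 2F = cong₂ _⊖_ (cong₂ _⊛_ (a 0F) (b 1F)) (cong₂ _⊛_ (a 1F) (b 0F))

volume-cong : ∀ {P Q : Placement 5} → (∀ v d → P v d ≡ Q v d) → volume P ≡ volume Q
volume-cong eq = sum-cong λ d → cong₂ _⊛_ (edge bᵛ d) (×̇-cong (edge cᵛ) (edge dᵛ) d)
  where
  edge : ∀ v d → _
  edge v d = cong₂ _⊖_ (eq v d) (eq aᵛ d)

lines-span : ∀ w w′ → (∀ x → lineWork (fromℤ ∘ lineStart x) (fromℤ ∘ lineEnd x) w w′ ≡ 0ℚ) → IsZero w × IsZero w′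
lines-span w w′ works = (λ { 0F → zero-by 3F (combination 3F) ; 1F → zero-by 4F (combination 4F) ; 2F → zero-by 5F (combination 5F) }) ,
                        (λ { 0F → zero-by 0F (combination 0F) ; 1F → zero-by 1F (combination 1F) ; 2F → zero-by 2F (combination 2F) })
  where
  -- The inverse of the matrix of Plücker vectors, with the unknowns in the order w′, w. It is
  -- integral because that matrix has determinant 1 or -1.
  inverse : Fin 6 → Fin 6 → ℤ
  inverse 0F = lookup (+ 3 ∷ + 3 ∷ + 4 ∷ -1ᶻ ∷ -1ᶻ ∷ -1ᶻ ∷ [])
  inverse 1F = lookup (-1ᶻ ∷ -1ᶻ ∷ -2ᶻ ∷ + 0 ∷ + 1 ∷ + 1 ∷ [])
  inverse 2F = lookup (-2ᶻ ∷ -1ᶻ ∷ -2ᶻ ∷ + 2 ∷ + 1 ∷ -1ᶻ ∷ [])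
  inverse 3F = lookup (+ 0 ∷ -1ᶻ ∷ -1ᶻ ∷ -1ᶻ ∷ + 0 ∷ + 1 ∷ [])
  inverse 4F = lookup (-1ᶻ ∷ + 0 ∷ + 0 ∷ + 1 ∷ + 1 ∷ -1ᶻ ∷ [])
  inverse 5F = lookup (+ 1 ∷ + 1 ∷ + 2 ∷ + 0 ∷ + 0 ∷ -1ᶻ ∷ [])
  unknown : Vector 6
  unknown = lookup (w′ 0F ∷ w′ 1F ∷ w′ 2F ∷ w 0F ∷ w 1F ∷ w 2F ∷ [])
  L : Vector 6
  L x = lineWork (fromℤ ∘ lineStart x) (fromℤ ∘ lineEnd x) w w′
  -- Syntactic counterparts of `∑`, `_×̇_` and `lineWork`; they evaluate to the originals by
  -- unfolding, so that `solve` accepts the statement as it stands.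
  ∑ᴾ : ∀ {n k} → (Fin n → Polynomial k) → Polynomial k
  ∑ᴾ {zero}  f = con (+ 0)
  ∑ᴾ {suc n} f = f zero :+ ∑ᴾ (f ∘ suc)
  crossᴾ : ∀ {k} → (Fin 3 → Polynomial k) → (Fin 3 → Polynomial k) → Fin 3 → Polynomial k
  crossᴾ x y 0F = x 1F :* y 2F :- x 2F :* y 1F
  crossᴾ x y 1F = x 2F :* y 0F :- x 0F :* y 2F
  crossᴾ x y 2F = x 0F :* y 1F :- x 1F :* y 0F
  lineᴾ : ∀ {k} → (Fin 3 → Polynomial k) → (Fin 3 → Polynomial k) → Fin 6 → Polynomial k
  lineᴾ w w′ x = ∑ᴾ (λ d → crossᴾ (con ∘ lineStart x) (con ∘ lineEnd x) d :* w d) :+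
    ∑ᴾ (λ d → (con (lineEnd x d) :- con (lineStart x d)) :* w′ d)
  equation : Fin 6 → (u₀ u₁ u₂ u₃ u₄ u₅ : Polynomial 6) → Polynomial 6 × Polynomial 6
  equation l u₀ u₁ u₂ u₃ u₄ u₅ =
    lookup (u₀ ∷ u₁ ∷ u₂ ∷ u₃ ∷ u₄ ∷ u₅ ∷ []) l :=
    ∑ᴾ λ x → con (inverse l x) :* lineᴾ (lookup (u₃ ∷ u₄ ∷ u₅ ∷ [])) (lookup (u₀ ∷ u₁ ∷ u₂ ∷ [])) x
  combination : ∀ l → unknown l ≡ ∑ (λ x → fromℤ (inverse l x) ⊛ L x)
  combination 0F = solve 6 (equation 0F) refl (w′ 0F) (w′ 1F) (w′ 2F) (w 0F) (w 1F) (w 2F)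
  combination 1F = solve 6 (equation 1F) refl (w′ 0F) (w′ 1F) (w′ 2F) (w 0F) (w 1F) (w 2F)
  combination 2F = solve 6 (equation 2F) refl (w′ 0F) (w′ 1F) (w′ 2F) (w 0F) (w 1F) (w 2F)
  combination 3F = solve 6 (equation 3F) refl (w′ 0F) (w′ 1F) (w′ 2F) (w 0F) (w 1F) (w 2F)
  combination 4F = solve 6 (equation 4F) refl (w′ 0F) (w′ 1F) (w′ 2F) (w 0F) (w 1F) (w 2F)
  combination 5F = solve 6 (equation 5F) refl (w′ 0F) (w′ 1F) (w′ 2F) (w 0F) (w 1F) (w 2F)
  zero-by : ∀ l {y} → y ≡ ∑ (λ x → fromℤ (inverse l x) ⊛ L x) → y ≡ 0ℚ
  zero-by l eq = trans eq (∙-zero (fromℤ ∘ inverse l) L (inj₂ ∘ works))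

module _ {m} (6≤m : 6 ≤ m) where

  ringPlacement : Placement (m * 3)
  ringPlacement v = let (i , s) = remQuot {m} 3 v in linkAt (lineOf (toℕ i)) (lineOf (toℕ (next i))) (s Fin.↑ˡ 2)

  private
    atLink : Fin m → Placement 5
    atLink i = linkAt (lineOf (toℕ i)) (lineOf (toℕ (next i)))

    ringPlacement-vtx : ∀ (i : Fin m) s d → ringPlacement (vtx i s) d ≡ atLink i (s Fin.↑ˡ 2) d
    ringPlacement-vtx i s d = cong (λ (i , s) → atLink i (s Fin.↑ˡ 2) d) (Finₚ.remQuot-combine {m} {3} i s)

    ringPlacement-local : ∀ j v d → local ringPlacement j v d ≡ atLink j v d
    ringPlacement-local j aᵛ d = ringPlacement-vtx j 0F d
    ringPlacement-local j bᵛ d = ringPlacement-vtx j 1F d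
    ringPlacement-local j zᵛ d = ringPlacement-vtx j 2F d
    ringPlacement-local j cᵛ d = ringPlacement-vtx (next j) 0F d
    ringPlacement-local j dᵛ d = ringPlacement-vtx (next j) 1F d

    apex : ∀ (j : Fin m) → Apex (local ringPlacement j)
    apex j d = trans (ringPlacement-local j zᵛ d) (sym (cong₂ _⊖_
      (cong₂ _⊕_ (cong₂ _⊕_ (ringPlacement-local j aᵛ d) (ringPlacement-local j bᵛ d)) (ringPlacement-local j cᵛ d))
      (cong (two ⊛_) (ringPlacement-local j dᵛ d))))

    volume≢0 : ∀ (j : Fin m) → volume (local ringPlacement j) ≢ 0ℚ
    volume≢0 j eq with skew (lineOf (toℕ j)) (lineOf (toℕ (next j)))
    ... | inj₁ same = lineOf-next 6≤m j same
    ... | inj₂ ≢0   = ≢0 (trans (sym (volume-cong (ringPlacement-local j))) eq)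

    lineOf-toℕ : ∀ x → lineOf (toℕ x) ≡ x
    lineOf-toℕ 0F = refl
    lineOf-toℕ 1F = refl
    lineOf-toℕ 2F = refl
    lineOf-toℕ 3F = refl
    lineOf-toℕ 4F = refl
    lineOf-toℕ 5F = refl

    spanning : Spanning {m} ringPlacement
    spanning w w′ works = lines-span w w′ λ x →
      let i = Fin.inject≤ x 6≤m
          line : lineOf (toℕ i) ≡ x
          line = trans (cong lineOf (Finₚ.toℕ-inject≤ x 6≤m)) (lineOf-toℕ x)
          start : ∀ d → ringPlacement (vtx i 0F) d ≡ fromℤ (lineStart x d)
          start d = trans (ringPlacement-vtx i 0F d) (cong (λ x → fromℤ (lineStart x d)) line)
          end : ∀ d → ringPlacement (vtx i 1F) d ≡ fromℤ (lineEnd x d)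
          end d = trans (ringPlacement-vtx i 1F d) (cong (λ x → fromℤ (lineEnd x d)) line)
      in trans (sym (cong₂ _⊕_ (sum-cong λ d → cong (_⊛ w d) (×̇-cong start end d))
                               (sum-cong λ d → cong (_⊛ w′ d) (cong₂ _⊖_ (end d) (start d))))) (works i)

  ring-circuitFamily : ∀ (h : Fin m) → CircuitFamily ringPlacement (hingeAndRing h)
  ring-circuitFamily h c stress = circuit ringPlacement apex volume≢0 spanning h c stress

-- Stresses of K₅

-- The five points become vectors (1, P v) in a space of dimension four.
affineDependency : ∀ (P : Placement 5) →
  ∃ λ μ → ∑ μ ≡ 0ℚ × (∀ d → ∑ (λ v → μ v ⊛ P v d) ≡ 0ℚ) × ∃ λ v → μ v ≢ 0ℚ
affineDependency P with nonTrivial 4 (λ v → λ { zero → 1ℚ ; (suc d) → P v d })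
... | μ , kills , nonzero =
  μ , trans (sum-cong λ v → solve 1 (λ x → x := x :* con (+ 1)) refl (μ v)) (kills zero) , kills ∘ suc , nonzero

K₅-weight : Vector 5 → Vector 8
K₅-weight μ t = let (u , v) = butterfly t in μ u ⊛ μ v

-- Each edge term is `g u v ⊕ g v u`. The sum of `g` over all ordered pairs vanishes, its two parts
-- containing the factors ∑ μ and ∑ μ P, and so does its diagonal. What remains is minus the two
-- pairs of K₅ that the butterfly lacks.
K₅-work : ∀ (P q : Placement 5) μ → ∑ μ ≡ 0ℚ → (∀ d → ∑ (λ v → μ v ⊛ P v d) ≡ 0ℚ) →
  ∑ (λ t → K₅-weight μ t ⊛ stretch P q (butterfly t)) ≡
  ⊝ (μ aᵛ ⊛ μ bᵛ ⊛ stretch P q (aᵛ , bᵛ) ⊕ μ cᵛ ⊛ μ dᵛ ⊛ stretch P q (cᵛ , dᵛ))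
K₅-work P q μ ∑μ≡0 ∑μP≡0 = begin
  ∑ (λ t → s t ⊛ ∑ (x t))                        ≡⟨ sum-cong (λ t → *-sum (s t) (x t)) ⟩
  ∑ (λ t → ∑ (λ d → s t ⊛ x t d))                ≡⟨ sum-swap (λ t d → s t ⊛ x t d) ⟩
  ∑ (λ d → ∑ (λ t → s t ⊛ x t d))                ≡⟨ sum-cong coordinate ⟩
  ∑ (λ d → ⊝ (α ⊛ y d ⊕ γ ⊛ z d))                ≡⟨ sum-neg (λ d → α ⊛ y d ⊕ γ ⊛ z d) ⟩
  ⊝ ∑ (λ d → α ⊛ y d ⊕ γ ⊛ z d)                  ≡⟨ cong ⊝_ (sum-+ (λ d → α ⊛ y d) (λ d → γ ⊛ z d)) ⟩
  ⊝ (∑ (λ d → α ⊛ y d) ⊕ ∑ (λ d → γ ⊛ z d))      ≡⟨ cong ⊝_ (cong₂ _⊕_ (*-sum α y) (*-sum γ z)) ⟨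
  ⊝ (α ⊛ ∑ y ⊕ γ ⊛ ∑ z)                          ∎
  where
  open ≡-Reasoning
  s : Vector 8
  s = K₅-weight μ
  α γ : ℚ
  α = μ aᵛ ⊛ μ bᵛ
  γ = μ cᵛ ⊛ μ dᵛ
  x : Fin 8 → Vector 3
  x t d = let (u , v) = butterfly t in (P u d ⊖ P v d) ⊛ (q u d ⊖ q v d)
  y z : Vector 3
  y d = (P aᵛ d ⊖ P bᵛ d) ⊛ (q aᵛ d ⊖ q bᵛ d)
  z d = (P cᵛ d ⊖ P dᵛ d) ⊛ (q cᵛ d ⊖ q dᵛ d)
  coordinate : ∀ d → ∑ (λ t → s t ⊛ x t d) ≡ ⊝ (α ⊛ y d ⊕ γ ⊛ z d)
  coordinate d = x≡y⊕0
    (trans (sum-cong λ t → pair (proj₁ (butterfly t)) (proj₂ (butterfly t)))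
      (trans expand (cong (λ w → ⊝ w ⊕ (∑ (λ u → ∑ (g u)) ⊖ ∑ (λ u → g u u))) (sym (cong₂ _⊕_ (pair aᵛ bᵛ) (pair cᵛ dᵛ))))))
    (trans (cong₂ _⊖_ all-pairs (sum-zero λ u → solve 3 (λ m a b → m :* a :* b :* m :- m :* a :* (m :* b) := con (+ 0)) refl (μ u) (P u d) (q u d)))
      (solve 0 (con (+ 0) :- con (+ 0) := con (+ 0)) refl))
    where
    g : Fin 5 → Fin 5 → ℚ
    g u v = μ u ⊛ P u d ⊛ q u d ⊛ μ v ⊖ μ u ⊛ P u d ⊛ (μ v ⊛ q v d)
    pair : ∀ u v → μ u ⊛ μ v ⊛ ((P u d ⊖ P v d) ⊛ (q u d ⊖ q v d)) ≡ g u v ⊕ g v u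
    pair u v = solve 6 (λ m n a b e f → m :* n :* ((a :- b) :* (e :- f)) :=
      (m :* a :* e :* n :- m :* a :* (n :* f)) :+ (n :* b :* f :* m :- n :* b :* (m :* e))) refl (μ u) (μ v) (P u d) (P v d) (q u d) (q v d)
    expand : ∑ (λ t → let (u , v) = butterfly t in g u v ⊕ g v u) ≡
      ⊝ ((g aᵛ bᵛ ⊕ g bᵛ aᵛ) ⊕ (g cᵛ dᵛ ⊕ g dᵛ cᵛ)) ⊕ (∑ (λ u → ∑ (g u)) ⊖ ∑ (λ u → g u u))
    expand = solve 25 (λ aa ab az ac ae ba bb bz bc be za zb zz zc ze ca cb cz cc ce ea eb ez ec ee →
      ((ac :+ ca) :+ ((ae :+ ea) :+ ((bc :+ cb) :+ ((be :+ eb) :+ ((za :+ az) :+ ((zb :+ bz) :+ ((zc :+ cz) :+ ((ze :+ ez) :+ con (+ 0))))))))) :=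
      :- ((ab :+ ba) :+ (ce :+ ec)) :+ (((aa :+ (ab :+ (az :+ (ac :+ (ae :+ con (+ 0)))))) :+ ((ba :+ (bb :+ (bz :+ (bc :+ (be :+ con (+ 0)))))) :+ ((za :+ (zb :+ (zz :+ (zc :+ (ze :+ con (+ 0)))))) :+ ((ca :+ (cb :+ (cz :+ (cc :+ (ce :+ con (+ 0)))))) :+ ((ea :+ (eb :+ (ez :+ (ec :+ (ee :+ con (+ 0)))))) :+ con (+ 0)))))) :- (aa :+ (bb :+ (zz :+ (cc :+ (ee :+ con (+ 0))))))))
      refl (g aᵛ aᵛ) (g aᵛ bᵛ) (g aᵛ zᵛ) (g aᵛ cᵛ) (g aᵛ dᵛ) (g bᵛ aᵛ) (g bᵛ bᵛ) (g bᵛ zᵛ) (g bᵛ cᵛ) (g bᵛ dᵛ) (g zᵛ aᵛ) (g zᵛ bᵛ) (g zᵛ zᵛ) (g zᵛ cᵛ) (g zᵛ dᵛ) (g cᵛ aᵛ) (g cᵛ bᵛ) (g cᵛ zᵛ) (g cᵛ cᵛ) (g cᵛ dᵛ) (g dᵛ aᵛ) (g dᵛ bᵛ) (g dᵛ zᵛ) (g dᵛ cᵛ) (g dᵛ dᵛ)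
    all-pairs : ∑ (λ u → ∑ (g u)) ≡ 0ℚ
    all-pairs = trans (sum-cong λ u → begin
        ∑ (g u)
          ≡⟨ sum-+ (λ v → μ u ⊛ P u d ⊛ q u d ⊛ μ v) (λ v → ⊝ (μ u ⊛ P u d ⊛ (μ v ⊛ q v d))) ⟩
        ∑ (λ v → μ u ⊛ P u d ⊛ q u d ⊛ μ v) ⊕ ∑ (λ v → ⊝ (μ u ⊛ P u d ⊛ (μ v ⊛ q v d)))
          ≡⟨ cong₂ _⊕_ (trans (sym (*-sum (μ u ⊛ P u d ⊛ q u d) μ)) (cong (μ u ⊛ P u d ⊛ q u d ⊛_) ∑μ≡0))
               (trans (sum-neg (λ v → μ u ⊛ P u d ⊛ (μ v ⊛ q v d))) (cong ⊝_ (sym (*-sum (μ u ⊛ P u d) (λ v → μ v ⊛ q v d))))) ⟩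
        μ u ⊛ P u d ⊛ q u d ⊛ 0ℚ ⊕ ⊝ (μ u ⊛ P u d ⊛ Q)
          ≡⟨ solve 3 (λ x y q → x :* con (+ 0) :+ :- (y :* q) := y :* :- q) refl (μ u ⊛ P u d ⊛ q u d) (μ u ⊛ P u d) Q ⟩
        μ u ⊛ P u d ⊛ ⊝ Q ∎)
      (trans (sym (sum-* (λ u → μ u ⊛ P u d) (⊝ Q))) (trans (cong (_⊛ ⊝ Q) (∑μP≡0 d)) (zeroˡ (⊝ Q))))
      where
      Q : ℚ
      Q = ∑ (λ v → μ v ⊛ q v d)

-- The sum of μ v (P v - P y) is zero by affine dependency, and its only surviving term is the one
-- for `x`.
isolated : ∀ (P : Placement 5) μ → ∑ μ ≡ 0ℚ → (∀ d → ∑ (λ v → μ v ⊛ P v d) ≡ 0ℚ) →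
  ∀ x y → (∀ v → v ≢ x → v ≢ y → μ v ≡ 0ℚ) → μ x ≢ 0ℚ → ∀ d → P x d ⊖ P y d ≡ 0ℚ
isolated P μ ∑μ≡0 ∑μP≡0 x y others μₓ≢0 d = x⊛y≡0⇒y≡0 μₓ≢0 (begin
  f x                          ≡⟨ sum-δ x f ⟨
  ∑ (λ v → δ x v ⊛ f v)        ≡⟨ sum-cong pick ⟩
  ∑ f                          ≡⟨ sum-cong (λ v → solve 3 (λ m p q → m :* (p :- q) := m :* p :+ :- q :* m) refl (μ v) (P v d) (P y d)) ⟩
  ∑ (λ v → μ v ⊛ P v d ⊕ ⊝ P y d ⊛ μ v)        ≡⟨ sum-+ (λ v → μ v ⊛ P v d) (λ v → ⊝ P y d ⊛ μ v) ⟩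
  ∑ (λ v → μ v ⊛ P v d) ⊕ ∑ (λ v → ⊝ P y d ⊛ μ v)  ≡⟨ cong₂ _⊕_ (∑μP≡0 d) (trans (sym (*-sum (⊝ P y d) μ)) (cong (⊝ P y d ⊛_) ∑μ≡0)) ⟩
  0ℚ ⊕ ⊝ P y d ⊛ 0ℚ            ≡⟨ solve 1 (λ p → con (+ 0) :+ :- p :* con (+ 0) := con (+ 0)) refl (P y d) ⟩
  0ℚ                           ∎)
  where
  open ≡-Reasoning
  f : Vector 5
  f v = μ v ⊛ (P v d ⊖ P y d)
  f≡0 : ∀ v → v ≢ x → f v ≡ 0ℚ
  f≡0 v v≢x with v Fin.≟ y
  ... | yes refl = solve 2 (λ m p → m :* (p :- p) := con (+ 0)) refl (μ v) (P v d)
  ... | no v≢y   = trans (cong (_⊛ (P v d ⊖ P y d)) (others v v≢x v≢y)) (zeroˡ _)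
  pick : ∀ v → δ x v ⊛ f v ≡ f v
  pick v with x Fin.≟ v
  ... | yes _  = *-identityˡ (f v)
  ... | no x≢v = trans (zeroˡ (f v)) (sym (f≡0 v (x≢v ∘ sym)))

-- The shift depends on the gap because the size `t` comes from `perturb` and cannot be prescribed:
-- a uniform shift could close a gap that was open.
nudge : Vector 3 → Vector 3
nudge x with isZero? x
... | inj₁ _ = δ 0F
... | inj₂ _ = 𝟘

nudge-separates : ∀ x {t} → t ≢ 0ℚ → ¬ (∀ d → x d ⊖ t ⊛ nudge x d ≡ 0ℚ)
nudge-separates x {t} t≢0 same with isZero? x
... | inj₁ x≡0 = t≢0 (trans (solve 2 (λ x t → t := x :- (x :- t :* con (+ 1))) refl (x 0F) t)
  (trans (cong₂ _⊖_ (x≡0 0F) (same 0F)) (solve 0 (con (+ 0) :- con (+ 0) := con (+ 0)) refl)))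
... | inj₂ (d , x≢0) = x≢0 (trans (solve 2 (λ x t → x := x :- t :* con (+ 0)) refl (x d) t) (same d))

Distinct : Vector 3 → Vector 3 → Set
Distinct x y = ¬ (∀ d → x d ⊖ y d ≡ 0ℚ)

-- If all eight products vanish, the support of `μ` contains no edge of the butterfly. So it lies in
-- one of the hinges or is the apex alone; the first makes hinge ends coincide, the second
-- contradicts ∑ μ = 0.
K₅-weight-nonzero : ∀ (P : Placement 5) → Distinct (P aᵛ) (P bᵛ) → Distinct (P cᵛ) (P dᵛ) →
  ∀ μ → ∑ μ ≡ 0ℚ → (∀ d → ∑ (λ v → μ v ⊛ P v d) ≡ 0ℚ) → (∃ λ v → μ v ≢ 0ℚ) → ¬ IsZero (K₅-weight μ)
K₅-weight-nonzero P a≢b c≢d μ ∑μ≡0 ∑μP≡0 (v , μᵥ≢0) weight≡0 = impossible v μᵥ≢0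
  where
  later : ∀ t → let (u , v) = butterfly t in μ u ≢ 0ℚ → μ v ≡ 0ℚ
  later t μᵤ≢0 = x⊛y≡0⇒y≡0 μᵤ≢0 (weight≡0 t)
  earlier : ∀ t → let (u , v) = butterfly t in μ v ≢ 0ℚ → μ u ≡ 0ℚ
  earlier t μᵥ≢0 = x⊛y≡0⇒y≡0 μᵥ≢0 (trans (*-comm _ _) (weight≡0 t))
  flip : ∀ {x y} → Distinct x y → Distinct y x
  flip {x} {y} x≢y eq = x≢y λ d → trans (solve 2 (λ x y → x :- y := :- (y :- x)) refl (x d) (y d))
    (trans (cong ⊝_ (eq d)) ⊝0≡0)
  iso : ∀ x y → Distinct (P x) (P y) → (∀ v → v ≢ x → v ≢ y → μ v ≡ 0ℚ) → ¬ μ x ≢ 0ℚ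
  iso x y x≢y others μₓ≢0 = x≢y (isolated P μ ∑μ≡0 ∑μP≡0 x y others μₓ≢0)
  impossible : ∀ v → ¬ μ v ≢ 0ℚ
  impossible aᵛ ≢0 = iso aᵛ bᵛ a≢b (λ { aᵛ ¬a _ → contradiction refl ¬a ; bᵛ _ ¬b → contradiction refl ¬b
    ; zᵛ _ _ → earlier 4F ≢0 ; cᵛ _ _ → later 0F ≢0 ; dᵛ _ _ → later 1F ≢0 }) ≢0
  impossible bᵛ ≢0 = iso bᵛ aᵛ (flip a≢b) (λ { aᵛ _ ¬a → contradiction refl ¬a ; bᵛ ¬b _ → contradiction refl ¬b
    ; zᵛ _ _ → earlier 5F ≢0 ; cᵛ _ _ → later 2F ≢0 ; dᵛ _ _ → later 3F ≢0 }) ≢0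
  impossible cᵛ ≢0 = iso cᵛ dᵛ c≢d (λ { cᵛ ¬c _ → contradiction refl ¬c ; dᵛ _ ¬d → contradiction refl ¬d
    ; zᵛ _ _ → earlier 6F ≢0 ; aᵛ _ _ → earlier 0F ≢0 ; bᵛ _ _ → earlier 2F ≢0 }) ≢0
  impossible dᵛ ≢0 = iso dᵛ cᵛ (flip c≢d) (λ { cᵛ _ ¬c → contradiction refl ¬c ; dᵛ ¬d _ → contradiction refl ¬d
    ; zᵛ _ _ → earlier 7F ≢0 ; aᵛ _ _ → earlier 1F ≢0 ; bᵛ _ _ → earlier 3F ≢0 }) ≢0
  impossible zᵛ ≢0 = ≢0 (trans (sym total) ∑μ≡0)
    where
    total : ∑ μ ≡ μ zᵛ
    total = trans (cong₂ _⊕_ (later 4F ≢0) (cong₂ _⊕_ (later 5F ≢0) (cong (μ zᵛ ⊕_) (cong₂ _⊕_ (later 6F ≢0) (cong (_⊕ 0ℚ) (later 7F ≢0))))))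
      (solve 1 (λ x → con (+ 0) :+ (con (+ 0) :+ (x :+ (con (+ 0) :+ (con (+ 0) :+ con (+ 0))))) := x) refl (μ zᵛ))

module _ {m} (h : Fin m) where

  private
    module _ (p : Placement (m * 3)) (μ : Fin m → Vector 5) (∑μ≡0 : ∀ j → ∑ (μ j) ≡ 0ℚ)
             (∑μP≡0 : ∀ j d → ∑ (λ v → μ j v ⊛ local p j v d) ≡ 0ℚ) where

      α γ : Vector m
      α j = μ j aᵛ ⊛ μ j bᵛ
      γ j = μ j cᵛ ⊛ μ j dᵛ

      -- Component `i` belongs to the hinge of `next i`, where link `i` contributes through c, d and
      -- link `next i` through a, b. The m + 1 vectors are those of the bar and of the scales.
      equations : Fin (suc m) → Vector m
      equations zero    i = δ h (next i)
      equations (suc j) i = δ i j ⊛ γ j ⊕ δ (next i) j ⊛ α j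

      module _ (κ : Vector (suc m)) (kills : Kills κ equations) where
        open ≡-Reasoning
        χ : ℚ
        χ = κ zero
        λᵒ : Vector m
        λᵒ = κ ∘ suc
        c : Vector (suc (m * 8))
        -- By `K₅-work` the links leave minus the hinge products, so the bar gets the same sign.
        c zero    = ⊝ χ
        c (suc x) = let (j , t) = remQuot {m} 8 x in λᵒ j ⊛ K₅-weight (μ j) t
        c-link : ∀ (j : Fin m) t → c (suc (combine j t)) ≡ λᵒ j ⊛ K₅-weight (μ j) t
        c-link j t = cong (λ (j , t) → λᵒ j ⊛ K₅-weight (μ j) t) (Finₚ.remQuot-combine {m} {8} j t)
        cancel : ∀ i → χ ⊛ δ h (next i) ⊕ (λᵒ i ⊛ γ i ⊕ λᵒ (next i) ⊛ α (next i)) ≡ 0ℚ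
        cancel i = trans (+-congˡ (sym (begin
          ∑ (λ j → λᵒ j ⊛ (δ i j ⊛ γ j ⊕ δ (next i) j ⊛ α j))
            ≡⟨ sum-cong (λ j → solve 5 (λ l d g e a → l :* (d :* g :+ e :* a) := d :* (l :* g) :+ e :* (l :* a)) refl (λᵒ j) (δ i j) (γ j) (δ (next i) j) (α j)) ⟩
          ∑ (λ j → δ i j ⊛ (λᵒ j ⊛ γ j) ⊕ δ (next i) j ⊛ (λᵒ j ⊛ α j))
            ≡⟨ sum-+ (λ j → δ i j ⊛ (λᵒ j ⊛ γ j)) (λ j → δ (next i) j ⊛ (λᵒ j ⊛ α j)) ⟩
          ∑ (λ j → δ i j ⊛ (λᵒ j ⊛ γ j)) ⊕ ∑ (λ j → δ (next i) j ⊛ (λᵒ j ⊛ α j))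
            ≡⟨ cong₂ _⊕_ (sum-δ i (λ j → λᵒ j ⊛ γ j)) (sum-δ (next i) (λ j → λᵒ j ⊛ α j)) ⟩
          λᵒ i ⊛ γ i ⊕ λᵒ (next i) ⊛ α (next i) ∎))) (kills i)
        stress : Stress p (hingeAndRing h) c
        stress q = begin
          ∑ (λ i → c i ⊛ stretch p q (hingeAndRing h i))
            ≡⟨ ringWork p q h c ⟩
          ⊝ χ ⊛ H h ⊕ ∑ (λ (j : Fin m) → ∑ (λ t → c (suc (combine j t)) ⊛ stretch (local p j) (local q j) (butterfly t)))
            ≡⟨ +-congˡ (sum-cong link) ⟩
          ⊝ χ ⊛ H h ⊕ ∑ (λ j → ⊝ (λᵒ j ⊛ α j ⊛ H j) ⊕ ⊝ (λᵒ j ⊛ γ j ⊛ H (next j)))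
            ≡⟨ +-congˡ (sum-+ (λ j → ⊝ (λᵒ j ⊛ α j ⊛ H j)) (λ j → ⊝ (λᵒ j ⊛ γ j ⊛ H (next j)))) ⟩
          ⊝ χ ⊛ H h ⊕ (∑ (λ j → ⊝ (λᵒ j ⊛ α j ⊛ H j)) ⊕ ∑ (λ j → ⊝ (λᵒ j ⊛ γ j ⊛ H (next j))))
            ≡⟨ cong₂ (λ s t → s ⊕ (t ⊕ ∑ (λ j → ⊝ (λᵒ j ⊛ γ j ⊛ H (next j))))) bar (sym (sum-next (λ j → ⊝ (λᵒ j ⊛ α j ⊛ H j)))) ⟩
          ∑ (λ j → ⊝ χ ⊛ δ h (next j) ⊛ H (next j)) ⊕ (∑ (λ j → ⊝ (λᵒ (next j) ⊛ α (next j) ⊛ H (next j))) ⊕ ∑ (λ j → ⊝ (λᵒ j ⊛ γ j ⊛ H (next j))))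
            ≡⟨ trans (sum-+ (λ j → ⊝ χ ⊛ δ h (next j) ⊛ H (next j)) (λ j → ⊝ (λᵒ (next j) ⊛ α (next j) ⊛ H (next j)) ⊕ ⊝ (λᵒ j ⊛ γ j ⊛ H (next j))))
                 (+-congˡ (sum-+ (λ j → ⊝ (λᵒ (next j) ⊛ α (next j) ⊛ H (next j))) (λ j → ⊝ (λᵒ j ⊛ γ j ⊛ H (next j))))) ⟨
          ∑ (λ j → ⊝ χ ⊛ δ h (next j) ⊛ H (next j) ⊕ (⊝ (λᵒ (next j) ⊛ α (next j) ⊛ H (next j)) ⊕ ⊝ (λᵒ j ⊛ γ j ⊛ H (next j))))
            ≡⟨ sum-zero (λ j → trans (solve 5 (λ x e u v k → :- x :* e :* k :+ (:- (u :* k) :+ :- (v :* k)) := :- (x :* e :+ (v :+ u)) :* k) refl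
                 χ (δ h (next j)) (λᵒ (next j) ⊛ α (next j)) (λᵒ j ⊛ γ j) (H (next j)))
                 (trans (cong (λ s → ⊝ s ⊛ H (next j)) (cancel j)) (solve 1 (λ x → :- con (+ 0) :* x := con (+ 0)) refl (H (next j))))) ⟩
          0ℚ ∎
          where
          H : Vector m
          H i = stretch p q (hinge i)
          bar : ⊝ χ ⊛ H h ≡ ∑ (λ j → ⊝ χ ⊛ δ h (next j) ⊛ H (next j))
          bar = sym (trans (sum-next (λ j → ⊝ χ ⊛ δ h j ⊛ H j))
            (trans (sum-cong λ j → solve 3 (λ x e k → x :* e :* k := e :* (x :* k)) refl (⊝ χ) (δ h j) (H j)) (sum-δ h (λ j → ⊝ χ ⊛ H j))))
          link : ∀ (j : Fin m) → ∑ (λ t → c (suc (combine j t)) ⊛ stretch (local p j) (local q j) (butterfly t)) ≡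
            ⊝ (λᵒ j ⊛ α j ⊛ H j) ⊕ ⊝ (λᵒ j ⊛ γ j ⊛ H (next j))
          link j = begin
            ∑ (λ t → c (suc (combine j t)) ⊛ x t)
              ≡⟨ sum-cong (λ t → trans (cong (_⊛ x t) (c-link j t)) (*-assoc (λᵒ j) (K₅-weight (μ j) t) (x t))) ⟩
            ∑ (λ t → λᵒ j ⊛ (K₅-weight (μ j) t ⊛ x t))
              ≡⟨ *-sum (λᵒ j) (λ t → K₅-weight (μ j) t ⊛ x t) ⟨
            λᵒ j ⊛ ∑ (λ t → K₅-weight (μ j) t ⊛ x t)
              ≡⟨ cong (λᵒ j ⊛_) (K₅-work (local p j) (local q j) (μ j) (∑μ≡0 j) (∑μP≡0 j)) ⟩
            λᵒ j ⊛ ⊝ (α j ⊛ H j ⊕ γ j ⊛ H (next j))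
              ≡⟨ solve 5 (λ l a g h k → l :* :- (a :* h :+ g :* k) := :- (l :* a :* h) :+ :- (l :* g :* k)) refl (λᵒ j) (α j) (γ j) (H j) (H (next j)) ⟩
            ⊝ (λᵒ j ⊛ α j ⊛ H j) ⊕ ⊝ (λᵒ j ⊛ γ j ⊛ H (next j)) ∎
            where
            x : Vector 8
            x t = stretch (local p j) (local q j) (butterfly t)

  -- K₅-stresses of the links, scaled so that they cancel on all hinges but h.
  hingesDistinct⇒dependent : ∀ (p : Placement (m * 3)) → (∀ (i : Fin m) → Distinct (p (vtx i 0F)) (p (vtx i 1F))) →
    ¬ IndependentFamily p (hingeAndRing h)
  hingesDistinct⇒dependent p distinct ind = with-dependencies (λ j → affineDependency (local p j))
    where
    with-dependencies : ¬ (∀ (j : Fin m) → ∃ λ μ → ∑ μ ≡ 0ℚ × (∀ d → ∑ (λ v → μ v ⊛ local p j v d) ≡ 0ℚ) × ∃ λ v → μ v ≢ 0ℚ)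
    with-dependencies dependency = with-scales (nonTrivial m (equations p μ ∑μ≡0 ∑μP≡0))
      where
      μ : Fin m → Vector 5
      μ j = proj₁ (dependency j)
      ∑μ≡0 : ∀ j → ∑ (μ j) ≡ 0ℚ
      ∑μ≡0 j = proj₁ (proj₂ (dependency j))
      ∑μP≡0 : ∀ j d → ∑ (λ v → μ j v ⊛ local p j v d) ≡ 0ℚ
      ∑μP≡0 j = proj₁ (proj₂ (proj₂ (dependency j)))
      with-scales : ¬ NonTrivial (equations p μ ∑μ≡0 ∑μP≡0)
      with-scales (κ , kills , zero , χ≢0) = χ≢0 (trans (solve 1 (λ x → x := :- (:- x)) refl (κ zero))
        (trans (cong ⊝_ (ind (c p μ ∑μ≡0 ∑μP≡0 κ kills) (stress p μ ∑μ≡0 ∑μP≡0 κ kills) zero)) ⊝0≡0))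
      with-scales (κ , kills , suc j , λ≢0) =
        K₅-weight-nonzero (local p j) (distinct j) (distinct (next j)) (μ j) (∑μ≡0 j) (∑μP≡0 j) (proj₂ (proj₂ (proj₂ (dependency j))))
          λ t → x⊛y≡0⇒y≡0 λ≢0 (trans (sym (c-link p μ ∑μ≡0 ∑μP≡0 κ kills j t))
            (ind (c p μ ∑μ≡0 ∑μP≡0 κ kills) (stress p μ ∑μ≡0 ∑μP≡0 κ kills) (suc (combine j t))))

  hingeAndRing-dependent : ∀ (p : Placement (m * 3)) → ¬ IndependentFamily p (hingeAndRing h)
  hingeAndRing-dependent p ind =
    perturbed (perturb p q (hingeAndRing h) ind)
    where
    separation : Fin m → Vector 3
    separation i = p (vtx i 0F) ⊟ p (vtx i 1F)
    shift : Fin m → Fin 3 → Vector 3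
    shift i 1F = nudge (separation i)
    shift i 0F = 𝟘
    shift i 2F = 𝟘
    q : Placement (m * 3)
    q v = let (i , s) = remQuot {m} 3 v in shift i s
    q-vtx : ∀ (i : Fin m) s d → q (vtx i s) d ≡ shift i s d
    q-vtx i s d = cong (λ (i , s) → shift i s d) (Finₚ.remQuot-combine {m} {3} i s)
    gap : ∀ t (i : Fin m) d → (p (vtx i 0F) d ⊕ t ⊛ q (vtx i 0F) d) ⊖ (p (vtx i 1F) d ⊕ t ⊛ q (vtx i 1F) d) ≡
      separation i d ⊖ t ⊛ nudge (separation i) d
    gap t i d = trans (cong₂ (λ x y → (p (vtx i 0F) d ⊕ t ⊛ x) ⊖ (p (vtx i 1F) d ⊕ t ⊛ y)) (q-vtx i 0F d) (q-vtx i 1F d))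
      (solve 4 (λ a b t s → (a :+ t :* con (+ 0)) :- (b :+ t :* s) := (a :- b) :- t :* s) refl _ _ t (nudge (separation i) d))
    perturbed : ¬ ∃ λ t → t ≢ 0ℚ × IndependentFamily (λ v → p v ⊞ t ⊠ q v) (hingeAndRing h)
    perturbed (t , t≢0 , ind′) = hingesDistinct⇒dependent (λ v → p v ⊞ t ⊠ q v)
      (λ i same → nudge-separates (separation i) t≢0 λ d → trans (sym (gap t i d)) (same d)) ind′

-- Rings with at most five links

fromℤ-⊖ : ∀ a b → fromℤ (a ℤ.- b) ≡ fromℤ a ⊖ fromℤ b
fromℤ-⊖ a b = trans (fromℤ-⊕ a (ℤ.- b)) (cong (fromℤ a ⊕_) (fromℤ-⊝ b))

-- The certificates are integral and are evaluated in ℤ; `stretch-fromℤ` carries the results over to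
-- ℚ.
stretchℤ : ∀ {n} → (p q : Fin n → Fin 3 → ℤ) → Edge n → ℤ
stretchℤ p q (u , v) = term 0F ℤ.+ (term 1F ℤ.+ (term 2F ℤ.+ + 0))
  where
  term : Fin 3 → ℤ
  term d = (p u d ℤ.- p v d) ℤ.* (q u d ℤ.- q v d)

stretch-fromℤ : ∀ {n} (p q : Fin n → Fin 3 → ℤ) e →
  stretch (λ v d → fromℤ (p v d)) (λ v d → fromℤ (q v d)) e ≡ fromℤ (stretchℤ p q e)
stretch-fromℤ p q (u , v) = sym (trans (fromℤ-⊕ _ _) (cong₂ _⊕_ (term 0F) (trans (fromℤ-⊕ _ _) (cong₂ _⊕_ (term 1F)
  (trans (fromℤ-⊕ _ _) (cong (_⊕ 0ℚ) (term 2F)))))))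
  where
  term : ∀ d → fromℤ ((p u d ℤ.- p v d) ℤ.* (q u d ℤ.- q v d)) ≡
    (fromℤ (p u d) ⊖ fromℤ (p v d)) ⊛ (fromℤ (q u d) ⊖ fromℤ (q v d))
  term d = trans (fromℤ-⊛ _ _) (cong₂ _⊛_ (fromℤ-⊖ (p u d) (p v d)) (fromℤ-⊖ (q u d) (q v d)))

-- Motions dual to the edges certify that es is independent; since each of them
-- moves every hinge, the stress of es and a hinge is nowhere zero.
Certified : ∀ {m} → List (Edge (m * 3)) → (Fin (m * 3) → Fin 3 → ℤ) → (ℕ → Fin (m * 3) → Fin 3 → ℤ) → Set
Certified {m} es p L = ∀ (j : Fin (length es)) →
  (∀ i → (i ≡ j × stretchℤ p (L (toℕ j)) (lookup es i) ≢ + 0) ⊎ stretchℤ p (L (toℕ j)) (lookup es i) ≡ + 0) ×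
  stretchℤ p (L (toℕ j)) (lookup es j) ≢ + 0 ×
  (∀ (h : Fin m) → stretchℤ p (L (toℕ j)) (hinge h) ≢ + 0)

certified? : ∀ {m} es p L → Dec (Certified {m} es p L)
certified? {m} es p L = Finₚ.all? λ j →
  (Finₚ.all? λ i → ((i Fin.≟ j) ×-dec ¬? (stretchℤ p (L (toℕ j)) (lookup es i) ℤ.≟ + 0)) ⊎-dec (stretchℤ p (L (toℕ j)) (lookup es i) ℤ.≟ + 0))
  ×-dec ¬? (stretchℤ p (L (toℕ j)) (lookup es j) ℤ.≟ + 0)
  ×-dec (Finₚ.all? λ h → ¬? (stretchℤ p (L (toℕ j)) (hinge h) ℤ.≟ + 0))

certified⇒circuitFamily : ∀ {m} es p L → Certified {m} es p L → ∀ (h : Fin m) →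
  CircuitFamily (λ v d → fromℤ (p v d)) (lookup (hinge h ∷ es))
certified⇒circuitFamily {m} es p L cert h c stress = circuit-from
  where
  open ≡-Reasoning
  s : Fin (length es) → Edge (m * 3) → ℚ
  s j e = fromℤ (stretchℤ p (L (toℕ j)) e)
  pick : ∀ j i → c (suc i) ⊛ s j (lookup es i) ≡ δ j i ⊛ (c (suc i) ⊛ s j (lookup es i))
  pick j i with j Fin.≟ i | proj₁ (cert j) i
  ... | yes _  | _                 = sym (*-identityˡ _)
  ... | no j≢i | inj₁ (i≡j , _)    = contradiction (sym i≡j) j≢i
  ... | no j≢i | inj₂ eq           = trans (cong (λ x → c (suc i) ⊛ fromℤ x) eq) (trans (zeroʳ _) (sym (zeroˡ _)))
  -- Testing with motion `j` leaves the bar and edge `j`, both with nonzero factors. Hence the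
  -- coefficient of the bar vanishes if and only if that of edge `j` does.
  relation : ∀ j → c zero ⊛ s j (hinge h) ⊕ c (suc j) ⊛ s j (lookup es j) ≡ 0ℚ
  relation j = begin
    c zero ⊛ s j (hinge h) ⊕ c (suc j) ⊛ s j (lookup es j)
      ≡⟨ +-congˡ (sum-δ j (λ i → c (suc i) ⊛ s j (lookup es i))) ⟨
    c zero ⊛ s j (hinge h) ⊕ ∑ (λ i → δ j i ⊛ (c (suc i) ⊛ s j (lookup es i)))
      ≡⟨ +-congˡ (sum-cong (pick j)) ⟨
    ∑ (λ i → c i ⊛ s j (lookup (hinge h ∷ es) i))
      ≡⟨ sum-cong (λ i → cong (c i ⊛_) (stretch-fromℤ p (L (toℕ j)) (lookup (hinge h ∷ es) i))) ⟨
    ∑ (λ i → c i ⊛ stretch (λ v d → fromℤ (p v d)) (λ v d → fromℤ (L (toℕ j) v d)) (lookup (hinge h ∷ es) i))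
      ≡⟨ stress (λ v d → fromℤ (L (toℕ j) v d)) ⟩
    0ℚ ∎
  fromℤ≢0 : ∀ {a} → a ≢ + 0 → fromℤ a ≢ 0ℚ
  fromℤ≢0 a≢0 eq = a≢0 (fromℤ-injective eq)
  from-hinge : c zero ≡ 0ℚ → IsZero c
  from-hinge c₀≡0 zero    = c₀≡0
  from-hinge c₀≡0 (suc j) = x⊛y≡0⇒y≡0 (fromℤ≢0 (proj₁ (proj₂ (cert j)))) (trans (*-comm _ _) (trans
    (solve 2 (λ x y → y := con (+ 0) :* x :+ y) refl (s j (hinge h)) _)
    (trans (cong (λ z → z ⊛ s j (hinge h) ⊕ c (suc j) ⊛ s j (lookup es j)) (sym c₀≡0)) (relation j))))
  circuit-from : ∀ i → c i ≡ 0ℚ → IsZero c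
  circuit-from zero    = from-hinge
  circuit-from (suc j) cⱼ≡0 = from-hinge (x⊛y≡0⇒y≡0 (fromℤ≢0 (proj₂ (proj₂ (cert j)) h)) (trans (*-comm _ _) (trans
    (solve 2 (λ x y → x := x :+ con (+ 0) :* y) refl _ (s j (lookup es j)))
    (trans (cong (λ z → c zero ⊛ s j (hinge h) ⊕ z ⊛ s j (lookup es j)) (sym cⱼ≡0)) (relation j)))))

overcounted⇒dependent : ∀ {n} (v₁ v₂ v₃ : Fin n) rest (es : List (Edge n)) → v₁ ≢ v₂ → v₁ ≢ v₃ → v₂ ≢ v₃ →
  suc (freeCoordinates v₁ v₂ v₃ rest) ≤ length es → All (Within v₁ v₂ v₃ rest) es → Dependent es
overcounted⇒dependent v₁ v₂ v₃ rest es v₁≢v₂ v₁≢v₃ v₂≢v₃ k≤ within ind =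
  let p , ind′ = independent-⊆ (Subₚ.take-⊆ k es) ind
  in contradiction′ (lookup (List.take k es))
       (trans (Listₚ.length-take k es) (ℕₚ.m≤n⇒m⊓n≡m k≤))
       (λ i → All.lookup (Subₚ.All-resp-⊆ (Subₚ.take-⊆ k es) within) (∈-lookup i))
       p (independentAt⇒independentFamily p (List.take k es) ind′)
  where
  -- `overcounted` treats families of exactly 3 n - 5 edges, so a prefix of this length is taken.
  k = suc (freeCoordinates v₁ v₂ v₃ rest)
  contradiction′ : ∀ {l} (E : Fin l → _) → l ≡ k → (∀ i → Within v₁ v₂ v₃ rest (E i)) → ∀ p → ¬ IndependentFamily p E
  contradiction′ E refl within p = overcounted v₁ v₂ v₃ rest v₁≢v₂ v₁≢v₃ v₂≢v₃ E within p

within? : ∀ {n} (v₁ v₂ v₃ : Fin n) rest es → Dec (All (Within v₁ v₂ v₃ rest) es)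
within? v₁ v₂ v₃ rest = All.all? λ (u , v) → (u ∈? (v₁ ∷ v₂ ∷ v₃ ∷ rest)) ×-dec (v ∈? (v₁ ∷ v₂ ∷ v₃ ∷ rest))
  where open DecMembership Fin._≟_

-- Rows of small integers, stored as base 100 digits shifted by 50.
digit : ℕ → ℕ → ℤ
digit zero    x = (x ℕ.% 100) ℤ.⊖ 50
digit (suc k) x = digit k (x ℕ./ 100)

decode : ∀ {n} → ℕ → Fin n → Fin 3 → ℤ
decode x v d = digit (3 * toℕ v ℕ.+ toℕ d) x

nth : List ℕ → ℕ → ℕ
nth []       _       = 0
nth (x ∷ xs) zero    = x
nth (x ∷ xs) (suc i) = nth xs i

-- An apex is the first endpoint of its edges.
without : ∀ {m} → List (Fin (m * 3)) → List (Edge (m * 3))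
without {m} zs = List.filter (λ e → ¬? (DecMembership._∈?_ Fin._≟_ (proj₁ e) zs)) (ringEdges m)

HingeCircuits : ℕ → Set
HingeCircuits m = ∀ (h : Fin m) → ∃ λ C → C ⊆ hinge h ∷ ringEdges m × hinge h ∈ C × IsCircuit C

-- The edge count together with the vertex list gives dependence at every placement, the certificate
-- gives independence of the proper sublists at one. All three conditions are decided by evaluation,
-- for every hinge at once.
hingeCircuits : ∀ {m} (zs : List (Fin (m * 3))) p Ls v₁ v₂ v₃ rest → v₁ ≢ v₂ → v₁ ≢ v₃ → v₂ ≢ v₃ →
  True (suc (freeCoordinates v₁ v₂ v₃ rest) ℕ.≤? suc (length (without {m} zs))) →
  True (Finₚ.all? λ (h : Fin m) → within? v₁ v₂ v₃ rest (hinge h ∷ without {m} zs)) →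
  True (certified? {m} (without {m} zs) (decode p) (λ j → decode (nth Ls j))) → HingeCircuits m
hingeCircuits {m} zs p Ls v₁ v₂ v₃ rest v₁≢v₂ v₁≢v₃ v₂≢v₃ k≤ within cert h =
  hinge h ∷ without {m} zs , refl ∷ Subₚ.filter-⊆ _ (ringEdges m) , here refl ,
  isCircuit (λ v d → fromℤ (decode p v d)) (hinge h ∷ without {m} zs)
    (certified⇒circuitFamily {m} (without {m} zs) (decode p) (λ j → decode (nth Ls j)) (toWitness cert) h)
    (overcounted⇒dependent v₁ v₂ v₃ rest (hinge h ∷ without {m} zs) v₁≢v₂ v₁≢v₃ v₂≢v₃ (toWitness k≤) (toWitness within h))

-- Certificates for three, four and five links, with one motion for each of 12, 24 and 36 edges

placement3 : ℕ
placement3 = 505050495051505049505050515049505051505050504950495149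

motions3 : List ℕ
motions3 =
  505050515050505050505050505049515050505050515050505050 ∷
  505050505251505050505050504851505050505050475050505050 ∷
  505050515050505050505050505049515150505050515050505050 ∷
  505050505251505050505050505051505050505050475050505050 ∷
  505050505251494949505050494850505050505050475050505050 ∷
  505050495050505050505050505051505050505050495050505050 ∷
  505050504849505050505050515250505050505050535050505050 ∷
  505050504849505050505050505047505050505050535050505050 ∷
  505050504849515050505050515250505050505050535050505050 ∷
  505050504849515150505050515250505050505050535050505050 ∷
  505050505051505050505050505051505050505050495050505050 ∷
  505050505251505050505050505051505050505050495050505050 ∷ []

placement4 : ℕ
placement4 = 505051515049504950504949495149494950505050515149514950505050515151515051

motions4 : List ℕ
motions4 =
  504951484950504852504752464550504752505050465050504950505050504950505050 ∷
  505149525150505248544948504738504944505050505250505248505050505150505050 ∷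
  505347565350505644505944626550505944505050625050505248505050505350505050 ∷
  504753444750504456385356505986505368505050504246504456505050504750505050 ∷
  505151485150485250465350505554485352505050505050505248505050505150505050 ∷
  504951484950504852504752464550504752505050465050504852505050504950505050 ∷
  504951484950504852465152505362505156505050505050504852505050504950505050 ∷
  505149525150505248544948504738504944505050525050505248505050505150505050 ∷
  504749524750544452544552504354504948505050505050504456505050504750505050 ∷
  505149525150505248544948504738504744505050505050505248505050505150505050 ∷
  505149525150505248505348545546505348505050545050505248505050505150505050 ∷
  504951484950504852425552505974505560505050505050504852505050504950505050 ∷
  504951484950504852465152505362505560505050505050504852505050504950505050 ∷
  505149525150505248584548504738504540505050505050505248505050505150505050 ∷
  505149525150505248544944504738504540505050505050505248505050505150505050 ∷
  504951484950504852424952505362505560505050505050504852505050504950505050 ∷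
  505147565150505444545344585538505340505050585050505248505050505150505050 ∷
  504951484950504753494853474756504954505050475050504852505050504950505050 ∷
  504951445348504852385952506586505764505050505050504852505050504950505050 ∷
  505149524950505248544748504534504744505050505050505248505050505150505050 ∷
  505150505150505248505148505146504948505050505050505248505050505150505050 ∷
  504951504950504852504952504954505152505050505050504852505050504950505050 ∷
  485149504950504852504952504954505152505050505050504852505050504950505050 ∷
  505050505150505248505148505146504948505050505050505248505050505150505050 ∷ []

placement5 : ℕ
placement5 = 514951505149505051494951495150505050505049515151505151505049515050505051505050515150495149

motions5 : List ℕ
motions5 =
  524846505352524848544647494851524948495148515147504750494750515048554750505050525050505050 ∷
  524846504948504648544243494447524948554948475151484948554550535052494950505050485050505050 ∷
  485254505152505452465857515653485152535952454165444360536350475056434350505050525050505050 ∷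
  524846504948504648385851576055444948394948633543644948394550453444494950505050485050505050 ∷
  485254504748485252465453515249485152514952494953505350515350495052494950505050485050505050 ∷
  564438505552544244623437474049564744454344576129565140453150555040515150505050525050505050 ∷
  524846504948504648385851576055444948394948633543644948394550615028494950505050485050505050 ∷
  485254505152505452545053474849525152535152455753445152535550475056515150505050525050505050 ∷
  604030504540503040542623533643524540594540513947564540595734575036454550505050405050505050 ∷
  406070505560507060467477476457485560415560496153445560417550435064555550505050605050505050 ∷
  406070505560507060467477476457485560415560496153445560575950435064555550505050605050505050 ∷
  604030504540503040542623533643524540594540513947564540432550575036454550505050405050505050 ∷
  524846505352524848544647494851524948495148515147525148494750515048515150505050525050505050 ∷
  524846504948504648385851576055444948394948633543804948394550615028494950505050485050505050 ∷
  485254504748485252425855535651465152515352514755504954515750495052494950505050485050505050 ∷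
  485254505152505452545053474849525152535152495353445152535550475056515150505050525050505050 ∷
  505050504848494950504848504848505050534950485052474951515150495052494950505050485050505050 ∷
  505050505252515150505252505252505050454950525048535149494950515048515150505050525050505050 ∷
  505050505252515150505252505252505050495746525048535149494950515048515150505050525050505050 ∷
  505050505252515150505252505252505050494950525048535149494950515048515150505050525050505050 ∷
  465458504648475554505254484846504850514750465250454949514750495052494950505050485050505050 ∷
  485254504748485252465453515249504952514952494953484952515350495052494950505050485050505050 ∷
  544642505048514346504442444442504846514746425646414945513950495052494950505050485050505050 ∷
  524846501716343048382619414455444948556548313575323364556150455060333350505050165050505050 ∷
  485254504748485252425855535651505152515352514755504954515750495052494950505050485050505050 ∷
  485254504748485252505051535651505152515352514755504954515750495052494950505050485050505050 ∷
  524846505352524848503837474449504948494748495345505146494350515048515150505050525050505050 ∷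
  524846505352524848564449474449504948494748495345505146494350515048515150505050525050505050 ∷
  524846505352545052505453555657505352495552574553585154495950515048515150505050525050505050 ∷
  524846505352464248503837474449504948494748495345505146494350515048515150505050525050505050 ∷
  485254585552545852466657596453525552495552614949605552495950515048555550505050605050505050 ∷
  485254503536667052627481595645565152453552696525686736453950555040676750505050845050505050 ∷
  643622505952524848505043535655505548495948554751565152495550515048515150505050525050505050 ∷
  524846505952524848505043535655505548495948554751565152495550515048515150505050525050505050 ∷
  525662504148485252505057474445504552514152455349444948514550495052494950505050485050505050 ∷
  364054504148485252505057474445504552514152455349444948514550495052494950505050485050505050 ∷ []

-- Without its three apexes the ring is the octahedron, with 12 = 3 · 6 - 6 edges, and the hinges
-- are its diagonals.
hingeCircuits₃ : HingeCircuits 3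
hingeCircuits₃ = hingeCircuits {3} (2F ∷ 5F ∷ 8F ∷ []) placement3 motions3 0F 1F 3F (4F ∷ 6F ∷ 7F ∷ [])
  (λ ()) (λ ()) (λ ()) tt tt tt

hingeCircuits₄ : HingeCircuits 4
hingeCircuits₄ = hingeCircuits {4} (2F ∷ 5F ∷ []) placement4 motions4 0F 1F 3F (4F ∷ tabulate (6 Fin.↑ʳ_))
  (λ ()) (λ ()) (λ ()) tt tt tt

hingeCircuits₅ : HingeCircuits 5
hingeCircuits₅ = hingeCircuits {5} (2F ∷ []) placement5 motions5 0F 1F 3F (tabulate (4 Fin.↑ʳ_))
  (λ ()) (λ ()) (λ ()) tt tt tt

-- For m < 6 the 8 m edges exceed 9 m - 6. The numbers 22, 31 and 40 are 3 n - 5 for n = 3 m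
-- vertices.
smallRing-dependent : ∀ {m} → 3 ≤ m → m ≤ 5 → Dependent (ringEdges m)
smallRing-dependent {3} _ _ = overcounted⇒dependent 0F 1F 2F (tabulate (3 Fin.↑ʳ_)) (ringEdges 3) (λ ()) (λ ()) (λ ())
  (ℕₚ.m≤m+n 22 2) (toWitness {a? = within? 0F 1F 2F (tabulate (3 Fin.↑ʳ_)) (ringEdges 3)} tt)
smallRing-dependent {4} _ _ = overcounted⇒dependent 0F 1F 2F (tabulate (3 Fin.↑ʳ_)) (ringEdges 4) (λ ()) (λ ()) (λ ())
  (ℕₚ.m≤m+n 31 1) (toWitness {a? = within? 0F 1F 2F (tabulate (3 Fin.↑ʳ_)) (ringEdges 4)} tt)
smallRing-dependent {5} _ _ = overcounted⇒dependent 0F 1F 2F (tabulate (3 Fin.↑ʳ_)) (ringEdges 5) (λ ()) (λ ()) (λ ())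
  (ℕₚ.m≤m+n 40 0) (toWitness {a? = within? 0F 1F 2F (tabulate (3 Fin.↑ʳ_)) (ringEdges 5)} tt)
smallRing-dependent {0} () _
smallRing-dependent {1} (s≤s ()) _
smallRing-dependent {2} (s≤s (s≤s ())) _
smallRing-dependent {suc (suc (suc (suc (suc (suc m)))))} _ (s≤s (s≤s (s≤s (s≤s (s≤s ())))))

-- Vertex sets induce few edges

∑ℕ : ∀ {n} → (Fin n → ℕ) → ℕ
∑ℕ {zero}  f = 0
∑ℕ {suc n} f = f zero ℕ.+ ∑ℕ (f ∘ suc)

∑ℕ-cong : ∀ {n} {f g : Fin n → ℕ} → (∀ i → f i ≡ g i) → ∑ℕ f ≡ ∑ℕ g
∑ℕ-cong {zero}  eq = refl
∑ℕ-cong {suc n} eq = cong₂ ℕ._+_ (eq zero) (∑ℕ-cong (eq ∘ suc))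

∑ℕ-mono : ∀ {n} {f g : Fin n → ℕ} → (∀ i → f i ≤ g i) → ∑ℕ f ≤ ∑ℕ g
∑ℕ-mono {zero}  f≤g = z≤n
∑ℕ-mono {suc n} f≤g = ℕₚ.+-mono-≤ (f≤g zero) (∑ℕ-mono (f≤g ∘ suc))

∑ℕ-+ : ∀ {n} (f g : Fin n → ℕ) → ∑ℕ (λ i → f i ℕ.+ g i) ≡ ∑ℕ f ℕ.+ ∑ℕ g
∑ℕ-+ {zero}  f g = refl
∑ℕ-+ {suc n} f g = trans (cong ((f zero ℕ.+ g zero) ℕ.+_) (∑ℕ-+ (f ∘ suc) (g ∘ suc)))
  (ℕ-solve 4 (λ a b c d → (a ⊹ b) ⊹ (c ⊹ d) ≔ (a ⊹ c) ⊹ (b ⊹ d)) refl (f zero) (g zero) _ _)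

∑ℕ-* : ∀ {n} k (f : Fin n → ℕ) → ∑ℕ (λ i → k * f i) ≡ k * ∑ℕ f
∑ℕ-* {zero}  k f = sym (ℕₚ.*-zeroʳ k)
∑ℕ-* {suc n} k f = trans (cong (k * f zero ℕ.+_) (∑ℕ-* k (f ∘ suc))) (sym (ℕₚ.*-distribˡ-+ k (f zero) _))

∑ℕ-const : ∀ n k → ∑ℕ {n} (λ _ → k) ≡ n * k
∑ℕ-const zero    k = refl
∑ℕ-const (suc n) k = cong (k ℕ.+_) (∑ℕ-const n k)

∑ℕ-init-last : ∀ {k} (f : Fin (suc k) → ℕ) → ∑ℕ f ≡ ∑ℕ (f ∘ inject₁) ℕ.+ f (fromℕ k)
∑ℕ-init-last {zero}  f = ℕₚ.+-comm (f zero) 0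
∑ℕ-init-last {suc k} f = trans (cong (f zero ℕ.+_) (∑ℕ-init-last (f ∘ suc))) (sym (ℕₚ.+-assoc (f zero) _ _))

∑ℕ-cycle : ∀ {A : Set} {k} (f : A → A → ℕ) (x : Fin (suc k) → A) →
  ∑ℕ (λ i → f (x i) (x (next i))) ≡ ∑ℕ (λ i → f (x (inject₁ i)) (x (suc i))) ℕ.+ f (x (fromℕ k)) (x zero)
∑ℕ-cycle {k = k} f x = trans (∑ℕ-init-last (λ i → f (x i) (x (next i))))
  (cong₂ ℕ._+_ (∑ℕ-cong λ i → cong (λ j → f (x (inject₁ i)) (x j)) (next-inject₁ i)) (cong (λ j → f (x (fromℕ k)) (x j)) (next-fromℕ k)))

∑ℕ-next : ∀ {m} (f : Fin m → ℕ) → ∑ℕ (f ∘ next) ≡ ∑ℕ f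
∑ℕ-next {zero}  f = refl
∑ℕ-next {suc k} f = trans (∑ℕ-cycle (λ _ j → f j) id) (ℕₚ.+-comm _ (f zero))

-- How many hinge vertices a, b and how many apexes of a link lie in a vertex set.
Cell : Set
Cell = Fin 3 × Fin 2

hinges apexes : Cell → ℕ
hinges = toℕ ∘ proj₁
apexes = toℕ ∘ proj₂

size : Cell → ℕ
size x = hinges x ℕ.+ apexes x

-- The ends of a hinge are nonadjacent and have the same neighbours, so the number of them in the
-- set is all that matters: consecutive hinges are completely joined, and the apex is joined to
-- both.
induced : Cell → Cell → ℕ
induced x y = hinges x * hinges y ℕ.+ apexes x * (hinges x ℕ.+ hinges y)

Sparse : ∀ {m} → (Fin m → Cell) → Set
Sparse x = ∑ℕ (λ i → induced (x i) (x (next i))) ℕ.+ 7 ≤ 3 * ∑ℕ (size ∘ x)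

-- A lower bound on 3 n - e for a set of n vertices met so far, s of them on
-- the current hinge, going around from a hinge that misses the set.
deficit : ℕ → ℕ → ℕ
deficit 0 _ = 0
deficit 1 _ = 3
-- Two vertices on one hinge are not adjacent; any other two may be.
deficit 2 2 = 6
deficit 2 _ = 5
deficit 3 _ = 6
-- Four vertices met on the way never form a K₄, which would leave 6. A whole butterfly attains 15 -
-- 8 = 7.
deficit _ _ = 7

-- The step adds the apex of `x` and the hinge vertices of `y`. From four vertices on the deficit
-- stays at 7 and the new edges are at most three per new vertex; below that, finitely many cases
-- are evaluated.
deficit-step : ∀ n (x y : Cell) → hinges x ≤ n →
  deficit (n ℕ.+ (apexes x ℕ.+ hinges y)) (hinges y) ℕ.+ induced x y ≤ deficit n (hinges x) ℕ.+ 3 * (apexes x ℕ.+ hinges y)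
deficit-step n (s , z) (s′ , z′) s≤n with n ℕ.<? 4
... | yes n<4 = subst (λ n → toℕ s ≤ n → deficit (n ℕ.+ (toℕ z ℕ.+ toℕ s′)) (toℕ s′) ℕ.+ (toℕ s * toℕ s′ ℕ.+ toℕ z * (toℕ s ℕ.+ toℕ s′)) ≤ deficit n (toℕ s) ℕ.+ 3 * (toℕ z ℕ.+ toℕ s′))
  (Finₚ.toℕ-fromℕ< n<4) (few (fromℕ< n<4) s s′ z) s≤n
  where
  few : ∀ (n : Fin 4) (s s′ : Fin 3) (z : Fin 2) → toℕ s ≤ toℕ n →
    deficit (toℕ n ℕ.+ (toℕ z ℕ.+ toℕ s′)) (toℕ s′) ℕ.+ (toℕ s * toℕ s′ ℕ.+ toℕ z * (toℕ s ℕ.+ toℕ s′)) ≤ deficit (toℕ n) (toℕ s) ℕ.+ 3 * (toℕ z ℕ.+ toℕ s′)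
  few = toWitness {a? = Finₚ.all? λ n → Finₚ.all? λ s → Finₚ.all? λ s′ → Finₚ.all? λ z → (toℕ s ℕ.≤? toℕ n) →-dec (_ ℕ.≤? _)} tt
... | no n≮4 with ℕₚ.m≤n⇒∃[o]m+o≡n (ℕₚ.≮⇒≥ n≮4)
...   | k , refl = ℕₚ.+-monoʳ-≤ 7 (many s s′ z)
  where
  many : ∀ (s s′ : Fin 3) (z : Fin 2) → toℕ s * toℕ s′ ℕ.+ toℕ z * (toℕ s ℕ.+ toℕ s′) ≤ 3 * (toℕ z ℕ.+ toℕ s′)
  many = toWitness {a? = Finₚ.all? λ s → Finₚ.all? λ s′ → Finₚ.all? λ z → _ ℕ.≤? _} tt

deficit-extend : ∀ n e (x y : Cell) → hinges x ≤ n → deficit n (hinges x) ℕ.+ e ≤ 3 * n →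
  deficit (n ℕ.+ (apexes x ℕ.+ hinges y)) (hinges y) ℕ.+ (e ℕ.+ induced x y) ≤ 3 * (n ℕ.+ (apexes x ℕ.+ hinges y))
deficit-extend n e x y s≤n bound = begin
  deficit n′ (hinges y) ℕ.+ (e ℕ.+ induced x y)    ≡⟨ ℕ-solve 3 (λ d e i → d ⊹ (e ⊹ i) ≔ (d ⊹ i) ⊹ e) refl (deficit n′ (hinges y)) e (induced x y) ⟩
  deficit n′ (hinges y) ℕ.+ induced x y ℕ.+ e      ≤⟨ ℕₚ.+-monoˡ-≤ e (deficit-step n x y s≤n) ⟩
  deficit n (hinges x) ℕ.+ 3 * k ℕ.+ e             ≡⟨ ℕ-solve 3 (λ d k e → d ⊹ k ⊹ e ≔ d ⊹ e ⊹ k) refl (deficit n (hinges x)) (3 * k) e ⟩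
  deficit n (hinges x) ℕ.+ e ℕ.+ 3 * k             ≤⟨ ℕₚ.+-monoˡ-≤ (3 * k) bound ⟩
  3 * n ℕ.+ 3 * k                                  ≡⟨ ℕₚ.*-distribˡ-+ 3 n k ⟨
  3 * n′                                           ∎
  where
  open ℕₚ.≤-Reasoning
  k n′ : ℕ
  k = apexes x ℕ.+ hinges y
  n′ = n ℕ.+ k

deficit-path : ∀ {k} (x : Fin (suc k) → Cell) n e → hinges (x zero) ≤ n → deficit n (hinges (x zero)) ℕ.+ e ≤ 3 * n →
  let n′ = n ℕ.+ ∑ℕ (λ i → apexes (x (inject₁ i)) ℕ.+ hinges (x (suc i)))
      e′ = e ℕ.+ ∑ℕ (λ i → induced (x (inject₁ i)) (x (suc i)))
  in hinges (x (fromℕ k)) ≤ n′ × deficit n′ (hinges (x (fromℕ k))) ℕ.+ e′ ≤ 3 * n′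
deficit-path {zero}  x n e s≤n bound =
  subst₂ (λ n e → hinges (x zero) ≤ n × deficit n (hinges (x zero)) ℕ.+ e ≤ 3 * n)
    (sym (ℕₚ.+-identityʳ n)) (sym (ℕₚ.+-identityʳ e)) (s≤n , bound)
deficit-path {suc k} x n e s≤n bound =
  subst₂ (λ n e → hinges (x (fromℕ (suc k))) ≤ n × deficit n (hinges (x (fromℕ (suc k)))) ℕ.+ e ≤ 3 * n)
    (ℕₚ.+-assoc n _ _) (ℕₚ.+-assoc e _ _)
    (deficit-path (x ∘ suc) _ _ (ℕₚ.≤-trans (ℕₚ.m≤n+m _ (apexes (x zero))) (ℕₚ.m≤n+m _ n))
      (deficit-extend n e (x zero) (x (suc zero)) s≤n bound))

-- Since the walk starts and ends at a hinge that misses the set, closing the cycle counts no vertex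
-- twice, and five vertices bring the deficit to 7.
sparse-from-zero : ∀ {k} (x : Fin (suc k) → Cell) → hinges (x zero) ≡ 0 → 5 ≤ ∑ℕ (size ∘ x) → Sparse x
sparse-from-zero {k} x s≡0 5≤n =
  let s≤n , bound = deficit-path x 0 0 (ℕₚ.≤-reflexive s≡0) z≤n
      final = deficit-extend n e (x (fromℕ k)) (x zero) s≤n bound
  in conclude (subst₂ (λ n e → deficit n (hinges (x zero)) ℕ.+ e ≤ 3 * n) total (sym (∑ℕ-cycle induced x)) final)
  where
  n e : ℕ
  n = ∑ℕ (λ i → apexes (x (inject₁ i)) ℕ.+ hinges (x (suc i)))
  e = ∑ℕ (λ i → induced (x (inject₁ i)) (x (suc i)))
  total : n ℕ.+ (apexes (x (fromℕ k)) ℕ.+ hinges (x zero)) ≡ ∑ℕ (size ∘ x)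
  total = begin
    n ℕ.+ (apexes (x (fromℕ k)) ℕ.+ hinges (x zero))         ≡⟨ ∑ℕ-cycle (λ x y → apexes x ℕ.+ hinges y) x ⟨
    ∑ℕ (λ i → apexes (x i) ℕ.+ hinges (x (next i)))          ≡⟨ ∑ℕ-+ (apexes ∘ x) (λ i → hinges (x (next i))) ⟩
    ∑ℕ (apexes ∘ x) ℕ.+ ∑ℕ (λ i → hinges (x (next i)))       ≡⟨ cong (∑ℕ (apexes ∘ x) ℕ.+_) (∑ℕ-next (hinges ∘ x)) ⟩
    ∑ℕ (apexes ∘ x) ℕ.+ ∑ℕ (hinges ∘ x)                      ≡⟨ ℕₚ.+-comm (∑ℕ (apexes ∘ x)) _ ⟩
    ∑ℕ (hinges ∘ x) ℕ.+ ∑ℕ (apexes ∘ x)                      ≡⟨ ∑ℕ-+ (hinges ∘ x) (apexes ∘ x) ⟨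
    ∑ℕ (size ∘ x)                                            ∎
    where open ≡-Reasoning
  deficit≥5 : ∀ {n} s → 5 ≤ n → deficit n s ≡ 7
  deficit≥5 s (s≤s (s≤s (s≤s (s≤s (s≤s _))))) = refl
  conclude : ∀ {e} → deficit (∑ℕ (size ∘ x)) (hinges (x zero)) ℕ.+ e ≤ 3 * ∑ℕ (size ∘ x) → e ℕ.+ 7 ≤ 3 * ∑ℕ (size ∘ x)
  conclude {e} bound = subst (_≤ 3 * ∑ℕ (size ∘ x)) (trans (cong (ℕ._+ e) (deficit≥5 (hinges (x zero)) 5≤n)) (ℕₚ.+-comm 7 e)) bound

-- Rotating the ring by one link lowers the index of the missed hinge by one and preserves both
-- sums.
sparse-from-miss : ∀ {m} (i : Fin m) (x : Fin m → Cell) → hinges (x i) ≡ 0 → 5 ≤ ∑ℕ (size ∘ x) → Sparse x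
sparse-from-miss {suc k} = FinInd.<-weakInduction (λ i → ∀ x → hinges (x i) ≡ 0 → 5 ≤ ∑ℕ (size ∘ x) → Sparse x)
  sparse-from-zero
  λ i rotated x s≡0 5≤n → subst₂ (λ e n → e ℕ.+ 7 ≤ 3 * n)
    (∑ℕ-next (λ i → induced (x i) (x (next i)))) (∑ℕ-next (size ∘ x))
    (rotated (x ∘ next) (trans (cong (hinges ∘ x) (next-inject₁ i)) s≡0) (subst (5 ≤_) (sym (∑ℕ-next (size ∘ x))) 5≤n))

-- When both hinges of a link are hit, twice its edge count plus 2 is at most 3 s + 3 s′ + 6 z, with
-- equality for a full butterfly. Summed around the ring this is 2 e + 2 m ≤ 6 n, and m ≥ 7 gives
-- the claim.
sparse-from-hits : ∀ {m} → 7 ≤ m → (x : Fin m → Cell) → (∀ i → hinges (x i) ≢ 0) → Sparse x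
sparse-from-hits {m} 7≤m x hit = ℕₚ.*-cancelˡ-≤ 2 (begin
  2 * (∑ℕ e ℕ.+ 7)                              ≤⟨ ℕₚ.*-monoʳ-≤ 2 (ℕₚ.+-monoʳ-≤ (∑ℕ e) 7≤m) ⟩
  2 * (∑ℕ e ℕ.+ m)                              ≡⟨ trans (ℕₚ.*-distribˡ-+ 2 (∑ℕ e) m) (cong₂ ℕ._+_ (sym (∑ℕ-* 2 e)) (trans (ℕₚ.*-comm 2 m) (sym (∑ℕ-const m 2)))) ⟩
  ∑ℕ (λ i → 2 * e i) ℕ.+ ∑ℕ {m} (λ _ → 2)       ≡⟨ ∑ℕ-+ (λ i → 2 * e i) (λ _ → 2) ⟨
  ∑ℕ (λ i → 2 * e i ℕ.+ 2)                      ≤⟨ ∑ℕ-mono (λ i → link (proj₁ (x i)) (proj₁ (x (next i))) (proj₂ (x i)) (hit i) (hit (next i))) ⟩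
  ∑ℕ (λ i → 3 * s i ℕ.+ (3 * s (next i) ℕ.+ 6 * z i))
    ≡⟨ trans (∑ℕ-+ (λ i → 3 * s i) (λ i → 3 * s (next i) ℕ.+ 6 * z i)) (cong₂ ℕ._+_ (∑ℕ-* 3 s)
         (trans (∑ℕ-+ (λ i → 3 * s (next i)) (λ i → 6 * z i)) (cong₂ ℕ._+_ (trans (∑ℕ-* 3 (s ∘ next)) (cong (3 *_) (∑ℕ-next s))) (∑ℕ-* 6 z)))) ⟩
  3 * ∑ℕ s ℕ.+ (3 * ∑ℕ s ℕ.+ 6 * ∑ℕ z)          ≡⟨ ℕ-solve 2 (λ s z → kon 3 ⊠ᴺ s ⊹ (kon 3 ⊠ᴺ s ⊹ kon 6 ⊠ᴺ z) ≔ kon 2 ⊠ᴺ (kon 3 ⊠ᴺ (s ⊹ z))) refl (∑ℕ s) (∑ℕ z) ⟩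
  2 * (3 * (∑ℕ s ℕ.+ ∑ℕ z))                     ≡⟨ cong (λ n → 2 * (3 * n)) (∑ℕ-+ s z) ⟨
  2 * (3 * ∑ℕ (size ∘ x))                       ∎)
  where
  open ℕₚ.≤-Reasoning
  s z e : Fin m → ℕ
  s = hinges ∘ x
  z = apexes ∘ x
  e i = induced (x i) (x (next i))
  link : ∀ (s s′ : Fin 3) (z : Fin 2) → toℕ s ≢ 0 → toℕ s′ ≢ 0 →
    2 * (toℕ s * toℕ s′ ℕ.+ toℕ z * (toℕ s ℕ.+ toℕ s′)) ℕ.+ 2 ≤ 3 * toℕ s ℕ.+ (3 * toℕ s′ ℕ.+ 6 * toℕ z)
  link = toWitness {a? = Finₚ.all? λ s → Finₚ.all? λ s′ → Finₚ.all? λ z →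
    ¬? (toℕ s ℕ.≟ 0) →-dec (¬? (toℕ s′ ℕ.≟ 0) →-dec (_ ℕ.≤? _))} tt

sparse : ∀ {m} → 7 ≤ m → (x : Fin m → Cell) → 5 ≤ ∑ℕ (size ∘ x) → Sparse x
sparse 7≤m x 5≤n with Finₚ.any? (λ i → hinges (x i) ℕ.≟ 0)
... | yes (i , s≡0) = sparse-from-miss i x s≡0 5≤n
... | no hit        = sparse-from-hits 7≤m x λ i s≡0 → hit (i , s≡0)

bit : Bool → Fin 2
bit false = 0F
bit true  = 1F

cell : Bool → Bool → Bool → Cell
cell false false z = 0F , bit z
cell false true  z = 1F , bit z
cell true  false z = 1F , bit z
cell true  true  z = 2F , bit z

size-cell : ∀ a b z → size (cell a b z) ≡ toℕ (bit a) ℕ.+ (toℕ (bit b) ℕ.+ toℕ (bit z))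
size-cell false false z = refl
size-cell false true  z = refl
size-cell true  false z = refl
size-cell true  true  z = refl

cells : ∀ {m} → Subset (m * 3) → Fin m → Cell
cells S i = cell (Vec.lookup S (vtx i 0F)) (Vec.lookup S (vtx i 1F)) (Vec.lookup S (vtx i 2F))

∣∷∣ : ∀ {n} b (S : Subset n) → ∣ b ∷ S ∣ ≡ toℕ (bit b) ℕ.+ ∣ S ∣
∣∷∣ false S = refl
∣∷∣ true  S = refl

∣S∣≡∑size : ∀ {m} (S : Subset (m * 3)) → ∣ S ∣ ≡ ∑ℕ (size ∘ cells {m} S)
∣S∣≡∑size {zero}  []              = refl
∣S∣≡∑size {suc m} (a ∷ b ∷ z ∷ S) = begin
  ∣ a ∷ b ∷ z ∷ S ∣                                                        ≡⟨ ∣∷∣ a (b ∷ z ∷ S) ⟩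
  toℕ (bit a) ℕ.+ ∣ b ∷ z ∷ S ∣                                            ≡⟨ cong (toℕ (bit a) ℕ.+_) (trans (∣∷∣ b (z ∷ S)) (cong (toℕ (bit b) ℕ.+_) (∣∷∣ z S))) ⟩
  toℕ (bit a) ℕ.+ (toℕ (bit b) ℕ.+ (toℕ (bit z) ℕ.+ ∣ S ∣))                ≡⟨ ℕ-solve 4 (λ a b z s → a ⊹ (b ⊹ (z ⊹ s)) ≔ (a ⊹ (b ⊹ z)) ⊹ s) refl (toℕ (bit a)) (toℕ (bit b)) (toℕ (bit z)) ∣ S ∣ ⟩
  toℕ (bit a) ℕ.+ (toℕ (bit b) ℕ.+ toℕ (bit z)) ℕ.+ ∣ S ∣                  ≡⟨ cong₂ ℕ._+_ (sym (size-cell a b z)) (∣S∣≡∑size {m} S) ⟩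
  size (cell a b z) ℕ.+ ∑ℕ (size ∘ cells {m} S)                            ∎
  where open ≡-Reasoning

weight : ∀ {n} → Subset n → Edge n → ℕ
weight S (u , v) = toℕ (bit (Vec.lookup S u)) * toℕ (bit (Vec.lookup S v))

totalWeight : ∀ {n} → Subset n → List (Edge n) → ℕ
totalWeight S es = ListAction.sum (List.map (weight S) es)

length≤totalWeight : ∀ {n} (S : Subset n) {xs ys} → xs ⊆ ys → All (λ e → proj₁ e ∈ₛ S × proj₂ e ∈ₛ S) xs →
  length xs ≤ totalWeight S ys
length≤totalWeight S []         _ = z≤n
length≤totalWeight S (y ∷ʳ τ)   within = ℕₚ.≤-trans (length≤totalWeight S τ within) (ℕₚ.m≤n+m _ (weight S y))
length≤totalWeight S (_∷_ {x = u , v} refl τ) ((u∈ , v∈) ∷ within) = ℕₚ.+-mono-≤ (ℕₚ.≤-reflexive (sym one)) (length≤totalWeight S τ within)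
  where
  one : weight S (u , v) ≡ 1
  one = cong₂ (λ a b → toℕ (bit a) * toℕ (bit b)) (Vecₚ.[]=⇒lookup u∈) (Vecₚ.[]=⇒lookup v∈)

totalWeight-link : ∀ {m} (S : Subset (m * 3)) (j : Fin m) → totalWeight S (linkEdges j) ≡ induced (cells S j) (cells S (next j))
totalWeight-link S j = count (Vec.lookup S (vtx j 0F)) (Vec.lookup S (vtx j 1F)) (Vec.lookup S (vtx j 2F))
  (Vec.lookup S (vtx (next j) 0F)) (Vec.lookup S (vtx (next j) 1F)) (Vec.lookup S (vtx (next j) 2F))
  where
  hinges-cell : ∀ a b z → hinges (cell a b z) ≡ toℕ (bit a) ℕ.+ toℕ (bit b)
  hinges-cell false false z = refl
  hinges-cell false true  z = refl
  hinges-cell true  false z = refl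
  hinges-cell true  true  z = refl
  apexes-cell : ∀ a b z → apexes (cell a b z) ≡ toℕ (bit z)
  apexes-cell false false z = refl
  apexes-cell false true  z = refl
  apexes-cell true  false z = refl
  apexes-cell true  true  z = refl
  count : ∀ a b z c d z′ → let # = toℕ ∘ bit in
    # a * # c ℕ.+ (# a * # d ℕ.+ (# b * # c ℕ.+ (# b * # d ℕ.+ (# z * # a ℕ.+ (# z * # b ℕ.+ (# z * # c ℕ.+ (# z * # d ℕ.+ 0))))))) ≡
    induced (cell a b z) (cell c d z′)
  count a b z c d z′ rewrite hinges-cell a b z | apexes-cell a b z | hinges-cell c d z′ =
    ℕ-solve 5 (λ a b z c d → a ⊠ᴺ c ⊹ (a ⊠ᴺ d ⊹ (b ⊠ᴺ c ⊹ (b ⊠ᴺ d ⊹ (z ⊠ᴺ a ⊹ (z ⊠ᴺ b ⊹ (z ⊠ᴺ c ⊹ (z ⊠ᴺ d ⊹ kon 0)))))))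
      ≔ (a ⊹ b) ⊠ᴺ (c ⊹ d) ⊹ z ⊠ᴺ ((a ⊹ b) ⊹ (c ⊹ d))) refl (toℕ (bit a)) (toℕ (bit b)) (toℕ (bit z)) (toℕ (bit c)) (toℕ (bit d))

totalWeight-concatMap : ∀ {A : Set} {n k} (S : Subset n) (G : A → List (Edge n)) (f : Fin k → A) →
  totalWeight S (concatMap G (tabulate f)) ≡ ∑ℕ (λ i → totalWeight S (G (f i)))
totalWeight-concatMap {k = zero}  S G f = refl
totalWeight-concatMap {k = suc k} S G f = begin
  totalWeight S (G (f zero) ++ rest)                                             ≡⟨ cong ListAction.sum (Listₚ.map-++ (weight S) (G (f zero)) rest) ⟩
  ListAction.sum (List.map (weight S) (G (f zero)) ++ List.map (weight S) rest)        ≡⟨ ListActionₚ.sum-++ (List.map (weight S) (G (f zero))) _ ⟩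
  totalWeight S (G (f zero)) ℕ.+ totalWeight S rest                              ≡⟨ cong (totalWeight S (G (f zero)) ℕ.+_) (totalWeight-concatMap S G (f ∘ suc)) ⟩
  totalWeight S (G (f zero)) ℕ.+ ∑ℕ (λ i → totalWeight S (G (f (suc i))))        ∎
  where
  open ≡-Reasoning
  rest = concatMap G (tabulate (f ∘ suc))

ring-nucleationFree : ∀ {m} → 7 ≤ m → NucleationFree (ringEdges m)
ring-nucleationFree {m} 7≤m (S , H , H⊆ , within , 5≤∣S∣ , (sub , sub⊆ , length≡ , _) , _) = ℕₚ.1+n≰n (begin
  suc (3 * n)                  ≤⟨ ℕₚ.+-monoʳ-≤ 1 (ℕₚ.m≤n+m∸n (3 * n) 6) ⟩
  7 ℕ.+ (3 * n ∸ 6)            ≤⟨ ℕₚ.+-monoʳ-≤ 7 3n∸6≤e ⟩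
  7 ℕ.+ e                      ≡⟨ ℕₚ.+-comm 7 e ⟩
  e ℕ.+ 7                      ≤⟨ sparse 7≤m (cells {m} S) (subst (5 ≤_) (∣S∣≡∑size {m} S) 5≤∣S∣) ⟩
  3 * n                        ∎)
  where
  open ℕₚ.≤-Reasoning
  n e : ℕ
  n = ∑ℕ (size ∘ cells {m} S)
  e = ∑ℕ (λ i → induced (cells {m} S i) (cells {m} S (next i)))
  3n∸6≤e : 3 * n ∸ 6 ≤ e
  3n∸6≤e = begin
    3 * n ∸ 6                                    ≡⟨ cong (λ n → 3 * n ∸ 6) (∣S∣≡∑size {m} S) ⟨
    3 * ∣ S ∣ ∸ 6                                ≡⟨ length≡ ⟨
    length sub                                   ≤⟨ Subₚ.length-mono-≤ sub⊆ ⟩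
    length H                                     ≤⟨ length≤totalWeight S H⊆ within ⟩
    totalWeight S (ringEdges m)                  ≡⟨ totalWeight-concatMap S (linkEdges {m}) id ⟩
    ∑ℕ (λ j → totalWeight S (linkEdges {m} j))   ≡⟨ ∑ℕ-cong (totalWeight-link {m} S) ⟩
    e                                            ∎

-- Hinges as nonedges, and the union of the cases m ≤ 5 and m ≥ 6

ring∈link : ∀ {m} {e : Edge (m * 3)} → e ∈ ringEdges m → ∃ λ (j : Fin m) → e ∈ linkEdges j
ring∈link {m} {e} e∈ with find (∈-concatMap⁻ linkEdges {xs = allFin m} e∈)
... | j , _ , e∈link = j , e∈link

vtx-injective : ∀ {m} {i j : Fin m} {s t} → vtx i s ≡ vtx j t → i ≡ j × s ≡ t
vtx-injective = Finₚ.combine-injective _ _ _ _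

-- The positions 0 and 1 of the ends exclude every edge of a link except (a, d), or (b, c) in the
-- reversed direction. That edge would join a link to itself, so that `next j` would be `j`.
hinge-nonedge : ∀ {m} → 2 ≤ m → (i : Fin m) → ¬ Adjacent (ringEdges m) (vtx i 0F) (vtx i 1F)
hinge-nonedge {m} 2≤m i (inj₁ e∈) with ring∈link {m} e∈
... | j , link = forward link
  where
  forward : ¬ (vtx i 0F , vtx i 1F) ∈ linkEdges j
  forward (here eq) = case proj₂ (vtx-injective {m} (cong proj₂ eq)) of λ ()
  forward (there (here eq)) = next-≢ 2≤m j (trans (sym (proj₁ (vtx-injective {m} (cong proj₂ eq)))) (proj₁ (vtx-injective {m} (cong proj₁ eq))))
  forward (there (there (here eq))) = case proj₂ (vtx-injective {m} (cong proj₁ eq)) of λ ()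
  forward (there (there (there (here eq)))) = case proj₂ (vtx-injective {m} (cong proj₁ eq)) of λ ()
  forward (there (there (there (there (here eq))))) = case proj₂ (vtx-injective {m} (cong proj₁ eq)) of λ ()
  forward (there (there (there (there (there (here eq)))))) = case proj₂ (vtx-injective {m} (cong proj₁ eq)) of λ ()
  forward (there (there (there (there (there (there (here eq))))))) = case proj₂ (vtx-injective {m} (cong proj₁ eq)) of λ ()
  forward (there (there (there (there (there (there (there (here eq)))))))) = case proj₂ (vtx-injective {m} (cong proj₁ eq)) of λ ()
hinge-nonedge {m} 2≤m i (inj₂ e∈) with ring∈link {m} e∈
... | j , link = backward link
  where
  backward : ¬ (vtx i 1F , vtx i 0F) ∈ linkEdges j
  backward (here eq) = case proj₂ (vtx-injective {m} (cong proj₁ eq)) of λ ()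
  backward (there (here eq)) = case proj₂ (vtx-injective {m} (cong proj₁ eq)) of λ ()
  backward (there (there (here eq))) = next-≢ 2≤m j (trans (sym (proj₁ (vtx-injective {m} (cong proj₂ eq)))) (proj₁ (vtx-injective {m} (cong proj₁ eq))))
  backward (there (there (there (here eq)))) = case proj₂ (vtx-injective {m} (cong proj₂ eq)) of λ ()
  backward (there (there (there (there (here eq))))) = case proj₂ (vtx-injective {m} (cong proj₁ eq)) of λ ()
  backward (there (there (there (there (there (here eq)))))) = case proj₂ (vtx-injective {m} (cong proj₁ eq)) of λ ()
  backward (there (there (there (there (there (there (here eq))))))) = case proj₂ (vtx-injective {m} (cong proj₁ eq)) of λ ()
  backward (there (there (there (there (there (there (there (here eq)))))))) = case proj₂ (vtx-injective {m} (cong proj₁ eq)) of λ ()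

module _ {m} (6≤m : 6 ≤ m) where

  largeRing-circuitFamily : ∀ (h : Fin m) → CircuitFamily (ringPlacement 6≤m) (lookup (hinge h ∷ ringEdges m))
  largeRing-circuitFamily h = subst (λ es → CircuitFamily (ringPlacement 6≤m) (lookup es)) (sym (hinge∷ring≡tabulate h))
    (circuitFamily-tabulate (ringPlacement 6≤m) (hingeAndRing h) (ring-circuitFamily 6≤m h))

  largeRing-dependent : ∀ (h : Fin m) → Dependent (hinge h ∷ ringEdges m)
  largeRing-dependent h (p , ind) = hingeAndRing-dependent h p (independentFamily-tabulate p (hingeAndRing h)
    (independentAt⇒independentFamily p (tabulate (hingeAndRing h)) (subst (IndependentAt p) (hinge∷ring≡tabulate h) ind)))

  largeRing-circuit : ∀ (h : Fin m) → IsCircuit (hinge h ∷ ringEdges m)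
  largeRing-circuit h = isCircuit (ringPlacement 6≤m) (hinge h ∷ ringEdges m) (largeRing-circuitFamily h) (largeRing-dependent h)

  -- The ring is the circuit without its bar, hence a proper sublist of it.
  largeRing-independent : Independent (ringEdges m)
  largeRing-independent = properSublist-independent (ringPlacement 6≤m) {ringEdges m} {hinge h ∷ ringEdges m}
    (largeRing-circuitFamily h) (hinge h ∷ʳ Sub.⊆-refl) ℕₚ.≤-refl
    where
    h : Fin m
    h = Fin.inject≤ 0F 6≤m

impliedHinge : ∀ {m} → 3 ≤ m → HingeCircuits m
impliedHinge {3} _ h = hingeCircuits₃ h
impliedHinge {4} _ h = hingeCircuits₄ h
impliedHinge {5} _ h = hingeCircuits₅ h
impliedHinge {suc (suc (suc (suc (suc (suc m)))))} _ h =
  _ , Sub.⊆-refl , here refl , largeRing-circuit (s≤s (s≤s (s≤s (s≤s (s≤s (s≤s z≤n)))))) h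
impliedHinge {0} ()
impliedHinge {1} (s≤s ())
impliedHinge {2} (s≤s (s≤s ()))

independent-rank : ∀ {n} {es : List (Edge n)} → Independent es → IsRank es (length es)
independent-rank {es = es} ind = (es , Sub.⊆-refl , refl , ind) ,
  λ (sub , sub⊆ , length≡ , _) → ℕₚ.<-irrefl refl (subst (_≤ length es) length≡ (Subₚ.length-mono-≤ sub⊆))

length-ring : ∀ m → length (ringEdges m) ≡ m * 8
length-ring zero      = refl
length-ring m@(suc _) = ℕₚ.suc-injective (trans (cong length (hinge∷ring≡tabulate {m} zero)) (Listₚ.length-tabulate (hingeAndRing {m} zero)))

flexes : ∀ m → 6 ≤ m → 3 * (m * 3) ∸ 6 ∸ m * 8 ≡ m ∸ 6
flexes m 6≤m = begin
  3 * (m * 3) ∸ 6 ∸ m * 8      ≡⟨ ℕₚ.∸-+-assoc (3 * (m * 3)) 6 (m * 8) ⟩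
  3 * (m * 3) ∸ (6 ℕ.+ m * 8)  ≡⟨ cong₂ _∸_ (ℕ-solve 1 (λ m → kon 3 ⊠ᴺ (m ⊠ᴺ kon 3) ≔ m ⊠ᴺ kon 8 ⊹ m) refl m) (ℕₚ.+-comm 6 (m * 8)) ⟩
  m * 8 ℕ.+ m ∸ (m * 8 ℕ.+ 6)  ≡⟨ ℕₚ.[m+n]∸[m+o]≡n∸o (m * 8) m 6 ⟩
  m ∸ 6                        ∎
  where open ≡-Reasoning

theorem1 : (m : ℕ) → 3 ≤ m →
    ((i : Fin m) → ImpliedNonedge (ringEdges m) (hinge i)) ×
    (7 ≤ m → NucleationFree (ringEdges m)) ×
    (6 ≤ m → Independent (ringEdges m) ×
       ∃ λ r → IsRank (ringEdges m) r × (3 * (m * 3) ∸ 6 ∸ r ≡ m ∸ 6)) ×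
    (m ≤ 5 → Dependent (ringEdges m))
theorem1 m 3≤m =
  (λ i → (λ a≡b → case proj₂ (vtx-injective {m} a≡b) of λ ()) ,
         hinge-nonedge (ℕₚ.≤-trans (s≤s (s≤s z≤n)) 3≤m) i , impliedHinge 3≤m i) ,
  ring-nucleationFree ,
  (λ 6≤m → let ind = largeRing-independent 6≤m in
    ind , m * 8 , subst (IsRank (ringEdges m)) (length-ring m) (independent-rank ind) , flexes m 6≤m) ,
  smallRing-dependent 3≤m
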